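{- Let $p\ge 3$ be a prime, let $N$ be a positive integer coprime to $p$, and let $\alpha\ge 0$ be an integer. (1) If $p\equiv 1 \pmod 3$, then $\overline{p}(3p^{6\alpha+5}N)\equiv 0 \pmod 3$ and $\overline{p}(3p^{18\alpha+17}N)\equiv 0 \pmod 9$. (2) If $p\equiv 2 \pmod 3$, then $\overline{p}(3p^{4\alpha+3}N)\equiv 0 \pmod 9$.
   Context: An overpartition of a nonnegative integer $n$ is a partition of $n$ in which the first occurrence of each distinct part may (or may not) be overlined; $\overline{p}(n)$ denotes the number of overpartitions of $n$ (with $\overline{p}(0)=1$). Equivalently, $\sum_{n\ge0}\overline{p}(n)q^n=\prod_{k\ge1}\frac{1+q^k}{1-q^k}$. -}

module Defs where

open import Data.Bool.Base using (Bool; true; false)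
open import Data.List.Base
  using (List; []; _∷_; _++_; map; length; replicate; concatMap; cartesianProductWith; upTo; filter)
open import Data.List.Membership.Propositional using (_∈_; lose; find)
open import Data.List.Membership.Propositional.Properties
  using (∈-concatMap⁺; ∈-concatMap⁻; ∈-cartesianProductWith⁺; ∈-cartesianProductWith⁻;
         ∈-upTo⁺; ∈-upTo⁻; ∈-map⁻; ∈-++⁻)
open import Data.List.Properties using (++-cancelˡ; filter-accept; filter-none)
open import Data.List.Relation.Unary.All as All using (All; []; _∷_)
import Data.List.Relation.Unary.All.Properties as All
import Data.List.Relation.Unary.AllPairs as AllPairs
import Data.List.Relation.Unary.AllPairs.Properties as AllPairs
open import Data.List.Relation.Unary.Any using (here; there)
open import Data.List.Relation.Unary.Linked as Linked using (Linked; []; [-]; _∷_)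
open import Data.List.Relation.Unary.Unique.Propositional using (Unique)
import Data.List.Relation.Unary.Unique.Propositional.Properties as Unique
open import Data.List.Relation.Binary.Disjoint.Propositional using (Disjoint)
open import Data.Nat.Base
open import Data.Nat.DivMod using (_/_; m/n*n≤m; m*n/n≡m; /-monoˡ-≤)
open import Data.Nat.ListAction using (sum)
open import Data.Nat.Properties
open import Data.Product.Base using (∃; ∃₂; _×_; _,_; proj₁; proj₂)
open import Data.Sum.Base using (_⊎_; inj₁; inj₂)
open import Function.Base using (_∘_)
open import Function.Bundles using (_⇔_; mk⇔)
open import Relation.Nullary using (contradiction)
open import Relation.Binary.PropositionalEquality

record Part : Set where
  constructor part
  field
    size      : ℕ
    overlined : Bool

open Part public

-- p ≽ q: the part q may come right after p in an overpartition written in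
-- weakly decreasing order. If q repeats the size of p, it is not the first
-- occurrence of its size, hence it is not overlined.

infix 4 _≽_

_≽_ : Part → Part → Set
p ≽ q = size q < size p ⊎ (size q ≡ size p × overlined q ≡ false)

record IsOverpartition (n : ℕ) (ps : List Part) : Set where
  constructor isOverpartition
  field
    positive : All (λ p → 0 < size p) ps
    ordered  : Linked _≽_ ps
    total    : sum (map size ps) ≡ n

-- j parts of size k contribute one factor 1 (j = 0) or 2 (j > 0) to the count:
-- only the first of them may be overlined.

copies : ℕ → ℕ → List (List Part)
copies k zero    = [] ∷ []
copies k (suc j) = map (λ o → part k o ∷ replicate j (part k false)) (true ∷ false ∷ [])

-- The overpartitions of n into parts of size at most k, grouped by the
-- number j of parts of size k.

overpartitions≤ : ℕ → ℕ → List (List Part)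
overpartitions≤ zero    zero    = [] ∷ []
overpartitions≤ zero    (suc n) = []
overpartitions≤ (suc k) n       =
  concatMap
    (λ j → cartesianProductWith _++_ (copies (suc k) j) (overpartitions≤ k (n ∸ j * suc k)))
    (upTo (suc (n / suc k)))

overpartitions : ℕ → List (List Part)
overpartitions n = overpartitions≤ n n

-- By ∈-overpartitions and overpartitions-unique, this is the number of lists
-- satisfying IsOverpartition n.

p̄ : ℕ → ℕ
p̄ n = length (overpartitions n)

private
  variable
    k n : ℕ
    ps qs : List Part

  Bounded : ℕ → List Part → Set
  Bounded k = All (λ p → size p ≤ k)

  weight : List Part → ℕ
  weight ps = sum (map size ps)

  plain : ℕ → ℕ → List Part
  plain k j = replicate j (part k false)

  copies⁻ : ∀ {cs} k j → cs ∈ copies k (suc j) → ∃ λ o → cs ≡ part k o ∷ plain k j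
  copies⁻ k j cs∈ with o , _ , eq ← ∈-map⁻ (λ o → part k o ∷ plain k j) cs∈ = o , eq

  copies⁺ : ∀ k j o → part k o ∷ plain k j ∈ copies k (suc j)
  copies⁺ k j true  = here refl
  copies⁺ k j false = there (here refl)

  plain-weight : ∀ k j qs → weight (plain k j ++ qs) ≡ j * k + weight qs
  plain-weight k zero    qs = refl
  plain-weight k (suc j) qs =
    trans (cong (k +_) (plain-weight k j qs)) (sym (+-assoc k (j * k) (weight qs)))

  plain-bounded : ∀ j → Bounded k qs → Bounded (suc k) (plain (suc k) j ++ qs)
  plain-bounded zero    b = All.map m≤n⇒m≤1+n b
  plain-bounded (suc j) b = ≤-refl ∷ plain-bounded j b

  plain-positive : ∀ k j → All (λ p → 0 < size p) qs →
                   All (λ p → 0 < size p) (plain (suc k) j ++ qs)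
  plain-positive k zero    ps = ps
  plain-positive k (suc j) ps = z<s ∷ plain-positive k j ps

  plain-ordered : ∀ {o} j → Bounded k qs → Linked _≽_ qs →
                  Linked _≽_ (part (suc k) o ∷ plain (suc k) j ++ qs)
  plain-ordered zero    []      []  = [-]
  plain-ordered zero    (b ∷ _) l   = inj₁ (s≤s b) ∷ l
  plain-ordered (suc j) b       l   = inj₂ (refl , refl) ∷ plain-ordered j b l

  ≽⇒≥ : ∀ {p q} → p ≽ q → size q ≤ size p
  ≽⇒≥ (inj₁ q<p)       = <⇒≤ q<p
  ≽⇒≥ (inj₂ (q≡p , _)) = ≤-reflexive q≡p

  ordered-bounded : ∀ {p} → Linked _≽_ (p ∷ ps) → size p ≤ k → Bounded k (p ∷ ps)
  ordered-bounded [-]     p≤k = p≤k ∷ []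
  ordered-bounded {p = p} (_∷_ {y = q} r l) p≤k =
    p≤k ∷ ordered-bounded l (≤-trans (≽⇒≥ {p} {q} r) p≤k)

  split : ∀ {o} ps → Linked _≽_ (part (suc k) o ∷ ps) →
          ∃₂ λ j qs → ps ≡ plain (suc k) j ++ qs × Bounded k qs × Linked _≽_ qs
  split []       _ = 0 , [] , refl , [] , []
  split (p ∷ ps) (inj₁ (s≤s p≤k) ∷ l) = 0 , p ∷ ps , refl , ordered-bounded l p≤k , l
  split (p ∷ ps) (inj₂ (refl , refl) ∷ l)
    with j , qs , refl , b , l′ ← split ps l = suc j , qs , refl , b , l′

  cons-copies : ∀ k n j cs qs → cs ∈ copies (suc k) j → j * suc k ≤ n →
                Bounded k qs × IsOverpartition (n ∸ j * suc k) qs →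
                Bounded (suc k) (cs ++ qs) × IsOverpartition n (cs ++ qs)
  cons-copies k n zero cs qs (here refl) _ (b , isOverpartition p l t) =
    All.map m≤n⇒m≤1+n b , isOverpartition p l t
  cons-copies k n (suc j) cs qs cs∈ j≤ (b , isOverpartition p l t)
    with o , refl ← copies⁻ (suc k) j cs∈ =
    ≤-refl ∷ plain-bounded j b , isOverpartition (z<s ∷ plain-positive k j p)
      (plain-ordered j b l)
      (begin
        suc k + weight (plain (suc k) j ++ qs)  ≡⟨ plain-weight (suc k) (suc j) qs ⟩
        suc j * suc k + weight qs               ≡⟨ cong (suc j * suc k +_) t ⟩
        suc j * suc k + (n ∸ suc j * suc k)     ≡⟨ m+[n∸m]≡n j≤ ⟩
        n                                       ∎)
    where open ≡-Reasoning

  sound : ∀ k n → ps ∈ overpartitions≤ k n → Bounded k ps × IsOverpartition n ps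
  sound zero    zero (here refl) = [] , isOverpartition [] [] refl
  sound (suc k) n    ps∈
    with j , j∈ , ps∈ⱼ ← find (∈-concatMap⁻ _ {xs = upTo (suc (n / suc k))} ps∈)
    with cs , qs , cs∈ , qs∈ , refl ←
         ∈-cartesianProductWith⁻ _++_ (copies (suc k) j) (overpartitions≤ k (n ∸ j * suc k)) ps∈ⱼ
    = cons-copies k n j cs qs cs∈
        (≤-trans (*-monoˡ-≤ (suc k) (≤-pred (∈-upTo⁻ j∈))) (m/n*n≤m n (suc k)))
        (sound k (n ∸ j * suc k) qs∈)

  assemble : ∀ k n j {cs qs} → cs ∈ copies (suc k) j → j * suc k ≤ n →
             qs ∈ overpartitions≤ k (n ∸ j * suc k) → cs ++ qs ∈ overpartitions≤ (suc k) n
  assemble k n j cs∈ j≤ qs∈ =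
    ∈-concatMap⁺ _ (lose (∈-upTo⁺ (s≤s j≤n/k)) (∈-cartesianProductWith⁺ _++_ cs∈ qs∈))
    where
    j≤n/k : j ≤ n / suc k
    j≤n/k = subst (_≤ n / suc k) (m*n/n≡m j (suc k)) (/-monoˡ-≤ (suc k) j≤)

  complete : ∀ k n → Bounded k ps → IsOverpartition n ps → ps ∈ overpartitions≤ k n
  complete zero _ []         (isOverpartition _ _ refl) = here refl
  complete zero _ (p≤0 ∷ _) (isOverpartition (0<p ∷ _) _ _) = contradiction p≤0 (<⇒≱ 0<p)
  complete (suc k) n [] o = assemble k n 0 (here refl) z≤n (complete k n [] o)
  complete {ps = part s o ∷ ps} (suc k) n (s≤ ∷ b) op@(isOverpartition (_ ∷ pos) l t)
    with m≤n⇒m<n∨m≡n s≤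
  ... | inj₁ (s≤s s≤k) =
    assemble k n 0 (here refl) z≤n (complete k n (ordered-bounded l s≤k) op)
  ... | inj₂ refl with j , qs , refl , b′ , l′ ← split ps l =
    assemble k n (suc j) (copies⁺ (suc k) j o)
      (subst (suc j * suc k ≤_) total (m≤m+n (suc j * suc k) (weight qs)))
      (complete k (n ∸ suc j * suc k) b′
        (isOverpartition (All.++⁻ʳ (plain (suc k) j) pos) l′
          (trans (sym (m+n∸m≡n (suc j * suc k) (weight qs))) (cong (_∸ suc j * suc k) total))))
    where
    total : suc j * suc k + weight qs ≡ n
    total = trans (sym (plain-weight (suc k) (suc j) qs)) t

  weight-bounded : ∀ ps → Bounded (weight ps) ps
  weight-bounded []       = []
  weight-bounded (p ∷ ps) =
    m≤m+n _ _ ∷ All.map (λ q≤ → ≤-trans q≤ (m≤n+m (weight ps) (size p))) (weight-bounded ps)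

∈-overpartitions : ps ∈ overpartitions n ⇔ IsOverpartition n ps
∈-overpartitions {ps} {n} = mk⇔ (proj₂ ∘ sound n n) λ op →
  complete n n (subst (λ m → Bounded m ps) (IsOverpartition.total op) (weight-bounded ps)) op

private
  multiplicity : ℕ → List Part → ℕ
  multiplicity k ps = length (filter (λ p → size p ≟ k) ps)

  multiplicity-bounded : Bounded k qs → multiplicity (suc k) qs ≡ 0
  multiplicity-bounded {k} b =
    cong length (filter-none (λ p → size p ≟ suc k) (All.map (λ q≤k → <⇒≢ (s≤s q≤k)) b))

  multiplicity-∷ : ∀ k o ps → multiplicity k (part k o ∷ ps) ≡ suc (multiplicity k ps)
  multiplicity-∷ k o ps = cong length (filter-accept (λ p → size p ≟ k) {part k o} {ps} refl)

  multiplicity-plain : ∀ j → Bounded k qs → multiplicity (suc k) (plain (suc k) j ++ qs) ≡ j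
  multiplicity-plain zero b = multiplicity-bounded b
  multiplicity-plain {k} {qs} (suc j) b =
    trans (multiplicity-∷ (suc k) false (plain (suc k) j ++ qs))
          (cong suc (multiplicity-plain j b))

  multiplicity-copies : ∀ {cs} j → cs ∈ copies (suc k) j → Bounded k qs →
                        multiplicity (suc k) (cs ++ qs) ≡ j
  multiplicity-copies zero (here refl) b = multiplicity-bounded b
  multiplicity-copies {k} {qs} (suc j) cs∈ b with o , refl ← copies⁻ (suc k) j cs∈ =
    trans (multiplicity-∷ (suc k) o (plain (suc k) j ++ qs)) (cong suc (multiplicity-plain j b))

  block : ℕ → ℕ → ℕ → List (List Part)
  block k n j = cartesianProductWith _++_ (copies (suc k) j) (overpartitions≤ k (n ∸ j * suc k))

  multiplicity-block : ∀ k n j → ps ∈ block k n j → multiplicity (suc k) ps ≡ j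
  multiplicity-block k n j ps∈
    with cs , qs , cs∈ , qs∈ , refl ←
         ∈-cartesianProductWith⁻ _++_ (copies (suc k) j) (overpartitions≤ k (n ∸ j * suc k)) ps∈
    = multiplicity-copies j cs∈ (proj₁ (sound k (n ∸ j * suc k) qs∈))

  block-disjoint : ∀ k n {i j} → i < j → Disjoint (block k n i) (block k n j)
  block-disjoint k n {i} {j} i<j (∈i , ∈j) =
    <⇒≢ i<j (trans (sym (multiplicity-block k n i ∈i)) (multiplicity-block k n j ∈j))

  unique≤ : ∀ k n → Unique (overpartitions≤ k n)
  unique≤ zero    zero    = [] AllPairs.∷ AllPairs.[]
  unique≤ zero    (suc n) = AllPairs.[]
  unique≤ (suc k) n       = Unique.concat⁺
    (All.map⁺ (All.universal block-unique (upTo (suc (n / suc k)))))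
    (AllPairs.map⁺ (AllPairs.applyUpTo⁺₁ (λ j → j) (suc (n / suc k)) λ i<j _ → block-disjoint k n i<j))
    where
    prepend : ∀ cs j → Unique (map (cs ++_) (overpartitions≤ k (n ∸ j * suc k)))
    prepend cs j = Unique.map⁺ (++-cancelˡ cs _ _) (unique≤ k (n ∸ j * suc k))

    block-unique : ∀ j → Unique (block k n j)
    block-unique zero    = Unique.++⁺ (prepend [] 0) AllPairs.[] λ ()
    block-unique (suc j) =
      Unique.++⁺ (prepend _ (suc j)) (Unique.++⁺ (prepend _ (suc j)) AllPairs.[] λ ()) disjoint
      where
      L = overpartitions≤ k (n ∸ suc j * suc k)

      disjoint : Disjoint
        (map ((part (suc k) true ∷ plain (suc k) j) ++_) L)
        (map ((part (suc k) false ∷ plain (suc k) j) ++_) L ++ [])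
      disjoint (∈₁ , ∈₂) with ∈-map⁻ _ ∈₁ | ∈-++⁻ (map ((part (suc k) false ∷ plain (suc k) j) ++_) L) ∈₂
      ... | _ , _ , refl | inj₁ ∈₂′ with ∈-map⁻ _ ∈₂′
      ...   | _ , _ , ()

overpartitions-unique : ∀ n → Unique (overpartitions n)
overpartitions-unique n = unique≤ n n

{-# OPTIONS --safe #-}

-- Write φ = Σ (-1)^s q^(s²) (s ∈ ℤ), P = Σ p̄(n) q^n and θ = q d/dq. The product formula gives
-- θ P = P C with C = Σ (1 - (-1)^x) a q^(ax), and an involution on the solutions of s² + ax = n
-- gives θ φ = - φ C; hence φ P = 1. Series with the same logarithmic derivative and the same
-- constant term agree, which yields two more identities: the 3-dissection Σ p̄(3n) q^n · φ⁴ = φ(q³)³,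
-- from the eigenvalue of C under the Hecke operator at 3, and Jacobi's
-- φ⁴ = 1 - 8 Σ (-1)^(a+x) a q^(ax), from Liouville's bijections on ax + by = n. As
-- φ(q³)³ ≡ φ⁹ (mod 9), p̄(3n) is congruent modulo 9 to the coefficient of q^n in φ φ⁴, which for
-- nonsquare n is ± 8 (F(4n) - 4 F(n)), where F(D) = Σ c over the (a, b, c) with b² + 4ac = D, a, c > 0.
--
-- F satisfies F(p²D) + p³ F(D/p²) = (p³ + 1) F(D) when p divides D: by Zagier's argument the sum of
-- the positive values Q(u, v) over the forms Q of nonsquare discriminant D with Q(1, 0) < 0 equals
-- v² F(D), and applying this at (u, v) = (j, p), 0 ≤ j < p, counts the forms of discriminant p²D.
-- So F(p^(2k+1) M) = (1 + p³ + ... + p^(3k)) F(pM) when p ∤ M, and the geometric sum vanishes modulo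
-- 3 or 9 in the cases of the theorem.

module Submission where

open import Defs
open import Data.Integer.Base using (ℤ; +_; -[1+_]; 0ℤ; 1ℤ; -1ℤ; -_; _-_; +<+)
import Data.Integer.Properties as ℤ
open import Data.Integer.Tactic.RingSolver using (solve-∀)
import Data.Nat.Base as ℕ
open ℕ using (ℕ; zero; suc; z≤n; s≤s)
import Data.Nat.Divisibility as ℕ
import Data.Nat.Properties as ℕ
import Data.Nat.Tactic.RingSolver as ℕ-Solver
open import Data.Product.Base using (∃; _×_; _,_; proj₁; proj₂)
open import Data.Product.Properties using (≡-dec)
open import Data.Sum.Base as Sum using (_⊎_; inj₁; inj₂; [_,_]′; reduce)
open import Data.Empty using (⊥)
open import Data.Unit.Base using (⊤; tt)
open import Function.Base using (_∘_; id)
open import Relation.Nullary using (¬_; ¬?; yes; no; contradiction; _×-dec_)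
open import Relation.Unary using (Decidable)
open import Relation.Binary.PropositionalEquality
  using (_≡_; _≢_; refl; sym; trans; cong; cong₂; subst; module ≡-Reasoning)

-- The exponent of p in n = p^(2k+1) N is odd, so n and 4n are never squares. This removes two
-- degenerate contributions: the coefficient of q^n in φ itself, and the forms that vanish at (1, 0)
-- or (0, 1), which would disturb Zagier's sum. For D the discriminant of a real quadratic field K,
-- Siegel's formula says F(D) = 60 ζ_K(-1); at nonsquare D, F is up to normalisation a coefficient
-- of Cohen's Eisenstein series of weight 5/2, hence the eigenvalue p³ + 1. The Hecke relation at p²
-- has in general a further term (D/p) p F(D). It vanishes for p | D, which is why the recursion
-- starts at pM instead of M. The modulus 9 arises because cubing lifts φ³ ≡ φ(q³) (mod 3) to a
-- congruence modulo 9. Since p³ ≡ ±1 (mod 9) according to p ≡ ±1 (mod 3), the sum 1 + p³ + ... +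
-- p^(3k) is modulo 9 either k + 1 or an alternating sum; so k is 3α + 2, 9α + 8 or 2α + 1, and 2k +
-- 1 is the exponent in the theorem.

-- Sums over finite sets given by predicates

module FiniteSums where

  open import Data.Integer.Base using (_+_; _*_)
  open import Data.List.Base using (List; []; _∷_; _++_; map; filter; deduplicate; upTo; applyUpTo)
  open import Data.List.Membership.Propositional using (_∈_)
  open import Data.List.Membership.Propositional.Properties
    using (∈-map⁺; ∈-map⁻; ∈-filter⁺; ∈-filter⁻; ∈-++⁺ˡ; ∈-++⁺ʳ; ∈-++⁻; ∈-deduplicate⁺; ∈-upTo⁺; ∈-upTo⁻)
  open import Data.List.Membership.Propositional.Properties.WithK using (unique∧set⇒bag)
  open import Data.List.Relation.Binary.BagAndSetEquality using (∼bag⇒↭)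
  open import Data.List.Relation.Binary.Permutation.Propositional using (_↭_; prep)
    renaming (refl to ↭-refl; swap to ↭-swap; trans to ↭-trans)
  open import Data.List.Relation.Unary.All as All using (All; []; _∷_)
  import Data.List.Relation.Unary.All.Properties as All
  open import Data.List.Relation.Unary.AllPairs using ([]; _∷_)
  open import Data.List.Relation.Unary.Any using (here; there)
  open import Data.List.Relation.Unary.Unique.Propositional using (Unique)
  import Data.List.Relation.Unary.Unique.Propositional.Properties as Unique
  import Data.List.Relation.Unary.Unique.DecPropositional.Properties as DecUnique
  open import Function.Bundles using (mk⇔)
  open import Relation.Binary.Definitions using (DecidableEquality)
  open ≡-Reasoning

  private
    variable
      A B : Set
      P Q R : A → Set
      v w : A → ℤ

  ∑ˡ : List A → (A → ℤ) → ℤ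
  ∑ˡ []       w = 0ℤ
  ∑ˡ (x ∷ xs) w = w x + ∑ˡ xs w

  ∑ˡ-cong : ∀ (xs : List A) → (∀ {x} → x ∈ xs → v x ≡ w x) → ∑ˡ xs v ≡ ∑ˡ xs w
  ∑ˡ-cong []       v≡w = refl
  ∑ˡ-cong (x ∷ xs) v≡w = cong₂ _+_ (v≡w (here refl)) (∑ˡ-cong xs (v≡w ∘ there))

  ∑ˡ-+ : ∀ (xs : List A) (v w : A → ℤ) → ∑ˡ xs (λ x → v x + w x) ≡ ∑ˡ xs v + ∑ˡ xs w
  ∑ˡ-+ []       v w = refl
  ∑ˡ-+ (x ∷ xs) v w = trans (cong (_+_ (v x + w x)) (∑ˡ-+ xs v w)) (interchange (v x) (w x) _ _)
    where
    interchange : ∀ a b c d → (a + b) + (c + d) ≡ (a + c) + (b + d)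
    interchange = solve-∀

  ∑ˡ-* : ∀ k (xs : List A) (w : A → ℤ) → ∑ˡ xs (λ x → k * w x) ≡ k * ∑ˡ xs w
  ∑ˡ-* k []       w = sym (ℤ.*-zeroʳ k)
  ∑ˡ-* k (x ∷ xs) w =
    trans (cong (_+_ (k * w x)) (∑ˡ-* k xs w)) (sym (ℤ.*-distribˡ-+ k (w x) (∑ˡ xs w)))

  ∑ˡ-++ : ∀ (xs ys : List A) (w : A → ℤ) → ∑ˡ (xs ++ ys) w ≡ ∑ˡ xs w + ∑ˡ ys w
  ∑ˡ-++ []       ys w = sym (ℤ.+-identityˡ _)
  ∑ˡ-++ (x ∷ xs) ys w = trans (cong (_+_ (w x)) (∑ˡ-++ xs ys w)) (sym (ℤ.+-assoc (w x) (∑ˡ xs w) (∑ˡ ys w)))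

  ∑ˡ-map : ∀ (f : A → B) xs (w : B → ℤ) → ∑ˡ (map f xs) w ≡ ∑ˡ xs (w ∘ f)
  ∑ˡ-map f []       w = refl
  ∑ˡ-map f (x ∷ xs) w = cong (_+_ (w (f x))) (∑ˡ-map f xs w)

  ∑ˡ-↭ : ∀ {xs ys : List A} (w : A → ℤ) → xs ↭ ys → ∑ˡ xs w ≡ ∑ˡ ys w
  ∑ˡ-↭ w ↭-refl         = refl
  ∑ˡ-↭ w (prep x p)   = cong (_+_ (w x)) (∑ˡ-↭ w p)
  ∑ˡ-↭ w (↭-swap x y p) = trans (cong (λ s → w x + (w y + s)) (∑ˡ-↭ w p)) (exchange (w x) (w y) _)
    where
    exchange : ∀ a b c → a + (b + c) ≡ b + (a + c)
    exchange = solve-∀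
  ∑ˡ-↭ w (↭-trans p q)  = trans (∑ˡ-↭ w p) (∑ˡ-↭ w q)

  -- A finite set is given by its defining property; the list only witnesses finiteness. Sums are
  -- transported along bijections between properties, and by `∑-indep` the chosen witness never
  -- matters.
  record Finite {A : Set} (P : A → Set) : Set where
    field
      elements : List A
      unique   : Unique elements
      sound    : ∀ {x} → x ∈ elements → P x
      complete : ∀ {x} → P x → x ∈ elements

  open Finite public

  opaque

    ∑ : {P : A → Set} → Finite P → (A → ℤ) → ℤ
    ∑ F w = ∑ˡ (elements F) w

    ∑-elements : (F : Finite P) (w : A → ℤ) → ∑ F w ≡ ∑ˡ (elements F) w
    ∑-elements F w = refl

    ∑-cong : (F : Finite P) → (∀ x → P x → v x ≡ w x) → ∑ F v ≡ ∑ F w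
    ∑-cong F v≡w = ∑ˡ-cong (elements F) λ x∈ → v≡w _ (sound F x∈)

    ∑-+ : (F : Finite P) (v w : A → ℤ) → ∑ F (λ x → v x + w x) ≡ ∑ F v + ∑ F w
    ∑-+ F = ∑ˡ-+ (elements F)

    ∑-* : ∀ k (F : Finite P) (w : A → ℤ) → ∑ F (λ x → k * w x) ≡ k * ∑ F w
    ∑-* k F = ∑ˡ-* k (elements F)

  ∑-neg : ∀ (F : Finite P) (w : A → ℤ) → ∑ F (λ x → - w x) ≡ - ∑ F w
  ∑-neg F w = begin
    ∑ F (λ x → - w x)      ≡⟨ ∑-cong F (λ x _ → sym (ℤ.-1*i≡-i (w x))) ⟩
    ∑ F (λ x → -1ℤ * w x)  ≡⟨ ∑-* -1ℤ F w ⟩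
    -1ℤ * ∑ F w            ≡⟨ ℤ.-1*i≡-i _ ⟩
    - ∑ F w                ∎

  ∑-zero : (F : Finite P) → (∀ x → P x → w x ≡ 0ℤ) → ∑ F w ≡ 0ℤ
  ∑-zero F w≡0 = trans (∑-cong F w≡0) (∑-* 0ℤ F (λ _ → 0ℤ))

  ∑-empty : (F : Finite P) → (∀ x → ¬ P x) → ∑ F w ≡ 0ℤ
  ∑-empty F ¬P = ∑-zero F λ x p → contradiction p (¬P x)

  empty : (∀ x → ¬ P x) → Finite P
  empty ¬P = record
    { elements = []
    ; unique   = []
    ; sound    = λ ()
    ; complete = λ {x} p → contradiction p (¬P x)
    }

  map-unique : (f : A → B) (xs : List A) → (∀ {x} → x ∈ xs → P x) →
               (∀ {x y} → P x → P y → f x ≡ f y → x ≡ y) → Unique xs → Unique (map f xs)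
  map-unique f []       s inj []        = []
  map-unique f (x ∷ xs) s inj (x∉ ∷ u) =
    All.map⁺ (All.tabulate λ y∈ eq → All.lookup x∉ y∈ (inj (s (here refl)) (s (there y∈)) eq))
    ∷ map-unique f xs (s ∘ there) inj u

  image : {P : A → Set} {Q : B → Set} (f : A → B) → (∀ {x} → P x → Q (f x)) → (∀ {x y} → P x → P y → f x ≡ f y → x ≡ y) →
          (∀ {y} → Q y → ∃ λ x → P x × f x ≡ y) → Finite P → Finite Q
  image {Q = Q} f to inj surj F = record
    { elements = map f (elements F)
    ; unique   = map-unique f (elements F) (sound F) inj (unique F)
    ; sound    = λ y∈ → let x , x∈ , eq = ∈-map⁻ f y∈ in subst Q (sym eq) (to (sound F x∈))
    ; complete = λ q → let x , p , eq = surj q in subst (_∈ _) eq (∈-map⁺ f (complete F p))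
    }

  opaque
    unfolding ∑

    -- Two repetition-free lists with the same members are permutations of each other: the absence
    -- of repetitions upgrades equality as sets to equality as multisets.
    ∑-indep : (F G : Finite P) (w : A → ℤ) → ∑ F w ≡ ∑ G w
    ∑-indep F G w = ∑ˡ-↭ w (∼bag⇒↭ (unique∧set⇒bag (unique F) (unique G)
      (mk⇔ (complete G ∘ sound F) (complete F ∘ sound G))))

    ∑-bij : (F : Finite P) (G : Finite Q) (f : A → B) → (∀ {x} → P x → Q (f x)) →
            (∀ {x y} → P x → P y → f x ≡ f y → x ≡ y) → (∀ {y} → Q y → ∃ λ x → P x × f x ≡ y) →
            (∀ x → P x → v x ≡ w (f x)) → ∑ F v ≡ ∑ G w
    ∑-bij {v = v} {w = w} F G f to inj surj v≡w = begin
      ∑ F v                        ≡⟨ ∑-cong F v≡w ⟩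
      ∑ F (w ∘ f)                  ≡⟨ ∑ˡ-map f (elements F) w ⟨
      ∑ (image f to inj surj F) w  ≡⟨ ∑-indep (image f to inj surj F) G w ⟩
      ∑ G w                        ∎

  ∑-inverse : (F : Finite P) (G : Finite Q) (f : A → B) (g : B → A) →
              (∀ {x} → P x → Q (f x)) → (∀ {y} → Q y → P (g y)) →
              (∀ x → P x → g (f x) ≡ x) → (∀ y → Q y → f (g y) ≡ y) →
              (∀ x → P x → v x ≡ w (f x)) → ∑ F v ≡ ∑ G w
  ∑-inverse F G f g to from gf fg = ∑-bij F G f to
    (λ p q eq → trans (sym (gf _ p)) (trans (cong g eq) (gf _ q)))
    (λ q → g _ , from q , fg _ q)

  i≡-i⇒i≡0 : ∀ {i} → i ≡ - i → i ≡ 0ℤ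
  i≡-i⇒i≡0 {i} eq = ℤ.*-cancelˡ-≡ (+ 2) i 0ℤ (begin
    + 2 * i  ≡⟨ double i ⟩
    i + i    ≡⟨ cong (_+ i) eq ⟩
    - i + i  ≡⟨ ℤ.+-inverseˡ i ⟩
    0ℤ       ∎)
    where
    double : ∀ i → + 2 * i ≡ i + i
    double = solve-∀

  -- The sum equals its own negative, and ℤ has no 2-torsion. Fixed points of `f` are allowed: the
  -- hypothesis forces their weight to be 0.
  ∑-cancel : (F : Finite P) (f : A → A) → (∀ {x} → P x → P (f x)) → (∀ x → P x → f (f x) ≡ x) →
             (∀ x → P x → w x ≡ - w (f x)) → ∑ F w ≡ 0ℤ
  ∑-cancel {w = w} F f to ff w≡ = i≡-i⇒i≡0
    (trans (∑-inverse F F f f to to ff ff w≡) (∑-neg F w))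

  infixl 6 _∩_

  _∩_ : Finite P → Decidable Q → Finite (λ x → P x × Q x)
  F ∩ Q? = record
    { elements = filter Q? (elements F)
    ; unique   = Unique.filter⁺ Q? (unique F)
    ; sound    = λ x∈ → let x∈′ , q = ∈-filter⁻ Q? x∈ in sound F x∈′ , q
    ; complete = λ (p , q) → ∈-filter⁺ Q? (complete F p) q
    }

  union : Finite P → Finite Q → (∀ {x} → P x → ¬ Q x) → Finite (λ x → P x ⊎ Q x)
  union F G disj = record
    { elements = elements F ++ elements G
    ; unique   = Unique.++⁺ (unique F) (unique G) λ (x∈F , x∈G) → disj (sound F x∈F) (sound G x∈G)
    ; sound    = λ x∈ → [ inj₁ ∘ sound F , inj₂ ∘ sound G ]′ (∈-++⁻ (elements F) x∈)
    ; complete = [ ∈-++⁺ˡ ∘ complete F , ∈-++⁺ʳ (elements F) ∘ complete G ]′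
    }

  relabel : (∀ {x} → P x → Q x) → (∀ {x} → Q x → P x) → Finite P → Finite Q
  relabel to from F = record
    { elements = elements F
    ; unique   = unique F
    ; sound    = to ∘ sound F
    ; complete = complete F ∘ from
    }

  opaque
    unfolding ∑

    ∑-split : (F : Finite P) (G : Finite Q) (H : Finite R) → (∀ {x} → P x → Q x ⊎ R x) →
              (∀ {x} → Q x → P x) → (∀ {x} → R x → P x) → (∀ {x} → Q x → ¬ R x) →
              (w : A → ℤ) → ∑ F w ≡ ∑ G w + ∑ H w
    ∑-split F G H to from₁ from₂ disj w = trans
      (∑-indep F (relabel [ from₁ , from₂ ]′ to (union G H disj)) w)
      (∑ˡ-++ (elements G) (elements H) w)

  ∑-∩ : (F : Finite P) (Q? : Decidable Q) (G : Finite (λ x → P x × ¬ Q x)) (w : A → ℤ) →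
        ∑ F w ≡ ∑ (F ∩ Q?) w + ∑ G w
  ∑-∩ {P = P} {Q = Q} F Q? G = ∑-split F (F ∩ Q?) G to proj₁ proj₁ λ (_ , q) (_ , ¬q) → ¬q q
    where
    to : ∀ {x} → P x → (P x × Q x) ⊎ (P x × ¬ Q x)
    to {x} p with Q? x
    ... | yes q = inj₁ (p , q)
    ... | no ¬q = inj₂ (p , ¬q)

  -- Any list containing all solutions will do, so finiteness comes down to an a priori bound on the
  -- coordinates.
  cover : DecidableEquality A → Decidable P → (xs : List A) → (∀ {x} → P x → x ∈ xs) → Finite P
  cover _≟_ P? xs c = record
    { elements = filter P? (deduplicate _≟_ xs)
    ; unique   = Unique.filter⁺ P? (DecUnique.deduplicate-! _≟_ xs)
    ; sound    = λ x∈ → proj₂ (∈-filter⁻ P? {xs = deduplicate _≟_ xs} x∈)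
    ; complete = λ p → ∈-filter⁺ P? (∈-deduplicate⁺ _≟_ (c p)) p
    }

  module _ {A B : Set} {R : A → B → Set} (G : ∀ a → Finite (R a)) where

    private
      fibres : List A → List (A × B)
      fibres []       = []
      fibres (x ∷ xs) = map (x ,_) (elements (G x)) ++ fibres xs

      fibres⁻ : ∀ {a b} xs → (a , b) ∈ fibres xs → a ∈ xs × R a b
      fibres⁻ (x ∷ xs) ab∈ with ∈-++⁻ (map (x ,_) (elements (G x))) ab∈
      ... | inj₁ ∈x with _ , b∈ , refl ← ∈-map⁻ (x ,_) ∈x = here refl , sound (G x) b∈
      ... | inj₂ ∈xs = let a∈ , r = fibres⁻ xs ∈xs in there a∈ , r

      fibres⁺ : ∀ {a b} xs → a ∈ xs → R a b → (a , b) ∈ fibres xs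
      fibres⁺ (x ∷ xs) (here refl) r = ∈-++⁺ˡ (∈-map⁺ (x ,_) (complete (G x) r))
      fibres⁺ (x ∷ xs) (there a∈)  r = ∈-++⁺ʳ (map (x ,_) (elements (G x))) (fibres⁺ xs a∈ r)

      fibres-unique : ∀ xs → Unique xs → Unique (fibres xs)
      fibres-unique []       []        = []
      fibres-unique (x ∷ xs) (x∉ ∷ u) = Unique.++⁺
        (Unique.map⁺ (λ { refl → refl }) (unique (G x))) (fibres-unique xs u) disjoint
        where
        disjoint : ∀ {ab} → ab ∈ map (x ,_) (elements (G x)) × ab ∈ fibres xs → ⊥
        disjoint (∈x , ∈xs) with _ , _ , refl ← ∈-map⁻ (x ,_) ∈x =
          All.lookup x∉ (proj₁ (fibres⁻ xs ∈xs)) refl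

      ∑ˡ-fibres : ∀ xs (w : A × B → ℤ) →
                  ∑ˡ (fibres xs) w ≡ ∑ˡ xs (λ a → ∑ (G a) (λ b → w (a , b)))
      ∑ˡ-fibres []       w = refl
      ∑ˡ-fibres (x ∷ xs) w = trans (∑ˡ-++ (map (x ,_) (elements (G x))) (fibres xs) w)
        (cong₂ _+_ (trans (∑ˡ-map (x ,_) (elements (G x)) w) (sym (∑-elements (G x) _))) (∑ˡ-fibres xs w))

    -- The index set of an iterated sum. Elements over different first components are distinct, so
    -- concatenating the fibres creates no repetition.
    dependent : {P : A → Set} → Finite P → Finite (λ (a , b) → P a × R a b)
    dependent F = record
      { elements = fibres (elements F)
      ; unique   = fibres-unique (elements F) (unique F)
      ; sound    = λ ab∈ → let a∈ , r = fibres⁻ (elements F) ab∈ in sound F a∈ , r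
      ; complete = λ (p , r) → fibres⁺ (elements F) (complete F p) r
      }

    opaque
      unfolding ∑

      ∑-dependent : {P : A → Set} (F : Finite P) (w : A × B → ℤ) →
                    ∑ (dependent F) w ≡ ∑ F (λ a → ∑ (G a) (λ b → w (a , b)))
      ∑-dependent F = ∑ˡ-fibres (elements F)

  product : Finite P → Finite Q → Finite (λ (a , b) → P a × Q b)
  product F G = dependent (λ _ → G) F

  ∑-product : (F : Finite P) (G : Finite Q) (v : A → ℤ) (w : B → ℤ) →
              ∑ (product F G) (λ (a , b) → v a * w b) ≡ ∑ F v * ∑ G w
  ∑-product F G v w = begin
    ∑ (product F G) (λ (a , b) → v a * w b)    ≡⟨ ∑-dependent (λ _ → G) F _ ⟩
    ∑ F (λ a → ∑ G (λ b → v a * w b))          ≡⟨ ∑-cong F (λ a _ → ∑-* (v a) G w) ⟩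
    ∑ F (λ a → v a * ∑ G w)                    ≡⟨ ∑-cong F (λ a _ → ℤ.*-comm (v a) _) ⟩
    ∑ F (λ a → ∑ G w * v a)                    ≡⟨ ∑-* (∑ G w) F v ⟩
    ∑ G w * ∑ F v                              ≡⟨ ℤ.*-comm (∑ G w) _ ⟩
    ∑ F v * ∑ G w                              ∎

  below : ∀ n → Finite (ℕ._< n)
  below n = record
    { elements = upTo n
    ; unique   = Unique.upTo⁺ n
    ; sound    = ∈-upTo⁻
    ; complete = ∈-upTo⁺
    }

  opaque
    unfolding ∑

    ∑ˡ-applyUpTo : ∀ (f : ℕ → A) n (w : A → ℤ) → ∑ˡ (applyUpTo f n) w ≡ ∑ (below n) (w ∘ f)
    ∑ˡ-applyUpTo f n w = go f id n
      where
      go : ∀ f (g : ℕ → ℕ) n → ∑ˡ (applyUpTo (f ∘ g) n) w ≡ ∑ˡ (applyUpTo g n) (w ∘ f)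
      go f g zero    = refl
      go f g (suc n) = cong (_+_ (w (f (g 0)))) (go f (g ∘ suc) n)

    ∑-below-suc : ∀ n (w : ℕ → ℤ) → ∑ (below (suc n)) w ≡ w 0 + ∑ (below n) (w ∘ suc)
    ∑-below-suc n w = cong (_+_ (w 0)) (∑ˡ-applyUpTo suc n w)

-- The ring of formal power series over ℤ

module PowerSeries where

  open import Algebra.Bundles using (CommutativeRing)
  open import Algebra.Bundles.Raw using (RawRing)
  import Algebra.Solver.Ring as RingSolver
  open import Algebra.Solver.Ring.AlmostCommutativeRing
    using (fromCommutativeRing; _-Raw-AlmostCommutative⟶_)
  open import Data.Integer.Base using (_+_; _*_)
  open import Data.Maybe.Base as Maybe using (Maybe)
  open import Level using (0ℓ)
  open import Relation.Binary.Consequences using (dec⇒weaklyDec)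
  import Relation.Binary.Reasoning.Setoid as SetoidReasoning
  open FiniteSums

  Series : Set
  Series = ℕ → ℤ

  infix 4 _≈_

  -- A record rather than a bare function type, so that both series can be inferred from a proof of
  -- equality.
  record _≈_ (f g : Series) : Set where
    constructor coefficientwise
    field at : ∀ n → f n ≡ g n

  open _≈_ public

  infixl 6 _⊕_
  infixl 7 _⊛_
  infix  8 ⊖_

  tail : Series → Series
  tail f n = f (suc n)

  const : ℤ → Series
  const k zero    = k
  const k (suc n) = 0ℤ

  𝟎 𝟏 : Series
  𝟎 _ = 0ℤ
  𝟏 = const 1ℤ

  -- The product follows the decomposition f = f(0) + q · `tail f` of the left factor, so the ring
  -- laws are inductions on the coefficient with f varying; `⊛-∑` recovers the usual convolution
  -- sum.
  _⊕_ _⊛_ : Series → Series → Series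
  (f ⊕ g) n = f n + g n
  (f ⊛ g) zero    = f 0 * g 0
  (f ⊛ g) (suc n) = f 0 * g (suc n) + (tail f ⊛ g) n

  ⊖_ : Series → Series
  (⊖ f) n = - f n

  ≈-refl : ∀ {f} → f ≈ f
  ≈-refl = coefficientwise λ _ → refl

  ≈-sym : ∀ {f g} → f ≈ g → g ≈ f
  ≈-sym p = coefficientwise λ n → sym (at p n)

  ≈-trans : ∀ {f g h} → f ≈ g → g ≈ h → f ≈ h
  ≈-trans p q = coefficientwise λ n → trans (at p n) (at q n)

  ⊛-cong′ : ∀ {f f′ g g′} → (∀ n → f n ≡ f′ n) → (∀ n → g n ≡ g′ n) → ∀ n → (f ⊛ g) n ≡ (f′ ⊛ g′) n
  ⊛-cong′ p q zero    = cong₂ _*_ (p 0) (q 0)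
  ⊛-cong′ p q (suc n) = cong₂ _+_ (cong₂ _*_ (p 0) (q (suc n))) (⊛-cong′ (p ∘ suc) q n)

  ⊛-cong : ∀ {f f′ g g′} → f ≈ f′ → g ≈ g′ → f ⊛ g ≈ f′ ⊛ g′
  ⊛-cong p q = coefficientwise (⊛-cong′ (at p) (at q))

  ⊛-congʳ : ∀ {f g g′} → g ≈ g′ → f ⊛ g ≈ f ⊛ g′
  ⊛-congʳ = ⊛-cong ≈-refl

  ⊛-congˡ : ∀ {f f′ g} → f ≈ f′ → f ⊛ g ≈ f′ ⊛ g
  ⊛-congˡ p = ⊛-cong p ≈-refl

  ⊕-cong : ∀ {f f′ g g′} → f ≈ f′ → g ≈ g′ → f ⊕ g ≈ f′ ⊕ g′
  ⊕-cong p q = coefficientwise λ n → cong₂ _+_ (at p n) (at q n)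

  ⊕-congʳ : ∀ f {g g′} → g ≈ g′ → f ⊕ g ≈ f ⊕ g′
  ⊕-congʳ f q = coefficientwise λ n → cong (_+_ (f n)) (at q n)

  ⊛-zeroˡ : ∀ f n → (𝟎 ⊛ f) n ≡ 0ℤ
  ⊛-zeroˡ f zero    = refl
  ⊛-zeroˡ f (suc n) = trans (ℤ.+-identityˡ _) (⊛-zeroˡ f n)

  ⊛-distribʳ : ∀ f g h n → ((g ⊕ h) ⊛ f) n ≡ (g ⊛ f) n + (h ⊛ f) n
  ⊛-distribʳ f g h zero    = ℤ.*-distribʳ-+ (f 0) (g 0) (h 0)
  ⊛-distribʳ f g h (suc n) =
    trans (cong (_+_ ((g 0 + h 0) * f (suc n))) (⊛-distribʳ f (tail g) (tail h) n))
          (regroup (g 0) (h 0) (f (suc n)) ((tail g ⊛ f) n) ((tail h ⊛ f) n))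
    where
    regroup : ∀ a b c d e → (a + b) * c + (d + e) ≡ (a * c + d) + (b * c + e)
    regroup = solve-∀

  ⊛-scaleˡ : ∀ k f g n → ((λ i → k * f i) ⊛ g) n ≡ k * (f ⊛ g) n
  ⊛-scaleˡ k f g zero    = ℤ.*-assoc k (f 0) (g 0)
  ⊛-scaleˡ k f g (suc n) =
    trans (cong (_+_ (k * f 0 * g (suc n))) (⊛-scaleˡ k (tail f) g n))
          (regroup k (f 0) (g (suc n)) ((tail f ⊛ g) n))
    where
    regroup : ∀ k a b c → k * a * b + k * c ≡ k * (a * b + c)
    regroup = solve-∀

  -- The mirror image of the defining recursion, peeling off the constant term of the right factor.
  -- Commutativity follows by comparing the two.
  ⊛-unfoldʳ : ∀ f g n → (f ⊛ g) (suc n) ≡ g 0 * f (suc n) + (f ⊛ tail g) n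
  ⊛-unfoldʳ f g zero    = swap (f 0) (g 1) (f 1) (g 0)
    where
    swap : ∀ a b c d → a * b + c * d ≡ d * c + a * b
    swap = solve-∀
  ⊛-unfoldʳ f g (suc n) =
    trans (cong (_+_ (f 0 * g (suc (suc n)))) (⊛-unfoldʳ (tail f) g n))
          (exchange (f 0 * g (suc (suc n))) (g 0 * f (suc (suc n))) ((tail f ⊛ tail g) n))
    where
    exchange : ∀ a b c → a + (b + c) ≡ b + (a + c)
    exchange = solve-∀

  ⊛-comm′ : ∀ f g n → (f ⊛ g) n ≡ (g ⊛ f) n
  ⊛-comm′ f g zero    = ℤ.*-comm (f 0) (g 0)
  ⊛-comm′ f g (suc n) =
    trans (cong (_+_ (f 0 * g (suc n))) (⊛-comm′ (tail f) g n)) (sym (⊛-unfoldʳ g f n))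

  ⊛-assoc′ : ∀ f g h n → ((f ⊛ g) ⊛ h) n ≡ (f ⊛ (g ⊛ h)) n
  ⊛-assoc′ f g h zero    = ℤ.*-assoc (f 0) (g 0) (h 0)
  ⊛-assoc′ f g h (suc n) = begin
    f 0 * g 0 * h (suc n) + (((λ i → f 0 * tail g i) ⊕ (tail f ⊛ g)) ⊛ h) n
      ≡⟨ cong (_+_ (f 0 * g 0 * h (suc n))) (begin
           (((λ i → f 0 * tail g i) ⊕ (tail f ⊛ g)) ⊛ h) n
             ≡⟨ ⊛-distribʳ h (λ i → f 0 * tail g i) (tail f ⊛ g) n ⟩
           ((λ i → f 0 * tail g i) ⊛ h) n + ((tail f ⊛ g) ⊛ h) n
             ≡⟨ cong₂ _+_ (⊛-scaleˡ (f 0) (tail g) h n) (⊛-assoc′ (tail f) g h n) ⟩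
           f 0 * (tail g ⊛ h) n + (tail f ⊛ (g ⊛ h)) n ∎) ⟩
    f 0 * g 0 * h (suc n) + (f 0 * (tail g ⊛ h) n + (tail f ⊛ (g ⊛ h)) n)
      ≡⟨ regroup (f 0) (g 0) (h (suc n)) ((tail g ⊛ h) n) ((tail f ⊛ (g ⊛ h)) n) ⟩
    f 0 * (g 0 * h (suc n) + (tail g ⊛ h) n) + (tail f ⊛ (g ⊛ h)) n ∎
    where
    open ≡-Reasoning
    regroup : ∀ a b c d e → a * b * c + (a * d + e) ≡ a * (b * c + d) + e
    regroup = solve-∀

  const-⊛ : ∀ k f n → (const k ⊛ f) n ≡ k * f n
  const-⊛ k f zero    = refl
  const-⊛ k f (suc n) = trans (cong (_+_ (k * f (suc n))) (⊛-zeroˡ f n)) (ℤ.+-identityʳ _)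

  seriesRing : CommutativeRing 0ℓ 0ℓ
  seriesRing = record
    { Carrier = Series ; _≈_ = _≈_ ; _+_ = _⊕_ ; _*_ = _⊛_ ; -_ = ⊖_ ; 0# = 𝟎 ; 1# = 𝟏
    ; isCommutativeRing = record
      { isRing = record
        { +-isAbelianGroup = record
          { isGroup = record
            { isMonoid = record
              { isSemigroup = record
                { isMagma = record
                  { isEquivalence = record { refl = ≈-refl ; sym = ≈-sym ; trans = ≈-trans }
                  ; ∙-cong = ⊕-cong
                  }
                ; assoc = λ f g h → coefficientwise λ n → ℤ.+-assoc (f n) (g n) (h n)
                }
              ; identity = (λ f → coefficientwise λ n → ℤ.+-identityˡ (f n))
                         , (λ f → coefficientwise λ n → ℤ.+-identityʳ (f n))
              }
            ; inverse = (λ f → coefficientwise λ n → ℤ.+-inverseˡ (f n))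
                      , (λ f → coefficientwise λ n → ℤ.+-inverseʳ (f n))
            ; ⁻¹-cong = λ p → coefficientwise λ n → cong -_ (at p n)
            }
          ; comm = λ f g → coefficientwise λ n → ℤ.+-comm (f n) (g n)
          }
        ; *-cong = ⊛-cong
        ; *-assoc = λ f g h → coefficientwise (⊛-assoc′ f g h)
        ; *-identity = identityˡ
                     , (λ f → ≈-trans (⊛-comm f 𝟏) (identityˡ f))
        ; distrib = (λ f g h → ≈-trans (⊛-comm f (g ⊕ h))
                      (≈-trans (coefficientwise (⊛-distribʳ f g h)) (⊕-cong (⊛-comm g f) (⊛-comm h f))))
                  , (λ f g h → coefficientwise (⊛-distribʳ f g h))
        }
      ; *-comm = ⊛-comm
      }
    }
    where
    ⊛-comm : ∀ f g → f ⊛ g ≈ g ⊛ f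
    ⊛-comm f g = coefficientwise (⊛-comm′ f g)

    identityˡ : ∀ f → 𝟏 ⊛ f ≈ f
    identityˡ f = coefficientwise λ n → trans (const-⊛ 1ℤ f n) (ℤ.*-identityˡ (f n))

  open CommutativeRing seriesRing public using (setoid)
    renaming (*-comm to ⊛-comm; *-assoc to ⊛-assoc; *-identityˡ to ⊛-identityˡ;
              *-identityʳ to ⊛-identityʳ; zeroˡ to 𝟎-⊛)

  module ≈-Reasoning = SetoidReasoning setoid

  private
    ℤ-coefficients : RawRing 0ℓ 0ℓ
    ℤ-coefficients = CommutativeRing.rawRing ℤ.+-*-commutativeRing

    constants : ℤ-coefficients -Raw-AlmostCommutative⟶ fromCommutativeRing seriesRing
    constants = record
      { ⟦_⟧    = const
      ; +-homo = λ a b → coefficientwise λ { zero → refl ; (suc n) → refl }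
      ; *-homo = λ a b → coefficientwise λ
          { zero → refl
          ; (suc n) → sym (trans (const-⊛ a (const b) (suc n)) (ℤ.*-zeroʳ a)) }
      ; -‿homo = λ a → coefficientwise λ { zero → refl ; (suc n) → refl }
      ; 0-homo = coefficientwise λ { zero → refl ; (suc n) → refl }
      ; 1-homo = ≈-refl
      }

    _≟ᶜ_ : ∀ a b → Maybe (const a ≈ const b)
    a ≟ᶜ b = Maybe.map (λ { refl → ≈-refl }) (dec⇒weaklyDec ℤ._≟_ a b)

  -- Integers enter as constant series, so that identities with numerical factors such as 3, 9 and
  -- -8 are decided as polynomial identities.
  module Solver = RingSolver ℤ-coefficients (fromCommutativeRing seriesRing) constants _≟ᶜ_

-- The Euler operator, substitution of powers of q, and dissection modulo 3

module Dilation where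

  open import Data.Integer.Base using (_+_; _*_)
  open import Data.Nat.Induction using (<-rec)
  open FiniteSums
  open PowerSeries
  open ≡-Reasoning

  θ : Series → Series
  θ f n = + n * f n

  θ-cong : ∀ {f g} → f ≈ g → θ f ≈ θ g
  θ-cong p = coefficientwise λ n → cong (+ n *_) (at p n)

  θ-⊕ : ∀ f g → θ (f ⊕ g) ≈ θ f ⊕ θ g
  θ-⊕ f g = coefficientwise λ n → ℤ.*-distribˡ-+ (+ n) (f n) (g n)

  +suc : ∀ n x → + suc n * x ≡ + n * x + x
  +suc n x = trans (cong (_* x) (ℤ.pos-+ 1 n)) (expand (+ n) x)
    where
    expand : ∀ n x → (1ℤ + n) * x ≡ n * x + x
    expand = solve-∀

  tail-θ : ∀ f n → tail (θ f) n ≡ (θ (tail f) ⊕ tail f) n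
  tail-θ f n = +suc n (f (suc n))

  θ-⊛ : ∀ f g → θ (f ⊛ g) ≈ θ f ⊛ g ⊕ f ⊛ θ g
  θ-⊛ f g = coefficientwise (go f g)
    where
    go : ∀ f g n → θ (f ⊛ g) n ≡ (θ f ⊛ g ⊕ f ⊛ θ g) n
    go f g zero    = leibniz₀ (f 0) (g 0)
      where
      leibniz₀ : ∀ a b → 0ℤ * (a * b) ≡ 0ℤ * a * b + a * (0ℤ * b)
      leibniz₀ = solve-∀
    go f g (suc n) = begin
      + suc n * (f 0 * g (suc n) + (tail f ⊛ g) n)
        ≡⟨ ℤ.*-distribˡ-+ (+ suc n) (f 0 * g (suc n)) ((tail f ⊛ g) n) ⟩
      + suc n * (f 0 * g (suc n)) + + suc n * (tail f ⊛ g) n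
        ≡⟨ cong (_+_ (+ suc n * (f 0 * g (suc n)))) (begin
             + suc n * (tail f ⊛ g) n            ≡⟨ +suc n ((tail f ⊛ g) n) ⟩
             θ (tail f ⊛ g) n + (tail f ⊛ g) n   ≡⟨ cong (_+ (tail f ⊛ g) n) (go (tail f) g n) ⟩
             (θ (tail f) ⊛ g) n + (tail f ⊛ θ g) n + (tail f ⊛ g) n  ∎) ⟩
      + suc n * (f 0 * g (suc n)) + ((θ (tail f) ⊛ g) n + (tail f ⊛ θ g) n + (tail f ⊛ g) n)
        ≡⟨ regroup (+ suc n) (f 0) (g (suc n)) ((θ (tail f) ⊛ g) n) ((tail f ⊛ θ g) n) ((tail f ⊛ g) n) ⟩
      0ℤ * f 0 * g (suc n) + ((θ (tail f) ⊛ g) n + (tail f ⊛ g) n)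
        + (f 0 * (+ suc n * g (suc n)) + (tail f ⊛ θ g) n)
        ≡⟨ cong (λ t → 0ℤ * f 0 * g (suc n) + t + (f ⊛ θ g) (suc n)) (begin
             (θ (tail f) ⊛ g) n + (tail f ⊛ g) n   ≡⟨ ⊛-distribʳ g (θ (tail f)) (tail f) n ⟨
             ((θ (tail f) ⊕ tail f) ⊛ g) n         ≡⟨ ⊛-cong′ (tail-θ f) (λ _ → refl) n ⟨
             (tail (θ f) ⊛ g) n                    ∎) ⟩
      (θ f ⊛ g ⊕ f ⊛ θ g) (suc n) ∎
      where
      regroup : ∀ m a c x y z →
                m * (a * c) + (x + y + z) ≡ 0ℤ * a * c + (x + z) + (a * (m * c) + y)
      regroup = solve-∀

  ⊛-cong-≤ : ∀ {f f′ g g′} n → (∀ {i} → i ℕ.≤ n → f i ≡ f′ i) → (∀ {i} → i ℕ.≤ n → g i ≡ g′ i) →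
             (f ⊛ g) n ≡ (f′ ⊛ g′) n
  ⊛-cong-≤ zero    p q = cong₂ _*_ (p z≤n) (q z≤n)
  ⊛-cong-≤ (suc n) p q = cong₂ _+_ (cong₂ _*_ (p z≤n) (q ℕ.≤-refl))
    (⊛-cong-≤ n (p ∘ s≤s) (q ∘ ℕ.m≤n⇒m≤1+n))

  ⊛-cong-< : ∀ {f f′ g g′} n → f 0 ≡ 0ℤ → f′ 0 ≡ 0ℤ → (∀ {i} → i ℕ.≤ n → f i ≡ f′ i) →
             (∀ {i} → i ℕ.< n → g i ≡ g′ i) → (f ⊛ g) n ≡ (f′ ⊛ g′) n
  ⊛-cong-< {f} {f′} {g} {g′} zero    f₀ f′₀ p q =
    trans (cong (_* g 0) f₀) (sym (cong (_* g′ 0) f′₀))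
  ⊛-cong-< {f} {f′} {g} {g′} (suc n) f₀ f′₀ p q = cong₂ _+_
    (trans (cong (_* g (suc n)) f₀) (sym (cong (_* g′ (suc n)) f′₀)))
    (⊛-cong-≤ n (p ∘ s≤s) (q ∘ s≤s))

  -- As k(0) = 0, the coefficient of q^n in k y involves only y(i) with i < n, so n y(n) is
  -- determined by earlier coefficients, and n > 0 can be cancelled in ℤ. Only y(0) is free.
  ode-unique : ∀ {k y z} → k 0 ≡ 0ℤ → θ y ≈ k ⊛ y → θ z ≈ k ⊛ z → y 0 ≡ z 0 → y ≈ z
  ode-unique {k} {y} {z} k₀ θy θz y₀ = coefficientwise (<-rec _ step)
    where
    step : ∀ n → (∀ {i} → i ℕ.< n → y i ≡ z i) → y n ≡ z n
    step zero    ih = y₀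
    step (suc n) ih = ℤ.*-cancelˡ-≡ (+ suc n) (y (suc n)) (z (suc n)) (begin
      θ y (suc n)        ≡⟨ at θy (suc n) ⟩
      (k ⊛ y) (suc n)    ≡⟨ ⊛-cong-< {k} {k} (suc n) k₀ k₀ (λ _ → refl) ih ⟩
      (k ⊛ z) (suc n)    ≡⟨ at θz (suc n) ⟨
      θ z (suc n)        ∎)

  -- dilate k r f is q^r f(q^(1+k)).
  dilate : ℕ → ℕ → Series → Series
  dilate k zero    f zero    = f 0
  dilate k (suc r) f zero    = 0ℤ
  dilate k zero    f (suc n) = dilate k k (tail f) n
  dilate k (suc r) f (suc n) = dilate k r f n

  dilate-cong′ : ∀ k r {f g} → (∀ n → f n ≡ g n) → ∀ n → dilate k r f n ≡ dilate k r g n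
  dilate-cong′ k zero    p zero    = p 0
  dilate-cong′ k (suc r) p zero    = refl
  dilate-cong′ k zero    p (suc n) = dilate-cong′ k k (p ∘ suc) n
  dilate-cong′ k (suc r) p (suc n) = dilate-cong′ k r p n

  dilate-cong : ∀ k r {f g} → f ≈ g → dilate k r f ≈ dilate k r g
  dilate-cong k r p = coefficientwise (dilate-cong′ k r (at p))

  dilate-⊕ : ∀ k r f g n → dilate k r (f ⊕ g) n ≡ dilate k r f n + dilate k r g n
  dilate-⊕ k zero    f g zero    = refl
  dilate-⊕ k (suc r) f g zero    = refl
  dilate-⊕ k zero    f g (suc n) = dilate-⊕ k k (tail f) (tail g) n
  dilate-⊕ k (suc r) f g (suc n) = dilate-⊕ k r f g n

  dilate-scale : ∀ k r c f n → dilate k r (λ i → c * f i) n ≡ c * dilate k r f n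
  dilate-scale k zero    c f zero    = refl
  dilate-scale k (suc r) c f zero    = sym (ℤ.*-zeroʳ c)
  dilate-scale k zero    c f (suc n) = dilate-scale k k c (tail f) n
  dilate-scale k (suc r) c f (suc n) = dilate-scale k r c f n

  dilate-𝟎 : ∀ k r n → dilate k r 𝟎 n ≡ 0ℤ
  dilate-𝟎 k zero    zero    = refl
  dilate-𝟎 k (suc r) zero    = refl
  dilate-𝟎 k zero    (suc n) = dilate-𝟎 k k n
  dilate-𝟎 k (suc r) (suc n) = dilate-𝟎 k r n

  dilate-const : ∀ k c → dilate k 0 (const c) ≈ const c
  dilate-const k c = coefficientwise λ { zero → refl ; (suc n) → dilate-𝟎 k k n }

  dilate-⊛ˡ : ∀ k r f g n → (dilate k r f ⊛ dilate k 0 g) n ≡ dilate k r (f ⊛ g) n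
  dilate-⊛ˡ k zero    f g zero    = refl
  dilate-⊛ˡ k (suc r) f g zero    = refl
  dilate-⊛ˡ k (suc r) f g (suc n) = trans (ℤ.+-identityˡ _) (dilate-⊛ˡ k r f g n)
  dilate-⊛ˡ k zero    f g (suc n) = begin
    f 0 * dilate k k (tail g) n + (dilate k k (tail f) ⊛ dilate k 0 g) n
      ≡⟨ cong₂ _+_ (sym (dilate-scale k k (f 0) (tail g) n)) (dilate-⊛ˡ k k (tail f) g n) ⟩
    dilate k k (λ i → f 0 * tail g i) n + dilate k k (tail f ⊛ g) n
      ≡⟨ dilate-⊕ k k (λ i → f 0 * tail g i) (tail f ⊛ g) n ⟨
    dilate k k ((λ i → f 0 * tail g i) ⊕ (tail f ⊛ g)) n ∎

  dilate-⊛ : ∀ k r s f g → dilate k r f ⊛ dilate k s g ≈ dilate k (r ℕ.+ s) (f ⊛ g)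
  dilate-⊛ k r s f g = coefficientwise (go r s)
    where
    go : ∀ r s n → (dilate k r f ⊛ dilate k s g) n ≡ dilate k (r ℕ.+ s) (f ⊛ g) n
    go zero    s n       = begin
      (dilate k 0 f ⊛ dilate k s g) n   ≡⟨ ⊛-comm′ (dilate k 0 f) (dilate k s g) n ⟩
      (dilate k s g ⊛ dilate k 0 f) n   ≡⟨ dilate-⊛ˡ k s g f n ⟩
      dilate k s (g ⊛ f) n              ≡⟨ dilate-cong′ k s (⊛-comm′ g f) n ⟩
      dilate k s (f ⊛ g) n              ∎
    go (suc r) s zero    = refl
    go (suc r) s (suc n) = trans (ℤ.+-identityˡ _) (go r s n)

  θ-dilate : ∀ k f → θ (dilate k 0 f) ≈ (λ n → + suc k * dilate k 0 (θ f) n)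
  θ-dilate k f = coefficientwise λ n → trans (go 0 f n) (drop (dilate k 0 (θ f) n) (dilate k 0 f n))
    where
    drop : ∀ x y → + suc k * x + 0ℤ * y ≡ + suc k * x
    drop x y = ℤ.+-identityʳ _

    zero-coeff : ∀ x c r → 0ℤ * x ≡ c * (0ℤ * x) + 0ℤ * r
    zero-coeff = solve-∀

    -- Generalised to q^r f(q^(1+k)), whose derivative has the extra term r q^r f(q^(1+k)), because
    -- the offset changes at every step of the recursion of `dilate`.
    go : ∀ r f n → θ (dilate k r f) n ≡ + suc k * dilate k r (θ f) n + + r * dilate k r f n
    go zero    f zero    = zero-coeff (f 0) (+ suc k) (f 0)
    go (suc r) f zero    = sym (cong₂ _+_ (ℤ.*-zeroʳ (+ suc k)) (ℤ.*-zeroʳ (+ suc r)))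
    go (suc r) f (suc n) = begin
      + suc n * dilate k r f n                                     ≡⟨ +suc n (dilate k r f n) ⟩
      θ (dilate k r f) n + dilate k r f n                          ≡⟨ cong (_+ dilate k r f n) (go r f n) ⟩
      K * dilate k r (θ f) n + + r * dilate k r f n + dilate k r f n
        ≡⟨ ℤ.+-assoc (K * dilate k r (θ f) n) _ _ ⟩
      K * dilate k r (θ f) n + (+ r * dilate k r f n + dilate k r f n)
        ≡⟨ cong (_+_ (K * dilate k r (θ f) n)) (+suc r (dilate k r f n)) ⟨
      K * dilate k r (θ f) n + + suc r * dilate k r f n            ∎
      where K = + suc k
    go zero    f (suc n) = begin
      + suc n * dilate k k (tail f) n                              ≡⟨ +suc n (dilate k k (tail f) n) ⟩
      θ (dilate k k (tail f)) n + dilate k k (tail f) n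
        ≡⟨ cong (_+ dilate k k (tail f) n) (go k (tail f) n) ⟩
      K * dilate k k (θ (tail f)) n + + k * dilate k k (tail f) n + dilate k k (tail f) n
        ≡⟨ ℤ.+-assoc (K * dilate k k (θ (tail f)) n) _ _ ⟩
      K * dilate k k (θ (tail f)) n + (+ k * dilate k k (tail f) n + dilate k k (tail f) n)
        ≡⟨ cong (_+_ (K * dilate k k (θ (tail f)) n)) (+suc k (dilate k k (tail f) n)) ⟨
      K * dilate k k (θ (tail f)) n + K * dilate k k (tail f) n
        ≡⟨ ℤ.*-distribˡ-+ K (dilate k k (θ (tail f)) n) (dilate k k (tail f) n) ⟨
      K * (dilate k k (θ (tail f)) n + dilate k k (tail f) n)
        ≡⟨ cong (K *_) (dilate-⊕ k k (θ (tail f)) (tail f) n) ⟨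
      K * dilate k k (θ (tail f) ⊕ tail f) n
        ≡⟨ cong (K *_) (dilate-cong′ k k (tail-θ f) n) ⟨
      K * dilate k k (tail (θ f)) n
        ≡⟨ ℤ.+-identityʳ _ ⟨
      K * dilate k k (tail (θ f)) n + 0ℤ * dilate k 0 f (suc n)    ∎
      where K = + suc k

  dilate-shift : ∀ k r f n → dilate k r f (r ℕ.+ n) ≡ dilate k 0 f n
  dilate-shift k zero    f n = refl
  dilate-shift k (suc r) f n = dilate-shift k r f n

  dilate-multiple : ∀ k f j → dilate k 0 f (j ℕ.* suc k) ≡ f j
  dilate-multiple k f zero    = refl
  dilate-multiple k f (suc j) = trans (dilate-shift k k (tail f) (j ℕ.* suc k)) (dilate-multiple k (tail f) j)

  dilate-other : ∀ k f n → (∀ j → n ≢ j ℕ.* suc k) → dilate k 0 f n ≡ 0ℤ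
  dilate-other k f n n≢ = go 0 f n n≢
    where
    go : ∀ r f n → (∀ j → n ≢ r ℕ.+ j ℕ.* suc k) → dilate k r f n ≡ 0ℤ
    go zero    f zero    n≢ = contradiction refl (n≢ 0)
    go (suc r) f zero    n≢ = refl
    go (suc r) f (suc n) n≢ = go r f n λ j eq → n≢ j (cong suc eq)
    go zero    f (suc n) n≢ = go k (tail f) n λ j eq → n≢ (suc j) (cong suc eq)

  -- The operator sending Σ f(n) q^n to Σ f(3j + r) q^j, recursive in j so that it runs in step with
  -- `dilate 2`.
  section : ℕ → Series → Series
  section r f zero    = f r
  section r f (suc j) = section r (λ n → f (3 ℕ.+ n)) j

  section-at : ∀ r f j → section r f j ≡ f (r ℕ.+ j ℕ.* 3)
  section-at r f zero    = cong f (sym (ℕ.+-identityʳ r))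
  section-at r f (suc j) = trans (section-at r (λ n → f (3 ℕ.+ n)) j)
    (cong f (trans (sym (ℕ.+-assoc 3 r (j ℕ.* 3)))
      (trans (cong (ℕ._+ j ℕ.* 3) (ℕ.+-comm 3 r)) (ℕ.+-assoc r 3 (j ℕ.* 3)))))

  section-cong : ∀ r {f g} → f ≈ g → section r f ≈ section r g
  section-cong r {f} {g} p = coefficientwise λ j →
    trans (section-at r f j) (trans (at p _) (sym (section-at r g j)))

  section-θ : ∀ r f j → section r (θ f) j ≡ + 3 * θ (section r f) j + + r * section r f j
  section-θ r f j = begin
    section r (θ f) j                                    ≡⟨ section-at r (θ f) j ⟩
    + (r ℕ.+ j ℕ.* 3) * f (r ℕ.+ j ℕ.* 3)                ≡⟨ cong₂ _*_ cast (sym (section-at r f j)) ⟩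
    (+ r + + j * + 3) * section r f j                    ≡⟨ expand (+ r) (+ j) (section r f j) ⟩
    + 3 * (+ j * section r f j) + + r * section r f j    ∎
    where
    cast : + (r ℕ.+ j ℕ.* 3) ≡ + r + + j * + 3
    cast = trans (ℤ.pos-+ r (j ℕ.* 3)) (cong (_+_ (+ r)) (ℤ.pos-* j 3))
    expand : ∀ r j x → (r + j * + 3) * x ≡ + 3 * (j * x) + r * x
    expand = solve-∀

  q : Series
  q zero          = 0ℤ
  q (suc zero)    = 1ℤ
  q (suc (suc n)) = 0ℤ

  q-⊛ : ∀ f n → (q ⊛ f) (suc n) ≡ f n
  q-⊛ f n = trans (ℤ.+-identityˡ _) (trans (⊛-cong′ tail-q (λ _ → refl) n)
    (trans (const-⊛ 1ℤ f n) (ℤ.*-identityˡ (f n))))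
    where
    tail-q : ∀ n → tail q n ≡ const 1ℤ n
    tail-q zero    = refl
    tail-q (suc n) = refl

  θq : θ q ≈ q
  θq = coefficientwise λ { 0 → refl ; 1 → refl ; (suc (suc n)) → ℤ.*-zeroʳ (+ suc (suc n)) }

  -- The substitution q ↦ q³: the first argument of `dilate` is the ratio minus one.
  V : Series → Series
  V = dilate 2 0

  decompose : ∀ f → f ≈ dilate 2 0 (section 0 f) ⊕ dilate 2 1 (section 1 f) ⊕ dilate 2 2 (section 2 f)
  decompose f = coefficientwise (go f)
    where
    go : ∀ f n → f n ≡ dilate 2 0 (section 0 f) n + dilate 2 1 (section 1 f) n + dilate 2 2 (section 2 f) n
    go f 0 = sym (trans (ℤ.+-identityʳ _) (ℤ.+-identityʳ _))
    go f 1 = sym (trans (ℤ.+-identityʳ _) (ℤ.+-identityˡ _))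
    go f 2 = sym (ℤ.+-identityˡ _)
    go f (suc (suc (suc n))) = go (λ n → f (3 ℕ.+ n)) n

  V-cong : ∀ {f g} → f ≈ g → V f ≈ V g
  V-cong = dilate-cong 2 0

  V-⊛ : ∀ f g → V f ⊛ V g ≈ V (f ⊛ g)
  V-⊛ = dilate-⊛ 2 0 0

  V-const : ∀ k → V (const k) ≈ const k
  V-const = dilate-const 2

  θ-V : ∀ f → θ (V f) ≈ const (+ 3) ⊛ V (θ f)
  θ-V f = ≈-trans (θ-dilate 2 f) (coefficientwise λ n → sym (const-⊛ (+ 3) (V (θ f)) n))

  -- The carry in a product of components with residues 1 and 2: q³ f(q³) is the image of q f under
  -- q ↦ q³.
  dilate-wrap : ∀ f → dilate 2 3 f ≈ dilate 2 0 (q ⊛ f)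
  dilate-wrap f = coefficientwise λ
    { zero    → refl
    ; (suc n) → sym (dilate-cong′ 2 2 (q-⊛ f) n) }

  dilate-sum : Series → Series → Series → Series
  dilate-sum f₀ f₁ f₂ = dilate 2 0 f₀ ⊕ dilate 2 1 f₁ ⊕ dilate 2 2 f₂

  section₀-sum : ∀ f₀ f₁ f₂ → section 0 (dilate-sum f₀ f₁ f₂) ≈ f₀
  section₀-sum f₀ f₁ f₂ = coefficientwise (go f₀ f₁ f₂)
    where
    go : ∀ f₀ f₁ f₂ j → section 0 (dilate-sum f₀ f₁ f₂) j ≡ f₀ j
    go f₀ f₁ f₂ zero    = trans (ℤ.+-identityʳ _) (ℤ.+-identityʳ _)
    go f₀ f₁ f₂ (suc j) = go (tail f₀) (tail f₁) (tail f₂) j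

  section₁-sum : ∀ f₀ f₁ f₂ → section 1 (dilate-sum f₀ f₁ f₂) ≈ f₁
  section₁-sum f₀ f₁ f₂ = coefficientwise (go f₀ f₁ f₂)
    where
    go : ∀ f₀ f₁ f₂ j → section 1 (dilate-sum f₀ f₁ f₂) j ≡ f₁ j
    go f₀ f₁ f₂ zero    = trans (ℤ.+-identityʳ _) (ℤ.+-identityˡ _)
    go f₀ f₁ f₂ (suc j) = go (tail f₀) (tail f₁) (tail f₂) j

  section₂-sum : ∀ f₀ f₁ f₂ → section 2 (dilate-sum f₀ f₁ f₂) ≈ f₂
  section₂-sum f₀ f₁ f₂ = coefficientwise (go f₀ f₁ f₂)
    where
    go : ∀ f₀ f₁ f₂ j → section 2 (dilate-sum f₀ f₁ f₂) j ≡ f₂ j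
    go f₀ f₁ f₂ zero    = ℤ.+-identityˡ _
    go f₀ f₁ f₂ (suc j) = go (tail f₀) (tail f₁) (tail f₂) j

  -- Multiplication by f in terms of 3-dissections. The residue 2 is absent from f, as it is for a
  -- theta series, whose exponents are squares.
  module Sections (f α β : Series) (f≈ : f ≈ dilate 2 0 α ⊕ dilate 2 1 β) (g : Series) where

    private
      g₀ g₁ g₂ : Series
      g₀ = section 0 g
      g₁ = section 1 g
      g₂ = section 2 g

      f⊛g : f ⊛ g ≈ dilate-sum (α ⊛ g₀ ⊕ q ⊛ (β ⊛ g₂)) (α ⊛ g₁ ⊕ β ⊛ g₀) (α ⊛ g₂ ⊕ β ⊛ g₁)
      f⊛g = R.begin
        f ⊛ g  R.≈⟨ ⊛-cong f≈ (decompose g) ⟩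
        (W 0 α ⊕ W 1 β) ⊛ (W 0 g₀ ⊕ W 1 g₁ ⊕ W 2 g₂)
          R.≈⟨ solve 5 (λ a b x y z → (a :+ b) :* (x :+ y :+ z) :=
                  (a :* x :+ b :* z) :+ (a :* y :+ b :* x) :+ (a :* z :+ b :* y)) ≈-refl
                  (W 0 α) (W 1 β) (W 0 g₀) (W 1 g₁) (W 2 g₂) ⟩
        (W 0 α ⊛ W 0 g₀ ⊕ W 1 β ⊛ W 2 g₂) ⊕ (W 0 α ⊛ W 1 g₁ ⊕ W 1 β ⊛ W 0 g₀)
          ⊕ (W 0 α ⊛ W 2 g₂ ⊕ W 1 β ⊛ W 1 g₁)
          R.≈⟨ ⊕-cong (⊕-cong
                 (⊕-cong (dilate-⊛ 2 0 0 α g₀) (≈-trans (dilate-⊛ 2 1 2 β g₂) (dilate-wrap (β ⊛ g₂))))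
                 (⊕-cong (dilate-⊛ 2 0 1 α g₁) (dilate-⊛ 2 1 0 β g₀)))
                 (⊕-cong (dilate-⊛ 2 0 2 α g₂) (dilate-⊛ 2 1 1 β g₁)) ⟩
        (W 0 (α ⊛ g₀) ⊕ W 0 (q ⊛ (β ⊛ g₂))) ⊕ (W 1 (α ⊛ g₁) ⊕ W 1 (β ⊛ g₀))
          ⊕ (W 2 (α ⊛ g₂) ⊕ W 2 (β ⊛ g₁))
          R.≈⟨ ⊕-cong (⊕-cong (merge 0 (α ⊛ g₀) (q ⊛ (β ⊛ g₂))) (merge 1 (α ⊛ g₁) (β ⊛ g₀)))
                      (merge 2 (α ⊛ g₂) (β ⊛ g₁)) ⟩
        dilate-sum (α ⊛ g₀ ⊕ q ⊛ (β ⊛ g₂)) (α ⊛ g₁ ⊕ β ⊛ g₀) (α ⊛ g₂ ⊕ β ⊛ g₁) R.∎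
        where
        module R = ≈-Reasoning
        open Solver
        W : ℕ → Series → Series
        W = dilate 2
        merge : ∀ r a b → W r a ⊕ W r b ≈ W r (a ⊕ b)
        merge r a b = coefficientwise λ n → sym (dilate-⊕ 2 r a b n)

    section₀-⊛ : section 0 (f ⊛ g) ≈ α ⊛ g₀ ⊕ q ⊛ (β ⊛ g₂)
    section₀-⊛ = ≈-trans (section-cong 0 f⊛g) (section₀-sum _ _ _)

    section₁-⊛ : section 1 (f ⊛ g) ≈ α ⊛ g₁ ⊕ β ⊛ g₀
    section₁-⊛ = ≈-trans (section-cong 1 f⊛g) (section₁-sum _ _ _)

    section₂-⊛ : section 2 (f ⊛ g) ≈ α ⊛ g₂ ⊕ β ⊛ g₁
    section₂-⊛ = ≈-trans (section-cong 2 f⊛g) (section₂-sum _ _ _)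

-- The 3-dissection of the reciprocal of φ and its reduction modulo 9

module CubicDissection where

  open import Data.Integer.Base using (_+_; _*_)
  open import Data.Integer.DivMod using (_%ℕ_; _/ℕ_; n%ℕd<d; a≡a%ℕn+[a/ℕn]*n)
  open import Function.Base using (_⟨_⟩_)
  open PowerSeries
  open Dilation
  open ≈-Reasoning
  open Solver

  cube≡ : ∀ c → ∃ λ x → c * (c * c) ≡ c + + 3 * x
  cube≡ c = go (c %ℕ 3) (c /ℕ 3) (n%ℕd<d c 3) (a≡a%ℕn+[a/ℕn]*n c 3)
    where
    go : ∀ r k → r ℕ.< 3 → c ≡ + r + k * + 3 → ∃ λ x → c * (c * c) ≡ c + + 3 * x
    go 0 k _ refl = + 9 * (k * k * k) - k , identity k
      where
      identity : ∀ k → (0ℤ + k * + 3) * ((0ℤ + k * + 3) * (0ℤ + k * + 3))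
                       ≡ 0ℤ + k * + 3 + + 3 * (+ 9 * (k * k * k) - k)
      identity = solve-∀
    go 1 k _ refl = + 9 * (k * k * k) + + 9 * (k * k) + + 2 * k , identity k
      where
      identity : ∀ k → (1ℤ + k * + 3) * ((1ℤ + k * + 3) * (1ℤ + k * + 3))
                       ≡ 1ℤ + k * + 3 + + 3 * (+ 9 * (k * k * k) + + 9 * (k * k) + + 2 * k)
      identity = solve-∀
    go 2 k _ refl = + 9 * (k * k * k) + + 18 * (k * k) + + 11 * k + + 2 , identity k
      where
      identity : ∀ k → (+ 2 + k * + 3) * ((+ 2 + k * + 3) * (+ 2 + k * + 3))
                       ≡ + 2 + k * + 3 + + 3 * (+ 9 * (k * k * k) + + 18 * (k * k) + + 11 * k + + 2)
      identity = solve-∀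
    go (suc (suc (suc r))) k (s≤s (s≤s (s≤s ()))) _

  cube : Series → Series
  cube f = f ⊛ (f ⊛ f)

  cube-cong : ∀ {f g} → f ≈ g → cube f ≈ cube g
  cube-cong p = ⊛-cong p (⊛-cong p p)

  uncons : ∀ f → f ≈ const (f 0) ⊕ q ⊛ tail f
  uncons f = coefficientwise λ
    { zero    → sym (ℤ.+-identityʳ (f 0))
    ; (suc n) → sym (trans (ℤ.+-identityˡ _) (q-⊛ (tail f) n)) }

  -- Write f = c + q g. Then f³ ≡ c³ + q³ g³ and c³ ≡ c modulo 3, and the term q³ g³ lowers the
  -- index by three, just as `V` does. The quotient by 3 is collected coefficient by coefficient.
  frobenius : ∀ f → ∃ λ h → cube f ≈ V f ⊕ const (+ 3) ⊛ h
  frobenius f = (λ n → proj₁ (go f n)) , coefficientwise λ n →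
    trans (proj₂ (go f n)) (cong (_+_ (V f n)) (sym (const-⊛ (+ 3) (λ n → proj₁ (go f n)) n)))
    where
    cross : Series → Series
    cross f = const (f 0 * f 0) ⊛ (q ⊛ tail f) ⊕ const (f 0) ⊛ ((q ⊛ tail f) ⊛ (q ⊛ tail f))

    expand : ∀ f → cube f ≈ const (f 0 * (f 0 * f 0)) ⊕ const (+ 3) ⊛ cross f ⊕ q ⊛ (q ⊛ (q ⊛ cube (tail f)))
    expand f = begin
      cube f                            ≈⟨ cube-cong (uncons f) ⟩
      cube (const c ⊕ q ⊛ g)
        ≈⟨ solve 3 (λ c q g → (c :+ q :* g) :* ((c :+ q :* g) :* (c :+ q :* g)) :=
             c :* (c :* c) :+ con (+ 3) :* (c :* c :* (q :* g) :+ c :* ((q :* g) :* (q :* g)))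
               :+ q :* (q :* (q :* (g :* (g :* g))))) ≈-refl (const c) q g ⟩
      const c ⊛ (const c ⊛ const c)
        ⊕ const (+ 3) ⊛ (const c ⊛ const c ⊛ (q ⊛ g) ⊕ const c ⊛ ((q ⊛ g) ⊛ (q ⊛ g)))
        ⊕ q ⊛ (q ⊛ (q ⊛ cube g))
        ≈⟨ ⊕-cong (⊕-cong (≈-trans (⊛-congʳ (const-* c c)) (const-* c (c * c)))
             (⊛-congʳ {const (+ 3)} (⊕-cong (⊛-congˡ (const-* c c)) ≈-refl))) ≈-refl ⟩
      const (c * (c * c)) ⊕ const (+ 3) ⊛ cross f ⊕ q ⊛ (q ⊛ (q ⊛ cube g)) ∎
      where
      c : ℤ
      c = f 0
      g : Series
      g = tail f
      const-* : ∀ a b → const a ⊛ const b ≈ const (a * b)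
      const-* a b = coefficientwise λ
        { zero → refl ; (suc n) → trans (const-⊛ a (const b) (suc n)) (ℤ.*-zeroʳ a) }

    expand-at : ∀ f n → cube f n ≡ const (f 0 * (f 0 * f 0)) n + + 3 * cross f n + (q ⊛ (q ⊛ (q ⊛ cube (tail f)))) n
    expand-at f n = trans (at (expand f) n)
      (cong (λ t → const (f 0 * (f 0 * f 0)) n + t + (q ⊛ (q ⊛ (q ⊛ cube (tail f)))) n)
        (const-⊛ (+ 3) (cross f) n))

    go : ∀ f n → ∃ λ x → cube f n ≡ V f n + + 3 * x
    go f 0 = cube≡ (f 0)
    go f 1 = cross f 1 , trans (expand-at f 1) (cong (_+_ (0ℤ + + 3 * cross f 1)) (q-⊛ (q ⊛ (q ⊛ cube (tail f))) 0)
      ⟨ trans ⟩ ℤ.+-identityʳ _)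
    go f 2 = cross f 2 , trans (expand-at f 2) (cong (_+_ (0ℤ + + 3 * cross f 2))
      (trans (q-⊛ (q ⊛ (q ⊛ cube (tail f))) 1) (q-⊛ (q ⊛ cube (tail f)) 0))
      ⟨ trans ⟩ ℤ.+-identityʳ _)
    go f (suc (suc (suc n))) = let x , eq = go (tail f) n in
      cross f (3 ℕ.+ n) + x , trans (expand-at f (3 ℕ.+ n))
        (trans (cong (_+_ (0ℤ + + 3 * cross f (3 ℕ.+ n)))
          (trans (q-⊛ (q ⊛ (q ⊛ cube (tail f))) (2 ℕ.+ n))
            (trans (q-⊛ (q ⊛ cube (tail f)) (1 ℕ.+ n)) (trans (q-⊛ (cube (tail f)) n) eq))))
          (regroup (cross f (3 ℕ.+ n)) (V (tail f) n) x))
      where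
      regroup : ∀ a b c → 0ℤ + + 3 * a + (b + + 3 * c) ≡ b + + 3 * (a + c)
      regroup = solve-∀

  cancel-const : ∀ m {f g} → const (+ suc m) ⊛ f ≈ const (+ suc m) ⊛ g → f ≈ g
  cancel-const m {f} {g} p = coefficientwise λ n → ℤ.*-cancelˡ-≡ (+ suc m) (f n) (g n)
    (trans (sym (const-⊛ (+ suc m) f n)) (trans (at p n) (const-⊛ (+ suc m) g n)))

  θ-cube : ∀ f → θ (cube f) ≈ const (+ 3) ⊛ (f ⊛ f ⊛ θ f)
  θ-cube f = begin
    θ (f ⊛ (f ⊛ f))                            ≈⟨ θ-⊛ f (f ⊛ f) ⟩
    θ f ⊛ (f ⊛ f) ⊕ f ⊛ θ (f ⊛ f)              ≈⟨ ⊕-congʳ (θ f ⊛ (f ⊛ f)) (⊛-congʳ {f} (θ-⊛ f f)) ⟩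
    θ f ⊛ (f ⊛ f) ⊕ f ⊛ (θ f ⊛ f ⊕ f ⊛ θ f)
      ≈⟨ solve 2 (λ f d → d :* (f :* f) :+ f :* (d :* f :+ f :* d) := con (+ 3) :* (f :* f :* d)) ≈-refl f (θ f) ⟩
    const (+ 3) ⊛ (f ⊛ f ⊛ θ f) ∎

  -- The arithmetic of the prime 3 enters through `φ≈`, which says φ = φ(q⁹) + q β(q³), and through
  -- `hecke`, which says that C has eigenvalue 4 = 1 + 3 under U₃ + 3V₃. The rest is algebra with
  -- series.
  module ThreeDissection
    (φ P C β : Series) (φ₀ : φ 0 ≡ 1ℤ) (P₀ : P 0 ≡ 1ℤ) (C₀ : C 0 ≡ 0ℤ)
    (θφ : θ φ ≈ ⊖ (φ ⊛ C)) (θP : θ P ≈ P ⊛ C)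
    (φ≈ : φ ≈ dilate 2 0 (V φ) ⊕ dilate 2 1 β)
    (hecke : section 0 C ⊕ const (+ 3) ⊛ V C ≈ const (+ 4) ⊛ C)
    where

    α c₀ c₁ c₂ p₀ p₁ p₂ : Series
    α  = V φ
    c₀ = section 0 C
    c₁ = section 1 C
    c₂ = section 2 C
    p₀ = section 0 P
    p₁ = section 1 P
    p₂ = section 2 P

    φ⊛P≈𝟏 : φ ⊛ P ≈ 𝟏
    φ⊛P≈𝟏 = ode-unique {𝟎} refl
      (begin
        θ (φ ⊛ P)                          ≈⟨ θ-⊛ φ P ⟩
        θ φ ⊛ P ⊕ φ ⊛ θ P                  ≈⟨ ⊕-cong (⊛-congˡ θφ) (⊛-congʳ θP) ⟩
        ⊖ (φ ⊛ C) ⊛ P ⊕ φ ⊛ (P ⊛ C)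
          ≈⟨ solve 3 (λ f p c → :- (f :* c) :* p :+ f :* (p :* c) := con 0ℤ) ≈-refl φ P C ⟩
        const 0ℤ                           ≈⟨ const-0 ⟩
        𝟎                                  ≈⟨ 𝟎-⊛ (φ ⊛ P) ⟨
        𝟎 ⊛ (φ ⊛ P)                        ∎)
      (begin
        θ 𝟏      ≈⟨ coefficientwise (λ { zero → refl ; (suc n) → ℤ.*-zeroʳ (+ suc n) }) ⟩
        𝟎        ≈⟨ 𝟎-⊛ 𝟏 ⟨
        𝟎 ⊛ 𝟏    ∎)
      (cong₂ _*_ φ₀ P₀)
      where
      const-0 : const 0ℤ ≈ 𝟎
      const-0 = coefficientwise λ { zero → refl ; (suc n) → refl }

    φ≈sum : φ ≈ dilate-sum α β 𝟎
    φ≈sum = ≈-trans φ≈ (coefficientwise λ n → sym (trans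
      (cong (_+_ (dilate 2 0 α n + dilate 2 1 β n)) (dilate-𝟎 2 2 n)) (ℤ.+-identityʳ _)))

    open Sections φ α β φ≈ C using ()
      renaming (section₀-⊛ to C-section₀; section₁-⊛ to C-section₁; section₂-⊛ to C-section₂)
    open Sections φ α β φ≈ P using ()
      renaming (section₀-⊛ to P-section₀; section₁-⊛ to P-section₁; section₂-⊛ to P-section₂)

    section-⊖ : ∀ r f → section r (⊖ f) ≈ ⊖ section r f
    section-⊖ r f = coefficientwise λ j → trans (section-at r (⊖ f) j) (cong -_ (sym (section-at r f j)))

    section-θ≈ : ∀ r {f} → section r φ ≈ f → section r (θ φ) ≈ const (+ 3) ⊛ θ f ⊕ const (+ r) ⊛ f
    section-θ≈ r {f} p = coefficientwise λ j → trans (section-θ r φ j)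
      (cong₂ _+_ (trans (cong (+ 3 *_) (at (θ-cong p) j)) (sym (const-⊛ (+ 3) (θ f) j)))
                 (trans (cong (+ r *_) (at p j)) (sym (const-⊛ (+ r) f j))))

    θφ-section : ∀ r {f g} → section r φ ≈ f → section r (φ ⊛ C) ≈ g →
                 const (+ 3) ⊛ θ f ⊕ const (+ r) ⊛ f ≈ ⊖ g
    θφ-section r {f} {g} p s = begin
      const (+ 3) ⊛ θ f ⊕ const (+ r) ⊛ f   ≈⟨ section-θ≈ r p ⟨
      section r (θ φ)                        ≈⟨ section-cong r θφ ⟩
      section r (⊖ (φ ⊛ C))                  ≈⟨ section-⊖ r (φ ⊛ C) ⟩
      ⊖ section r (φ ⊛ C)                    ≈⟨ coefficientwise (λ n → cong -_ (at s n)) ⟩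
      ⊖ g                                    ∎

    θα : const (+ 3) ⊛ θ α ⊕ const 0ℤ ⊛ α ≈ ⊖ (α ⊛ c₀ ⊕ q ⊛ (β ⊛ c₂))
    θα = θφ-section 0 (≈-trans (section-cong 0 φ≈sum) (section₀-sum α β 𝟎)) C-section₀

    θβ : const (+ 3) ⊛ θ β ⊕ const 1ℤ ⊛ β ≈ ⊖ (α ⊛ c₁ ⊕ β ⊛ c₀)
    θβ = θφ-section 1 (≈-trans (section-cong 1 φ≈sum) (section₁-sum α β 𝟎)) C-section₁

    α⊛c₂⊕β⊛c₁ : α ⊛ c₂ ⊕ β ⊛ c₁ ≈ 𝟎
    α⊛c₂⊕β⊛c₁ = begin
      α ⊛ c₂ ⊕ β ⊛ c₁   ≈⟨ solve 1 (λ x → x := :- (:- x)) ≈-refl (α ⊛ c₂ ⊕ β ⊛ c₁) ⟩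
      ⊖ (⊖ (α ⊛ c₂ ⊕ β ⊛ c₁))
        ≈⟨ coefficientwise (λ n → cong -_ (at (θφ-section 2 (≈-trans (section-cong 2 φ≈sum) (section₂-sum α β 𝟎)) C-section₂) n)) ⟨
      ⊖ (const (+ 3) ⊛ θ 𝟎 ⊕ const (+ 2) ⊛ 𝟎)
        ≈⟨ coefficientwise (λ n → cong -_ (cong₂ _+_
             (trans (const-⊛ (+ 3) (θ 𝟎) n) (cong (+ 3 *_) (ℤ.*-zeroʳ (+ n)))) (const-⊛ (+ 2) 𝟎 n))) ⟩
      𝟎 ∎

    -- With ω a primitive cube root of unity, N(q³) is the product of α(q³) + ω^i q β(q³) over i =
    -- 0, 1, 2: the norm of φ down to series in q³.
    N : Series
    N = cube α ⊕ q ⊛ cube β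

    -- The logarithmic derivative of a norm is the trace of the logarithmic derivative, and the
    -- trace of -C keeps only the exponents divisible by 3.
    θN : θ N ≈ ⊖ (c₀ ⊛ N)
    θN = cancel-const 2 (begin
      const (+ 3) ⊛ θ N
        ≈⟨ ⊛-congʳ {const (+ 3)} (≈-trans (θ-⊕ (cube α) (q ⊛ cube β))
             (⊕-cong (θ-cube α) (≈-trans (θ-⊛ q (cube β)) (⊕-cong (⊛-congˡ θq) (⊛-congʳ (θ-cube β)))))) ⟩
      const (+ 3) ⊛ (const (+ 3) ⊛ (α ⊛ α ⊛ θ α) ⊕ (q ⊛ cube β ⊕ q ⊛ (const (+ 3) ⊛ (β ⊛ β ⊛ θ β))))
        ≈⟨ solve 5 (λ a b q x y →
             con (+ 3) :* (con (+ 3) :* (a :* a :* x) :+ (q :* (b :* (b :* b)) :+ q :* (con (+ 3) :* (b :* b :* y)))) :=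
             con (+ 3) :* (a :* a :* (con (+ 3) :* x :+ con 0ℤ :* a) :+ q :* (b :* b :* (con (+ 3) :* y :+ con 1ℤ :* b))))
             ≈-refl α β q (θ α) (θ β) ⟩
      const (+ 3) ⊛ (α ⊛ α ⊛ (const (+ 3) ⊛ θ α ⊕ const 0ℤ ⊛ α) ⊕ q ⊛ (β ⊛ β ⊛ (const (+ 3) ⊛ θ β ⊕ const 1ℤ ⊛ β)))
        ≈⟨ ⊛-congʳ {const (+ 3)} (⊕-cong (⊛-congʳ {α ⊛ α} θα) (⊛-congʳ {q} (⊛-congʳ {β ⊛ β} θβ))) ⟩
      const (+ 3) ⊛ (α ⊛ α ⊛ ⊖ (α ⊛ c₀ ⊕ q ⊛ (β ⊛ c₂)) ⊕ q ⊛ (β ⊛ β ⊛ ⊖ (α ⊛ c₁ ⊕ β ⊛ c₀)))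
        -- Multiplying the equations for the residues 0, 1, 2 by α², q β², -q α β eliminates c₁ and
        -- c₂. These cofactors are the components of the product of the other two conjugates of φ.
        ≈⟨ solve 6 (λ a b q x y z →
             con (+ 3) :* (a :* a :* (:- (a :* x :+ q :* (b :* z))) :+ q :* (b :* b :* (:- (a :* y :+ b :* x)))) :=
             con (+ 3) :* (:- (x :* (a :* (a :* a) :+ q :* (b :* (b :* b)))) :+ :- (q :* (a :* b)) :* (a :* z :+ b :* y)))
             ≈-refl α β q c₀ c₁ c₂ ⟩
      const (+ 3) ⊛ (⊖ (c₀ ⊛ N) ⊕ ⊖ (q ⊛ (α ⊛ β)) ⊛ (α ⊛ c₂ ⊕ β ⊛ c₁))
        ≈⟨ ⊛-congʳ {const (+ 3)} (⊕-congʳ (⊖ (c₀ ⊛ N)) (≈-trans (⊛-congʳ {⊖ (q ⊛ (α ⊛ β))} α⊛c₂⊕β⊛c₁) (⊛-comm (⊖ (q ⊛ (α ⊛ β))) 𝟎))) ⟩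
      const (+ 3) ⊛ (⊖ (c₀ ⊛ N) ⊕ 𝟎 ⊛ ⊖ (q ⊛ (α ⊛ β)))
        ≈⟨ ⊛-congʳ {const (+ 3)} (≈-trans (⊕-congʳ (⊖ (c₀ ⊛ N)) (𝟎-⊛ (⊖ (q ⊛ (α ⊛ β)))))
             (coefficientwise λ n → ℤ.+-identityʳ ((⊖ (c₀ ⊛ N)) n))) ⟩
      const (+ 3) ⊛ ⊖ (c₀ ⊛ N) ∎)

    θVφ : θ α ≈ ⊖ (const (+ 3) ⊛ (V C ⊛ α))
    θVφ = begin
      θ (V φ)                             ≈⟨ θ-V φ ⟩
      const (+ 3) ⊛ V (θ φ)
        ≈⟨ ⊛-congʳ {const (+ 3)} (V-cong (≈-trans θφ (solve 2 (λ f c → :- (f :* c) := con -1ℤ :* (f :* c)) ≈-refl φ C))) ⟩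
      const (+ 3) ⊛ V (const -1ℤ ⊛ (φ ⊛ C))
        ≈⟨ ⊛-congʳ {const (+ 3)} (V-⊛ (const -1ℤ) (φ ⊛ C)) ⟨
      const (+ 3) ⊛ (V (const -1ℤ) ⊛ V (φ ⊛ C))
        ≈⟨ ⊛-congʳ {const (+ 3)} (⊛-cong (V-const -1ℤ) (≈-sym (V-⊛ φ C))) ⟩
      const (+ 3) ⊛ (const -1ℤ ⊛ (V φ ⊛ V C))
        ≈⟨ solve 2 (λ f c → con (+ 3) :* (con -1ℤ :* (f :* c)) := :- (con (+ 3) :* (c :* f))) ≈-refl (V φ) (V C) ⟩
      ⊖ (const (+ 3) ⊛ (V C ⊛ α)) ∎

    fourth : Series
    fourth = φ ⊛ cube φ

    θ-fourth : θ fourth ≈ ⊖ (const (+ 4) ⊛ C) ⊛ fourth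
    θ-fourth = begin
      θ (φ ⊛ cube φ)                                     ≈⟨ θ-⊛ φ (cube φ) ⟩
      θ φ ⊛ cube φ ⊕ φ ⊛ θ (cube φ)                      ≈⟨ ⊕-congʳ (θ φ ⊛ cube φ) (⊛-congʳ {φ} (θ-cube φ)) ⟩
      θ φ ⊛ cube φ ⊕ φ ⊛ (const (+ 3) ⊛ (φ ⊛ φ ⊛ θ φ))
        ≈⟨ solve 2 (λ f d → d :* (f :* (f :* f)) :+ f :* (con (+ 3) :* (f :* f :* d)) := con (+ 4) :* (f :* (f :* f)) :* d)
             ≈-refl φ (θ φ) ⟩
      const (+ 4) ⊛ cube φ ⊛ θ φ                         ≈⟨ ⊛-congʳ θφ ⟩
      const (+ 4) ⊛ cube φ ⊛ ⊖ (φ ⊛ C)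
        ≈⟨ solve 2 (λ f c → con (+ 4) :* (f :* (f :* f)) :* (:- (f :* c)) := :- (con (+ 4) :* c) :* (f :* (f :* (f :* f))))
             ≈-refl φ C ⟩
      ⊖ (const (+ 4) ⊛ C) ⊛ fourth ∎

    -- Both sides have constant term 1. On the left the norm contributes c₀ to the logarithmic
    -- derivative and φ(q³) contributes 3 V C, up to sign; by `hecke` they add up to 4C, as for φ⁴.
    N⊛α≈fourth : N ⊛ α ≈ fourth
    N⊛α≈fourth = ode-unique {⊖ (const (+ 4) ⊛ C)} (cong (λ c → - (+ 4 * c)) C₀)
      (begin
        θ (N ⊛ α)                                        ≈⟨ θ-⊛ N α ⟩
        θ N ⊛ α ⊕ N ⊛ θ α                                ≈⟨ ⊕-cong (⊛-congˡ θN) (⊛-congʳ θVφ) ⟩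
        ⊖ (c₀ ⊛ N) ⊛ α ⊕ N ⊛ ⊖ (const (+ 3) ⊛ (V C ⊛ α))
          ≈⟨ solve 4 (λ n a c v → :- (c :* n) :* a :+ n :* (:- (con (+ 3) :* (v :* a))) :=
               (:- (c :+ con (+ 3) :* v)) :* (n :* a)) ≈-refl N α c₀ (V C) ⟩
        ⊖ (c₀ ⊕ const (+ 3) ⊛ V C) ⊛ (N ⊛ α)             ≈⟨ ⊛-congˡ (coefficientwise λ n → cong -_ (at hecke n)) ⟩
        ⊖ (const (+ 4) ⊛ C) ⊛ (N ⊛ α)                    ∎)
      θ-fourth
      (≡R.begin
        (φ 0 * (φ 0 * φ 0) + 0ℤ) * φ 0  ≡R.≡⟨ cong (λ c → (c * (c * c) + 0ℤ) * c) φ₀ ⟩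
        1ℤ                              ≡R.≡⟨ cong (λ c → c * (c * (c * c))) φ₀ ⟨
        φ 0 * (φ 0 * (φ 0 * φ 0))       ≡R.∎)
      where module ≡R = ≡-Reasoning

    -- Cramer's rule for φ P = 1 sorted by residues: the cofactors α², q β², -q α β eliminate p₁ and
    -- p₂, and only the residue 0 component of 1 is nonzero.
    N⊛p₀ : N ⊛ p₀ ≈ α ⊛ α
    N⊛p₀ = begin
      N ⊛ p₀
        ≈⟨ solve 6 (λ a b q x y z →
             (a :* (a :* a) :+ q :* (b :* (b :* b))) :* x :=
             a :* a :* (a :* x :+ q :* (b :* z)) :+ q :* (b :* b) :* (a :* y :+ b :* x)
               :+ (:- (q :* (a :* b))) :* (a :* z :+ b :* y)) ≈-refl α β q p₀ p₁ p₂ ⟩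
      α ⊛ α ⊛ (α ⊛ p₀ ⊕ q ⊛ (β ⊛ p₂)) ⊕ q ⊛ (β ⊛ β) ⊛ (α ⊛ p₁ ⊕ β ⊛ p₀)
        ⊕ ⊖ (q ⊛ (α ⊛ β)) ⊛ (α ⊛ p₂ ⊕ β ⊛ p₁)
        ≈⟨ ⊕-cong (⊕-cong (⊛-congʳ (≈-trans (≈-sym P-section₀) (≈-trans (section-cong 0 φ⊛P≈𝟏) section₀-𝟏)))
                          (⊛-congʳ (≈-trans (≈-sym P-section₁) (≈-trans (section-cong 1 φ⊛P≈𝟏) section₁-𝟏))))
                  (⊛-congʳ (≈-trans (≈-sym P-section₂) (≈-trans (section-cong 2 φ⊛P≈𝟏) section₂-𝟏))) ⟩
      α ⊛ α ⊛ const 1ℤ ⊕ q ⊛ (β ⊛ β) ⊛ const 0ℤ ⊕ ⊖ (q ⊛ (α ⊛ β)) ⊛ const 0ℤ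
        ≈⟨ solve 3 (λ a b q → a :* a :* con 1ℤ :+ q :* (b :* b) :* con 0ℤ :+ (:- (q :* (a :* b))) :* con 0ℤ := a :* a)
             ≈-refl α β q ⟩
      α ⊛ α ∎
      where
      zeros : ∀ r j → section r 𝟎 j ≡ 0ℤ
      zeros r zero    = refl
      zeros r (suc j) = zeros r j
      section₀-𝟏 : section 0 𝟏 ≈ const 1ℤ
      section₀-𝟏 = coefficientwise λ { zero → refl ; (suc j) → zeros 0 j }
      section₁-𝟏 : section 1 𝟏 ≈ const 0ℤ
      section₁-𝟏 = coefficientwise λ { zero → refl ; (suc j) → zeros 1 j }
      section₂-𝟏 : section 2 𝟏 ≈ const 0ℤ
      section₂-𝟏 = coefficientwise λ { zero → refl ; (suc j) → zeros 2 j }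

    p₀⊛fourth : p₀ ⊛ fourth ≈ cube α
    p₀⊛fourth = begin
      p₀ ⊛ fourth       ≈⟨ ⊛-congʳ N⊛α≈fourth ⟨
      p₀ ⊛ (N ⊛ α)      ≈⟨ solve 3 (λ n a p → p :* (n :* a) := a :* (n :* p)) ≈-refl N α p₀ ⟩
      α ⊛ (N ⊛ p₀)      ≈⟨ ⊛-congʳ N⊛p₀ ⟩
      α ⊛ (α ⊛ α)       ∎

    -- By `frobenius`, α = φ³ - 3h. Its cube differs from φ⁹ by a multiple of 9, the binomial
    -- coefficient 3 supplying the second factor 3. Division by φ⁴ is multiplication by P⁴.
    p₀≡φ⁵ : ∃ λ h → p₀ ≈ φ ⊛ fourth ⊕ const (+ 9) ⊛ h
    p₀≡φ⁵ = P⁴ ⊛ R , (begin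
      p₀                            ≈⟨ ⊛-identityʳ p₀ ⟨
      p₀ ⊛ 𝟏                        ≈⟨ ⊛-congʳ 𝟏≈ ⟩
      p₀ ⊛ (fourth ⊛ P⁴)            ≈⟨ ⊛-assoc p₀ fourth P⁴ ⟨
      p₀ ⊛ fourth ⊛ P⁴              ≈⟨ ⊛-congˡ p₀⊛fourth ⟩
      cube α ⊛ P⁴
        ≈⟨ ⊛-congˡ (≈-trans (cube-cong (solve 2 (λ a h → a := (a :+ con (+ 3) :* h) :- con (+ 3) :* h) ≈-refl α h))
             (cube-cong {g = cube φ ⊕ ⊖ (const (+ 3) ⊛ h)} (⊕-cong (≈-sym cubeφ) ≈-refl))) ⟩
      cube (cube φ ⊕ ⊖ (const (+ 3) ⊛ h)) ⊛ P⁴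
        ≈⟨ solve 3 (λ f h p →
             (f :* (f :* f) :- con (+ 3) :* h) :* ((f :* (f :* f) :- con (+ 3) :* h) :* (f :* (f :* f) :- con (+ 3) :* h)) :* p :=
             (f :* (f :* (f :* (f :* f)))) :* (f :* (f :* (f :* f)) :* p) :+ con (+ 9) :* (p :*
               (con (+ 3) :* (h :* h :* (f :* (f :* f))) :- con (+ 3) :* (h :* h :* h) :- h :* (f :* (f :* f)) :* (f :* (f :* f)))))
             ≈-refl φ h P⁴ ⟩
      φ ⊛ fourth ⊛ (fourth ⊛ P⁴) ⊕ const (+ 9) ⊛ (P⁴ ⊛ R)
        ≈⟨ ⊕-cong (≈-trans (⊛-congʳ (≈-sym 𝟏≈)) (⊛-identityʳ (φ ⊛ fourth))) ≈-refl ⟩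
      φ ⊛ fourth ⊕ const (+ 9) ⊛ (P⁴ ⊛ R) ∎)
      where
      h : Series
      h = proj₁ (frobenius φ)
      cubeφ : cube φ ≈ α ⊕ const (+ 3) ⊛ h
      cubeφ = proj₂ (frobenius φ)
      P⁴ R : Series
      P⁴ = P ⊛ cube P
      R  = const (+ 3) ⊛ (h ⊛ h ⊛ cube φ) ⊕ ⊖ (const (+ 3) ⊛ (h ⊛ h ⊛ h)) ⊕ ⊖ (h ⊛ cube φ ⊛ cube φ)
      𝟏≈ : 𝟏 ≈ fourth ⊛ P⁴
      𝟏≈ = begin
        𝟏                                      ≈⟨ solve 0 (con 1ℤ := con 1ℤ :* (con 1ℤ :* (con 1ℤ :* con 1ℤ))) ≈-refl ⟩
        𝟏 ⊛ cube 𝟏                             ≈⟨ ⊛-cong φ⊛P≈𝟏 (cube-cong φ⊛P≈𝟏) ⟨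
        (φ ⊛ P) ⊛ cube (φ ⊛ P)
          ≈⟨ solve 2 (λ f p → (f :* p) :* ((f :* p) :* ((f :* p) :* (f :* p))) :=
               f :* (f :* (f :* f)) :* (p :* (p :* (p :* p)))) ≈-refl φ P ⟩
        fourth ⊛ P⁴ ∎

    fourth-unique : ∀ E → E 0 ≡ 1ℤ → θ E ≈ ⊖ (const (+ 4) ⊛ C) ⊛ E → fourth ≈ E
    fourth-unique E E₀ θE = ode-unique (cong (λ c → - (+ 4 * c)) C₀) θ-fourth θE
      (trans (cong (λ c → c * (c * (c * c))) φ₀) (sym E₀))

-- Generating functions of weighted classes and of overpartitions

module OverpartitionSeries where

  open import Data.Integer.Base using (_+_; _*_)
  open import Data.List.Base using (List; []; _∷_; length; map; concatMap; cartesianProductWith; upTo; _++_)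
  open import Data.List.Properties using (length-++; length-map)
  import Data.List.Relation.Unary.All as All
  import Data.List.Relation.Unary.AllPairs as AllPairs
  open import Data.List.Relation.Unary.Any using (here)
  open import Data.Nat.DivMod using (_/_; m/n*n≤m; m*n/n≡m; /-monoˡ-≤)
  open import Data.Nat.Divisibility using (_∣?_; divides)
  open FiniteSums
  open PowerSeries
  open Dilation
  open ≡-Reasoning

  private
    variable
      A B : Set
      P Q : A → Set

  ∑-singleton : (F : Finite P) {a : A} → P a → (∀ x → P x → x ≡ a) → (w : A → ℤ) → ∑ F w ≡ w a
  ∑-singleton {P = P} F {a} p only w = trans (sym (∑-bij {P = λ x → x ≡ a} {v = w} one F (λ x → x)
    (λ { refl → p }) (λ _ _ eq → eq) (λ q → _ , only _ q , refl) (λ _ _ → refl)))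
    (trans (∑-elements one w) (ℤ.+-identityʳ (w a)))
    where
    one : Finite (λ x → x ≡ a)
    one = record
      { elements = a ∷ []
      ; unique   = All.[] AllPairs.∷ AllPairs.[]
      ; sound    = λ { (here eq) → eq }
      ; complete = here
      }

  ∑-below-sucʳ : ∀ n (w : ℕ → ℤ) → ∑ (below (suc n)) w ≡ ∑ (below n) w + w n
  ∑-below-sucʳ zero    w = trans (∑-below-suc 0 w) (trans (ℤ.+-comm (w 0) _) (cong (_+ w 0)
    (trans (∑-empty {w = w ∘ suc} (below 0) λ _ ()) (sym (∑-empty {w = w} (below 0) λ _ ())))))
  ∑-below-sucʳ (suc n) w = begin
    ∑ (below (suc (suc n))) w                          ≡⟨ ∑-below-suc (suc n) w ⟩
    w 0 + ∑ (below (suc n)) (w ∘ suc)                  ≡⟨ cong (_+_ (w 0)) (∑-below-sucʳ n (w ∘ suc)) ⟩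
    w 0 + (∑ (below n) (w ∘ suc) + w (suc n))          ≡⟨ ℤ.+-assoc (w 0) _ _ ⟨
    w 0 + ∑ (below n) (w ∘ suc) + w (suc n)            ≡⟨ cong (_+ w (suc n)) (∑-below-suc n w) ⟨
    ∑ (below (suc n)) w + w (suc n)                    ∎

  ⊛-∑ : ∀ f g n → (f ⊛ g) n ≡ ∑ (below (suc n)) (λ i → f i * g (n ℕ.∸ i))
  ⊛-∑ f g zero    = sym (∑-singleton (below 1) (s≤s z≤n) (λ { zero _ → refl ; (suc _) (s≤s ()) }) _)
  ⊛-∑ f g (suc n) = trans (cong (_+_ (f 0 * g (suc n))) (⊛-∑ (tail f) g n))
    (sym (∑-below-suc (suc n) (λ i → f i * g (suc n ℕ.∸ i))))

  -- A weighted combinatorial class with finitely many objects in each degree. Through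
  -- `⊛-generates`, products of series become sums over pairs of objects.
  record Generates {A : Set} (P : A → Set) (deg : A → ℕ) (w : A → ℤ) (f : Series) : Set where
    field
      fibre       : ∀ n → Finite (λ a → P a × deg a ≡ n)
      coefficient : ∀ n → f n ≡ ∑ (fibre n) w

  open Generates public

  module _ {A B : Set} {P : A → Set} {Q : B → Set} {deg : A → ℕ} {deg′ : B → ℕ}
           {v : A → ℤ} {w : B → ℤ} {f g : Series}
           (F : Generates P deg v f) (G : Generates Q deg′ w g) where

    ⊛-generates : ∀ {n} (H : Finite (λ (a , b) → (P a × Q b) × deg a ℕ.+ deg′ b ≡ n)) →
                  (f ⊛ g) n ≡ ∑ H (λ (a , b) → v a * w b)
    ⊛-generates {n} H = begin
      (f ⊛ g) n
        ≡⟨ ⊛-∑ f g n ⟩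
      ∑ (below (suc n)) (λ i → f i * g (n ℕ.∸ i))
        ≡⟨ ∑-cong (below (suc n)) (λ i _ → trans (cong₂ _*_ (coefficient F i) (coefficient G (n ℕ.∸ i)))
             (sym (∑-product (fibre F i) (fibre G (n ℕ.∸ i)) v w))) ⟩
      ∑ (below (suc n)) (λ i → ∑ (product (fibre F i) (fibre G (n ℕ.∸ i))) (λ (a , b) → v a * w b))
        ≡⟨ ∑-dependent (λ i → product (fibre F i) (fibre G (n ℕ.∸ i))) (below (suc n)) _ ⟨
      ∑ (dependent (λ i → product (fibre F i) (fibre G (n ℕ.∸ i))) (below (suc n)))
        (λ (i , a , b) → v a * w b)
        ≡⟨ ∑-bij (dependent (λ i → product (fibre F i) (fibre G (n ℕ.∸ i))) (below (suc n))) H proj₂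
             (λ { {i , _} (i<1+n , (p , refl) , q , e) →
                  (p , q) , trans (cong (i ℕ.+_) e) (ℕ.m+[n∸m]≡n (ℕ.≤-pred i<1+n)) })
             (λ { (_ , (_ , refl) , _) (_ , (_ , refl) , _) refl → refl })
             (λ { {a , b} ((p , q) , refl) → (deg a , a , b) ,
                  (s≤s (ℕ.m≤m+n (deg a) (deg′ b)) , (p , refl) , q , sym (ℕ.m+n∸m≡n (deg a) (deg′ b))) , refl })
             (λ _ _ → refl) ⟩
      ∑ H (λ (a , b) → v a * w b) ∎

  dilate-∑ : ∀ k f {n} (F : Finite (λ j → j ℕ.* suc k ≡ n)) → dilate k 0 f n ≡ ∑ F f
  dilate-∑ k f {n} F with suc k ∣? n
  ... | yes (divides j refl) = trans (dilate-multiple k f j)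
    (sym (∑-singleton F refl (λ i eq → ℕ.*-cancelʳ-≡ i j (suc k) eq) f))
  ... | no k∤n = trans (dilate-other k f n (λ j eq → k∤n (divides j eq)))
    (sym (∑-empty F λ j eq → k∤n (divides j (sym eq))))

  multiples : ∀ k n → Finite (λ j → j ℕ.* suc k ≡ n)
  multiples k n = cover ℕ._≟_ (λ j → j ℕ.* suc k ℕ.≟ n) (elements (below (suc n)))
    λ { {j} refl → complete (below (suc n)) (s≤s (ℕ.m≤m*n j (suc k))) }

  sgn : ℕ → ℤ
  sgn zero    = 1ℤ
  sgn (suc n) = - sgn n

  -- Twice the indicator of odd n; as a series, the logarithmic derivative of (1 + q) / (1 - q).
  odd : Series
  odd n = 1ℤ - sgn n

  -- The series (1 + q) / (1 - q): j copies of one part, the first of them possibly overlined.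
  onceOverlined : Series
  onceOverlined zero    = 1ℤ
  onceOverlined (suc n) = + 2

  θ-onceOverlined : θ onceOverlined ≈ onceOverlined ⊛ odd
  θ-onceOverlined = coefficientwise λ
    { zero    → refl
    ; (suc n) → sym (trans (cong (_+_ (1ℤ * odd (suc n))) (twos n)) (collect n (sgn n))) }
    where
    step : ∀ n s → + 2 * (1ℤ - - s) + (+ 2 * n + 1ℤ - s) ≡ + 2 * (1ℤ + n) + 1ℤ - - s
    step = solve-∀

    twos : ∀ n → ((λ _ → + 2) ⊛ odd) n ≡ + 2 * + n + 1ℤ - sgn n
    twos zero    = refl
    twos (suc n) = trans (cong (_+_ (+ 2 * odd (suc n))) (twos n))
      (trans (step (+ n) (sgn n)) (cong (λ m → + 2 * m + 1ℤ - - sgn n) (sym (ℤ.pos-+ 1 n))))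

    regroup : ∀ n s → 1ℤ * (1ℤ - - s) + (+ 2 * n + 1ℤ - s) ≡ (1ℤ + n) * + 2
    regroup = solve-∀

    collect : ∀ n s → 1ℤ * (1ℤ - - s) + (+ 2 * + n + 1ℤ - s) ≡ + suc n * + 2
    collect n s = trans (regroup (+ n) s) (cong (_* + 2) (sym (ℤ.pos-+ 1 n)))

  p̄≤ : ℕ → Series
  p̄≤ k n = + length (overpartitions≤ k n)

  +length-concatMap : ∀ (f : A → List B) xs → + length (concatMap f xs) ≡ ∑ˡ xs (λ x → + length (f x))
  +length-concatMap f []       = refl
  +length-concatMap f (x ∷ xs) = trans (cong +_ (length-++ (f x)))
    (trans (ℤ.pos-+ (length (f x)) _) (cong (_+_ (+ length (f x))) (+length-concatMap f xs)))

  length-product : ∀ {C : Set} (f : A → B → C) xs ys →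
                   length (cartesianProductWith f xs ys) ≡ length xs ℕ.* length ys
  length-product f []       ys = refl
  length-product f (x ∷ xs) ys = trans (length-++ (map (f x) ys))
    (cong₂ ℕ._+_ (length-map (f x) ys) (length-product f xs ys))

  +length-copies : ∀ k j → + length (copies k j) ≡ onceOverlined j
  +length-copies k zero    = refl
  +length-copies k (suc j) = refl

  -- The enumeration is already grouped by the multiplicity j of the part k + 1. Since j (k + 1) is
  -- the exponent taken from the first factor, the concatenation over j is a Cauchy product.
  p̄≤-suc : ∀ k → p̄≤ (suc k) ≈ dilate k 0 onceOverlined ⊛ p̄≤ k
  p̄≤-suc k = coefficientwise λ n → sym (begin
    (dilate k 0 onceOverlined ⊛ p̄≤ k) n
      ≡⟨ ⊛-∑ (dilate k 0 onceOverlined) (p̄≤ k) n ⟩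
    ∑ (below (suc n)) (λ i → dilate k 0 onceOverlined i * p̄≤ k (n ℕ.∸ i))
      ≡⟨ ∑-cong (below (suc n)) (λ i _ → inner n i) ⟩
    ∑ (below (suc n)) (λ i → ∑ (multiples k i) (λ j → p̄≤ k (n ℕ.∸ i) * onceOverlined j))
      ≡⟨ ∑-dependent (multiples k) (below (suc n)) _ ⟨
    ∑ (dependent (multiples k) (below (suc n))) (λ (i , j) → p̄≤ k (n ℕ.∸ i) * onceOverlined j)
      ≡⟨ ∑-bij (dependent (multiples k) (below (suc n))) (below (suc (n / suc k))) proj₂
           (λ { {_ , j} (i<1+n , refl) → s≤s (subst (ℕ._≤ n / suc k) (m*n/n≡m j (suc k))
                  (/-monoˡ-≤ (suc k) (ℕ.≤-pred i<1+n))) })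
           (λ { (_ , refl) (_ , refl) refl → refl })
           (λ { {j} j< → (j ℕ.* suc k , j) , (s≤s (ℕ.≤-trans (ℕ.*-monoˡ-≤ (suc k) (ℕ.≤-pred j<))
                  (m/n*n≤m n (suc k))) , refl) , refl })
           (λ { (_ , j) (_ , refl) → sym (block n j) }) ⟩
    ∑ (below (suc (n / suc k))) (λ j → + length (blocks n j))
      ≡⟨ trans (+length-concatMap (blocks n) (upTo (suc (n / suc k)))) (sym (∑-elements (below (suc (n / suc k))) _)) ⟨
    p̄≤ (suc k) n ∎)
    where
    blocks : ℕ → ℕ → List (List Part)
    blocks n j = cartesianProductWith _++_ (copies (suc k) j) (overpartitions≤ k (n ℕ.∸ j ℕ.* suc k))

    inner : ∀ n i → dilate k 0 onceOverlined i * p̄≤ k (n ℕ.∸ i) ≡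
            ∑ (multiples k i) (λ j → p̄≤ k (n ℕ.∸ i) * onceOverlined j)
    inner n i = trans (ℤ.*-comm (dilate k 0 onceOverlined i) (p̄≤ k (n ℕ.∸ i)))
      (trans (cong (p̄≤ k (n ℕ.∸ i) *_) (dilate-∑ k onceOverlined (multiples k i)))
        (sym (∑-* (p̄≤ k (n ℕ.∸ i)) (multiples k i) onceOverlined)))

    block : ∀ n j → + length (blocks n j) ≡ p̄≤ k (n ℕ.∸ j ℕ.* suc k) * onceOverlined j
    block n j = begin
      + length (blocks n j)
        ≡⟨ cong +_ (length-product _++_ (copies (suc k) j) _) ⟩
      + (length (copies (suc k) j) ℕ.* length (overpartitions≤ k (n ℕ.∸ j ℕ.* suc k)))
        ≡⟨ ℤ.pos-* (length (copies (suc k) j)) _ ⟩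
      + length (copies (suc k) j) * p̄≤ k (n ℕ.∸ j ℕ.* suc k)
        ≡⟨ cong (_* p̄≤ k (n ℕ.∸ j ℕ.* suc k)) (+length-copies (suc k) j) ⟩
      onceOverlined j * p̄≤ k (n ℕ.∸ j ℕ.* suc k)
        ≡⟨ ℤ.*-comm (onceOverlined j) _ ⟩
      p̄≤ k (n ℕ.∸ j ℕ.* suc k) * onceOverlined j ∎

  logDerivative≤ : ℕ → Series
  logDerivative≤ zero    = 𝟎
  logDerivative≤ (suc k) = logDerivative≤ k ⊕ (λ n → + suc k * dilate k 0 odd n)

  θ-p̄≤ : ∀ k → θ (p̄≤ k) ≈ p̄≤ k ⊛ logDerivative≤ k
  θ-p̄≤ zero    = coefficientwise λ n → trans (vanish n) (sym (trans (⊛-comm′ (p̄≤ 0) 𝟎 n) (⊛-zeroˡ (p̄≤ 0) n)))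
    where
    vanish : ∀ n → θ (p̄≤ 0) n ≡ 0ℤ
    vanish zero    = refl
    vanish (suc n) = ℤ.*-zeroʳ (+ suc n)
  θ-p̄≤ (suc k) = R.begin
    θ (p̄≤ (suc k))                                      R.≈⟨ θ-cong (p̄≤-suc k) ⟩
    θ (D ⊛ p̄≤ k)                                        R.≈⟨ θ-⊛ D (p̄≤ k) ⟩
    θ D ⊛ p̄≤ k ⊕ D ⊛ θ (p̄≤ k)
      R.≈⟨ ⊕-cong (⊛-congˡ θD) (⊛-congʳ {D} (θ-p̄≤ k)) ⟩
    (D ⊛ K) ⊛ p̄≤ k ⊕ D ⊛ (p̄≤ k ⊛ logDerivative≤ k)
      R.≈⟨ solve 4 (λ d x p l → (d :* x) :* p :+ d :* (p :* l) := (d :* p) :* (l :+ x)) ≈-refl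
             D K (p̄≤ k) (logDerivative≤ k) ⟩
    (D ⊛ p̄≤ k) ⊛ (logDerivative≤ k ⊕ K)                 R.≈⟨ ⊛-congˡ (p̄≤-suc k) ⟨
    p̄≤ (suc k) ⊛ (logDerivative≤ k ⊕ K)                 R.∎
    where
    module R = ≈-Reasoning
    open Solver
    D K : Series
    D = dilate k 0 onceOverlined
    K n = + suc k * dilate k 0 odd n

    θD : θ D ≈ D ⊛ K
    θD = R.begin
      θ D                                                 R.≈⟨ θ-dilate k onceOverlined ⟩
      (λ n → + suc k * dilate k 0 (θ onceOverlined) n)
        R.≈⟨ coefficientwise (λ n → cong (+ suc k *_)
               (trans (at (dilate-cong k 0 θ-onceOverlined) n) (sym (dilate-⊛ˡ k 0 onceOverlined odd n)))) ⟩
      (λ n → + suc k * (D ⊛ dilate k 0 odd) n)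
        R.≈⟨ coefficientwise (λ n → trans (cong (+ suc k *_) (⊛-comm′ D (dilate k 0 odd) n))
               (sym (⊛-scaleˡ (+ suc k) (dilate k 0 odd) D n))) ⟩
      K ⊛ D                                               R.≈⟨ ⊛-comm K D ⟩
      D ⊛ K                                               R.∎

  dilate-< : ∀ k r f n → n ℕ.< r → dilate k r f n ≡ 0ℤ
  dilate-< k (suc r) f zero    _         = refl
  dilate-< k (suc r) f (suc n) (s≤s n<r) = dilate-< k r f n n<r

  p̄-series : Series
  p̄-series n = + p̄ n

  logDerivative : Series
  logDerivative n = logDerivative≤ n n

  -- The factor for the part size k + 1 is 1 + O(q^(k+1)), so adjoining sizes above n leaves the
  -- coefficient of q^n alone. The infinite product is thus the diagonal of the finite ones.
  p̄≤-stable : ∀ {k n} → n ℕ.≤ k → p̄≤ k n ≡ p̄-series n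
  p̄≤-stable {n = n} n≤k = go (ℕ.≤⇒≤′ n≤k)
    where
    go : ∀ {k} → n ℕ.≤′ k → p̄≤ k n ≡ p̄-series n
    go ℕ.≤′-refl = refl
    go {suc k} (ℕ.≤′-step n≤k) = begin
      p̄≤ (suc k) n                                 ≡⟨ at (p̄≤-suc k) n ⟩
      (dilate k 0 onceOverlined ⊛ p̄≤ k) n          ≡⟨ ⊛-cong-≤ {g = p̄≤ k} n (λ i≤n → trivial (ℕ.≤-trans i≤n (ℕ.≤′⇒≤ n≤k))) (λ _ → refl) ⟩
      (𝟏 ⊛ p̄≤ k) n                                 ≡⟨ at (⊛-identityˡ (p̄≤ k)) n ⟩
      p̄≤ k n                                       ≡⟨ go n≤k ⟩
      p̄-series n                                   ∎
      where
      trivial : ∀ {i} → i ℕ.≤ k → dilate k 0 onceOverlined i ≡ 𝟏 i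
      trivial {zero}  _   = refl
      trivial {suc i} i<k = dilate-< k k _ i i<k

  logDerivative≤-stable : ∀ {k n} → n ℕ.≤ k → logDerivative≤ k n ≡ logDerivative n
  logDerivative≤-stable {n = n} n≤k = go (ℕ.≤⇒≤′ n≤k)
    where
    go : ∀ {k} → n ℕ.≤′ k → logDerivative≤ k n ≡ logDerivative n
    go ℕ.≤′-refl = refl
    go {suc k} (ℕ.≤′-step n≤k) = begin
      logDerivative≤ k n + + suc k * dilate k 0 odd n   ≡⟨ cong (λ t → logDerivative≤ k n + + suc k * t) (trivial (ℕ.≤′⇒≤ n≤k)) ⟩
      logDerivative≤ k n + + suc k * 0ℤ                 ≡⟨ cong (_+_ (logDerivative≤ k n)) (ℤ.*-zeroʳ (+ suc k)) ⟩
      logDerivative≤ k n + 0ℤ                           ≡⟨ ℤ.+-identityʳ _ ⟩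
      logDerivative≤ k n                                ≡⟨ go n≤k ⟩
      logDerivative n                                   ∎
      where
      trivial : ∀ {i} → i ℕ.≤ k → dilate k 0 odd i ≡ 0ℤ
      trivial {zero}  _   = refl
      trivial {suc i} i<k = dilate-< k k _ i i<k

  θ-p̄ : θ p̄-series ≈ p̄-series ⊛ logDerivative
  θ-p̄ = coefficientwise λ n → begin
    + n * p̄≤ n n                       ≡⟨ at (θ-p̄≤ n) n ⟩
    (p̄≤ n ⊛ logDerivative≤ n) n        ≡⟨ ⊛-cong-≤ n p̄≤-stable logDerivative≤-stable ⟩
    (p̄-series ⊛ logDerivative) n       ∎

  Factorisation : ℕ → ℕ × ℕ → Set
  Factorisation n (a , x) = (0 ℕ.< a × 0 ℕ.< x) × a ℕ.* x ≡ n

  factorisations : ∀ n → Finite (Factorisation n)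
  factorisations n = cover (≡-dec ℕ._≟_ ℕ._≟_)
    (λ (a , x) → ((0 ℕ.<? a) ×-dec (0 ℕ.<? x)) ×-dec (a ℕ.* x ℕ.≟ n))
    (elements (product (below (suc n)) (below (suc n))))
    λ { {a , x} ((0<a , 0<x) , refl) → complete (product (below (suc n)) (below (suc n)))
        ( s≤s (ℕ.m≤m*n a x {{ℕ.>-nonZero 0<x}})
        , s≤s (ℕ.m≤n*m x a {{ℕ.>-nonZero 0<a}}) ) }

  logDerivative≤-∑ : ∀ k n → logDerivative≤ k n ≡ ∑ (below k) (λ i → + suc i * dilate i 0 odd n)
  logDerivative≤-∑ zero    n = sym (∑-empty (below 0) λ _ ())
  logDerivative≤-∑ (suc k) n = trans (cong (_+ + suc k * dilate k 0 odd n) (logDerivative≤-∑ k n))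
    (sym (∑-below-sucʳ k (λ i → + suc i * dilate i 0 odd n)))

  -- A Lambert series rewritten over divisors: a = i + 1 is the part size and x its cofactor in n.
  logDerivative-∑ : ∀ n → logDerivative n ≡ ∑ (factorisations n) (λ (a , x) → + a * odd x)
  logDerivative-∑ n = begin
    logDerivative n
      ≡⟨ logDerivative≤-∑ n n ⟩
    ∑ (below n) (λ i → + suc i * dilate i 0 odd n)
      ≡⟨ ∑-cong (below n) (λ i _ → trans (cong (+ suc i *_) (dilate-∑ i odd (multiples i n)))
           (sym (∑-* (+ suc i) (multiples i n) odd))) ⟩
    ∑ (below n) (λ i → ∑ (multiples i n) (λ x → + suc i * odd x))
      ≡⟨ ∑-dependent (λ i → multiples i n) (below n) _ ⟨
    ∑ (dependent (λ i → multiples i n) (below n)) (λ (i , x) → + suc i * odd x)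
      ≡⟨ ∑-bij (dependent (λ i → multiples i n) (below n)) (factorisations n) (λ (i , x) → suc i , x)
           (λ { {i , zero} (() , refl)
              ; {i , suc x} (i<n , eq) → (s≤s z≤n , s≤s z≤n) , trans (ℕ.*-comm (suc i) (suc x)) eq })
           (λ { _ _ refl → refl })
           (λ { {zero , x} ((() , _) , _)
              ; {suc i , x} ((_ , 0<x) , refl) → (i , x) ,
                  (ℕ.m≤m*n (suc i) x {{ℕ.>-nonZero 0<x}} , ℕ.*-comm x (suc i)) , refl })
           (λ _ _ → refl) ⟩
    ∑ (factorisations n) (λ (a , x) → + a * odd x) ∎

  logDerivative-generates : Generates (λ (a , x) → 0 ℕ.< a × 0 ℕ.< x) (λ (a , x) → a ℕ.* x)
                                      (λ (a , x) → + a * odd x) logDerivative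
  logDerivative-generates = record { fibre = factorisations ; coefficient = logDerivative-∑ }

-- The logarithmic derivative as an eigenvector of the Hecke operator at 3

module HeckeAtThree where

  open import Data.Integer.Base using (_+_; _*_)
  open import Data.Nat.Divisibility using (_∣_; _∣?_; divides; divides-refl)
  open import Data.Nat.Primality using (Prime; prime?; euclidsLemma)
  open import Relation.Nullary.Decidable using (from-yes)
  open FiniteSums
  open PowerSeries
  open Dilation
  open OverpartitionSeries
  open ≡-Reasoning

  prime-3 : Prime 3
  prime-3 = from-yes (prime? 3)

  sgn-*3 : ∀ x → sgn (x ℕ.* 3) ≡ sgn x
  sgn-*3 zero    = refl
  sgn-*3 (suc x) = trans (cong (λ s → - - - s) (sgn-*3 x)) (cong -_ (ℤ.neg-involutive (sgn x)))

  0<*3⇒0< : ∀ {x} → 0 ℕ.< x ℕ.* 3 → 0 ℕ.< x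
  0<*3⇒0< {suc x} _ = s≤s z≤n

  0<⇒0<*3 : ∀ {x} → 0 ℕ.< x → 0 ℕ.< x ℕ.* 3
  0<⇒0<*3 {suc x} _ = s≤s z≤n

  *3-swap : ∀ a x → a ℕ.* 3 ℕ.* x ≡ a ℕ.* x ℕ.* 3
  *3-swap a x = trans (ℕ.*-assoc a 3 x) (trans (cong (a ℕ.*_) (ℕ.*-comm 3 x)) (sym (ℕ.*-assoc a x 3)))

  -- Factorisations ax = 3j with 3 | a are those of j with a tripled, so their weight triples. If 3
  -- ∤ a, then 3 | x, and dividing x by 3 keeps its parity: these are the factorisations of j with 3
  -- ∤ a, at the same weight. The missing ones, with 3 | a, are supplied by 3 V C.
  logDerivative-hecke₃ : section 0 logDerivative ⊕ const (+ 3) ⊛ V logDerivative ≈ const (+ 4) ⊛ logDerivative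
  logDerivative-hecke₃ = coefficientwise λ j → begin
    section 0 logDerivative j + (const (+ 3) ⊛ V logDerivative) j
      ≡⟨ cong₂ _+_ (trans (section-at 0 logDerivative j) (logDerivative-∑ (j ℕ.* 3)))
           (trans (const-⊛ (+ 3) (V logDerivative) j) (thirds j)) ⟩
    ∑ (factorisations (j ℕ.* 3)) w + ∑ (factorisations j ∩ 3∣?) w
      ≡⟨ cong (_+ ∑ (factorisations j ∩ 3∣?) w) (trans
           (∑-∩ (factorisations (j ℕ.* 3)) 3∣? (factorisations (j ℕ.* 3) ∩ 3∤?) w)
           (cong₂ _+_ (sym (left j)) (sym (right j)))) ⟩
    + 3 * ∑ (factorisations j) w + ∑ (factorisations j ∩ 3∤?) w + ∑ (factorisations j ∩ 3∣?) w
      ≡⟨ regroup (+ 3 * ∑ (factorisations j) w) _ _ ⟩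
    + 3 * ∑ (factorisations j) w + (∑ (factorisations j ∩ 3∣?) w + ∑ (factorisations j ∩ 3∤?) w)
      ≡⟨ cong (_+_ (+ 3 * ∑ (factorisations j) w)) (∑-∩ (factorisations j) 3∣? (factorisations j ∩ 3∤?) w) ⟨
    + 3 * ∑ (factorisations j) w + ∑ (factorisations j) w
      ≡⟨ four (∑ (factorisations j) w) ⟩
    + 4 * ∑ (factorisations j) w
      ≡⟨ cong (+ 4 *_) (logDerivative-∑ j) ⟨
    + 4 * logDerivative j
      ≡⟨ const-⊛ (+ 4) logDerivative j ⟨
    (const (+ 4) ⊛ logDerivative) j ∎
    where
    w : ℕ × ℕ → ℤ
    w (a , x) = + a * odd x

    3∣? = λ (ax : ℕ × ℕ) → 3 ∣? proj₁ ax
    3∤? = λ (ax : ℕ × ℕ) → ¬? (3 ∣? proj₁ ax)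

    regroup : ∀ a b c → a + b + c ≡ a + (c + b)
    regroup = solve-∀

    four : ∀ a → + 3 * a + a ≡ + 4 * a
    four = solve-∀

    w-*3 : ∀ a x → + 3 * (+ a * odd x) ≡ + (a ℕ.* 3) * odd x
    w-*3 a x = trans (move (+ a) (odd x)) (cong (_* odd x) (sym (ℤ.pos-* a 3)))
      where
      move : ∀ a o → + 3 * (a * o) ≡ a * + 3 * o
      move = solve-∀

    left : ∀ j → + 3 * ∑ (factorisations j) w ≡ ∑ (factorisations (j ℕ.* 3) ∩ 3∣?) w
    left j = trans (sym (∑-* (+ 3) (factorisations j) w))
      (∑-bij (factorisations j) (factorisations (j ℕ.* 3) ∩ 3∣?) (λ (a , x) → a ℕ.* 3 , x)
        (λ { {a , x} ((0<a , 0<x) , refl) →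
             ((0<⇒0<*3 0<a , 0<x) , *3-swap a x) , divides-refl a })
        (λ { {a , _} {b , _} _ _ eq → cong₂ _,_ (ℕ.*-cancelʳ-≡ a b 3 (cong proj₁ eq)) (cong proj₂ eq) })
        (λ { {_ , x} (((0<a , 0<x) , eq) , divides a refl) → (a , x) ,
             ((0<*3⇒0< 0<a , 0<x) , ℕ.*-cancelʳ-≡ _ _ 3 (trans (sym (*3-swap a x)) eq)) , refl })
        (λ (a , x) _ → w-*3 a x))

    right : ∀ j → ∑ (factorisations j ∩ 3∤?) w ≡ ∑ (factorisations (j ℕ.* 3) ∩ 3∤?) w
    right j = ∑-bij (factorisations j ∩ 3∤?) (factorisations (j ℕ.* 3) ∩ 3∤?) (λ (a , x) → a , x ℕ.* 3)
      (λ { {a , x} (((0<a , 0<x) , refl) , 3∤a) →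
           ((0<a , 0<⇒0<*3 0<x) , sym (ℕ.*-assoc a x 3)) , 3∤a })
      (λ { {_ , x} {_ , y} _ _ eq → cong₂ _,_ (cong proj₁ eq) (ℕ.*-cancelʳ-≡ x y 3 (cong proj₂ eq)) })
      surj
      (λ (a , x) _ → cong (λ s → + a * (1ℤ - s)) (sym (sgn-*3 x)))
      where
      surj : ∀ {ax} → Factorisation (j ℕ.* 3) ax × ¬ (3 ∣ proj₁ ax) →
             ∃ λ by → (Factorisation j by × ¬ (3 ∣ proj₁ by)) × (proj₁ by , proj₂ by ℕ.* 3) ≡ ax
      surj {a , x} (((0<a , 0<x) , eq) , 3∤a) with euclidsLemma a x prime-3 (divides j eq)
      ... | inj₁ 3∣a = contradiction 3∣a 3∤a
      ... | inj₂ (divides y refl) = (a , y) ,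
        (((0<a , 0<*3⇒0< 0<x) , ℕ.*-cancelʳ-≡ _ _ 3 (trans (ℕ.*-assoc a y 3) eq)) , 3∤a) , refl

    thirds : ∀ j → + 3 * V logDerivative j ≡ ∑ (factorisations j ∩ 3∣?) w
    thirds j = begin
      + 3 * V logDerivative j
        ≡⟨ cong (+ 3 *_) (dilate-∑ 2 logDerivative (multiples 2 j)) ⟩
      + 3 * ∑ (multiples 2 j) logDerivative
        ≡⟨ cong (+ 3 *_) (trans (∑-cong (multiples 2 j) (λ i _ → logDerivative-∑ i))
             (sym (∑-dependent factorisations (multiples 2 j) _))) ⟩
      + 3 * ∑ (dependent factorisations (multiples 2 j)) (λ (_ , ax) → w ax)
        ≡⟨ ∑-* (+ 3) (dependent factorisations (multiples 2 j)) _ ⟨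
      ∑ (dependent factorisations (multiples 2 j)) (λ (_ , ax) → + 3 * w ax)
        ≡⟨ ∑-bij (dependent factorisations (multiples 2 j)) (factorisations j ∩ 3∣?)
             (λ (_ , a , x) → a ℕ.* 3 , x)
             (λ { {_ , a , x} (refl , (0<a , 0<x) , refl) →
                  ((0<⇒0<*3 0<a , 0<x) , *3-swap a x) , divides-refl a })
             (λ { {_ , a , x} {_ , b , y} (_ , _ , refl) (_ , _ , refl) eq →
                  cong₂ (λ a x → a ℕ.* x , a , x) (ℕ.*-cancelʳ-≡ a b 3 (cong proj₁ eq)) (cong proj₂ eq) })
             (λ { {_ , x} (((0<a , 0<x) , refl) , divides a refl) → (a ℕ.* x , a , x) ,
                  (sym (*3-swap a x) , (0<*3⇒0< 0<a , 0<x) , refl) , refl })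
             (λ (_ , a , x) _ → w-*3 a x) ⟩
      ∑ (factorisations j ∩ 3∣?) w ∎

-- Liouville's bijections on a x + b y = n

module LiouvilleIdentity where

  open import Data.Integer.Base using (_+_; _*_)
  open import Data.Product.Base using (swap)
  open import Relation.Binary.Definitions using (tri<; tri≈; tri>)
  open FiniteSums
  open PowerSeries
  open Dilation
  open OverpartitionSeries
  open ≡-Reasoning

  sgn-+ : ∀ m n → sgn (m ℕ.+ n) ≡ sgn m * sgn n
  sgn-+ zero    n = sym (ℤ.*-identityˡ (sgn n))
  sgn-+ (suc m) n = trans (cong -_ (sgn-+ m n)) (ℤ.neg-distribˡ-* (sgn m) (sgn n))

  sgn² : ∀ n → sgn n * sgn n ≡ 1ℤ
  sgn² zero    = refl
  sgn² (suc n) = trans (square (sgn n)) (sgn² n)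
    where
    square : ∀ s → - s * - s ≡ s * s
    square = solve-∀

  sgn-double : ∀ n → sgn (n ℕ.+ n) ≡ 1ℤ
  sgn-double n = trans (sgn-+ n n) (sgn² n)

  sgn-cancel : ∀ m n → sgn (m ℕ.+ n) * sgn n ≡ sgn m
  sgn-cancel m n = trans (cong (_* sgn n) (sgn-+ m n)) (trans (ℤ.*-assoc (sgn m) (sgn n) (sgn n))
    (trans (cong (sgn m *_) (sgn² n)) (ℤ.*-identityʳ (sgn m))))

  sgn-absorb : ∀ m n → sgn (m ℕ.+ (m ℕ.+ n)) ≡ sgn n
  sgn-absorb m n = trans (cong sgn (sym (ℕ.+-assoc m m n))) (trans (sgn-+ (m ℕ.+ m) n)
    (trans (cong (_* sgn n) (sgn-double m)) (ℤ.*-identityˡ (sgn n))))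

  ∑-trisect : {A : Set} {P : A → Set} (F : Finite P) (f g : A → ℕ) (w : A → ℤ) →
    ∑ F w ≡ ∑ (F ∩ λ x → f x ℕ.<? g x) w + ∑ (F ∩ λ x → g x ℕ.<? f x) w + ∑ (F ∩ λ x → f x ℕ.≟ g x) w
  ∑-trisect {P = P} F f g w = begin
    ∑ F w
      ≡⟨ ∑-∩ F f<g? (F ∩ λ x → ¬? (f<g? x)) w ⟩
    ∑ (F ∩ f<g?) w + ∑ (F ∩ λ x → ¬? (f<g? x)) w
      ≡⟨ cong (_+_ (∑ (F ∩ f<g?) w)) (∑-split (F ∩ λ x → ¬? (f<g? x)) (F ∩ λ x → g x ℕ.<? f x) (F ∩ λ x → f x ℕ.≟ g x)
           to (λ (p , g<f) → p , ℕ.<-asym g<f) (λ (p , f≡g) → p , λ f<g → ℕ.<-irrefl f≡g f<g)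
           (λ (_ , g<f) (_ , f≡g) → ℕ.<-irrefl (sym f≡g) g<f) w) ⟩
    ∑ (F ∩ f<g?) w + (∑ (F ∩ λ x → g x ℕ.<? f x) w + ∑ (F ∩ λ x → f x ℕ.≟ g x) w)
      ≡⟨ ℤ.+-assoc (∑ (F ∩ f<g?) w) _ _ ⟨
    ∑ (F ∩ f<g?) w + ∑ (F ∩ λ x → g x ℕ.<? f x) w + ∑ (F ∩ λ x → f x ℕ.≟ g x) w ∎
    where
    f<g? = λ x → f x ℕ.<? g x
    to : ∀ {x} → P x × ¬ (f x ℕ.< g x) → (P x × g x ℕ.< f x) ⊎ (P x × f x ≡ g x)
    to {x} (p , f≮g) with ℕ.<-cmp (f x) (g x)
    ... | tri< f<g _ _ = contradiction f<g f≮g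
    ... | tri≈ _ f≡g _ = inj₂ (p , f≡g)
    ... | tri> _ _ g<f = inj₁ (p , g<f)

  Quadruple : Set
  Quadruple = (ℕ × ℕ) × (ℕ × ℕ)

  Convolution : ℕ → Quadruple → Set
  Convolution n ((a , x) , b , y) = ((0 ℕ.< a × 0 ℕ.< x) × 0 ℕ.< b × 0 ℕ.< y) × a ℕ.* x ℕ.+ b ℕ.* y ≡ n

  convolutions : ∀ n → Finite (Convolution n)
  convolutions n = cover (≡-dec (≡-dec ℕ._≟_ ℕ._≟_) (≡-dec ℕ._≟_ ℕ._≟_))
    (λ ((a , x) , b , y) → (((0 ℕ.<? a) ×-dec (0 ℕ.<? x)) ×-dec ((0 ℕ.<? b) ×-dec (0 ℕ.<? y)))
                           ×-dec (a ℕ.* x ℕ.+ b ℕ.* y ℕ.≟ n))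
    (elements (product box box))
    λ { {(a , x) , b , y} (((0<a , 0<x) , 0<b , 0<y) , refl) → complete (product box box)
        ( ( s≤s (ℕ.≤-trans (ℕ.m≤m*n a x {{ℕ.>-nonZero 0<x}}) (ℕ.m≤m+n (a ℕ.* x) (b ℕ.* y)))
          , s≤s (ℕ.≤-trans (ℕ.m≤n*m x a {{ℕ.>-nonZero 0<a}}) (ℕ.m≤m+n (a ℕ.* x) (b ℕ.* y))))
        , ( s≤s (ℕ.≤-trans (ℕ.m≤m*n b y {{ℕ.>-nonZero 0<y}}) (ℕ.m≤n+m (b ℕ.* y) (a ℕ.* x)))
          , s≤s (ℕ.≤-trans (ℕ.m≤n*m y b {{ℕ.>-nonZero 0<b}}) (ℕ.m≤n+m (b ℕ.* y) (a ℕ.* x)))) ) }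
    where box = product (below (suc n)) (below (suc n))

  fstA sndA fstX sndX : Quadruple → ℕ
  fstA ((a , x) , b , y) = a
  sndA ((a , x) , b , y) = b
  fstX ((a , x) , b , y) = x
  sndX ((a , x) , b , y) = y

  module Liouville (n : ℕ) where

    H : Finite (Convolution n)
    H = convolutions n

    A> = H ∩ λ z → sndA z ℕ.<? fstA z
    A< = H ∩ λ z → fstA z ℕ.<? sndA z
    A≡ = H ∩ λ z → fstA z ℕ.≟ sndA z
    X> = H ∩ λ z → sndX z ℕ.<? fstX z
    X< = H ∩ λ z → fstX z ℕ.<? sndX z
    X≡ = H ∩ λ z → fstX z ℕ.≟ sndX z

    swap-Convolution : ∀ {z} → Convolution n z → Convolution n (swap z)
    swap-Convolution {(a , x) , b , y} ((p , q) , e) = (q , p) , trans (ℕ.+-comm (b ℕ.* y) (a ℕ.* x)) e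

    swap-A : ∀ w → ∑ A> w ≡ ∑ A< (w ∘ swap)
    swap-A w = ∑-inverse A> A< swap swap (λ (c , l) → swap-Convolution c , l) (λ (c , l) → swap-Convolution c , l)
      (λ _ _ → refl) (λ _ _ → refl) (λ _ _ → refl)

    swap-X : ∀ w → ∑ X> w ≡ ∑ X< (w ∘ swap)
    swap-X w = ∑-inverse X> X< swap swap (λ (c , l) → swap-Convolution c , l) (λ (c , l) → swap-Convolution c , l)
      (λ _ _ → refl) (λ _ _ → refl) (λ _ _ → refl)

    -- ax + by = (a - b)x + b(x + y)
    shear : Quadruple → Quadruple
    shear ((a , x) , b , y) = (a ℕ.∸ b , x) , b , x ℕ.+ y

    unshear : Quadruple → Quadruple
    unshear ((a , x) , b , y) = (a ℕ.+ b , x) , b , y ℕ.∸ x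

    shear-to : ∀ {z} → Convolution n z × sndA z ℕ.< fstA z → Convolution n (shear z) × fstX (shear z) ℕ.< sndX (shear z)
    shear-to {(a , x) , b , y} ((((0<a , 0<x) , 0<b , 0<y) , e) , b<a) =
      (((ℕ.m<n⇒0<n∸m b<a , 0<x) , 0<b , ℕ.<-≤-trans 0<x (ℕ.m≤m+n x y)) ,
        trans (expand (a ℕ.∸ b) b x y) (trans (cong (λ c → c ℕ.* x ℕ.+ b ℕ.* y) (ℕ.m∸n+n≡m (ℕ.<⇒≤ b<a))) e)) ,
      ℕ.m<m+n x 0<y
      where
      expand : ∀ d b x y → d ℕ.* x ℕ.+ b ℕ.* (x ℕ.+ y) ≡ (d ℕ.+ b) ℕ.* x ℕ.+ b ℕ.* y
      expand = ℕ-Solver.solve-∀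

    shear-from : ∀ {z} → Convolution n z × fstX z ℕ.< sndX z → Convolution n (unshear z) × sndA (unshear z) ℕ.< fstA (unshear z)
    shear-from {(a , x) , b , y} ((((0<a , 0<x) , 0<b , 0<y) , e) , x<y) =
      (((ℕ.<-≤-trans 0<a (ℕ.m≤m+n a b) , 0<x) , 0<b , ℕ.m<n⇒0<n∸m x<y) ,
        trans (expand a b x (y ℕ.∸ x)) (trans (cong (λ c → a ℕ.* x ℕ.+ b ℕ.* c) (ℕ.m+[n∸m]≡n (ℕ.<⇒≤ x<y))) e)) ,
      ℕ.m<n+m b 0<a
      where
      expand : ∀ a b x d → (a ℕ.+ b) ℕ.* x ℕ.+ b ℕ.* d ≡ a ℕ.* x ℕ.+ b ℕ.* (x ℕ.+ d)
      expand = ℕ-Solver.solve-∀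

    ∑-shear : ∀ w → ∑ A> (w ∘ shear) ≡ ∑ X< w
    ∑-shear w = ∑-inverse A> X< shear unshear shear-to shear-from
      (λ { ((a , x) , b , y) (_ , b<a) → cong₂ (λ a y → (a , x) , b , y) (ℕ.m∸n+n≡m (ℕ.<⇒≤ b<a)) (ℕ.m+n∸m≡n x y) })
      (λ { ((a , x) , b , y) (_ , x<y) → cong₂ (λ a y → (a , x) , b , y) (ℕ.m+n∸n≡m a b) (ℕ.m+[n∸m]≡n (ℕ.<⇒≤ x<y)) })
      (λ _ _ → refl)

    ∑-shear′ : ∀ w → ∑ A< (w ∘ swap ∘ shear ∘ swap) ≡ ∑ X> w
    ∑-shear′ w = begin
      ∑ A< (w ∘ swap ∘ shear ∘ swap)  ≡⟨ swap-A (w ∘ swap ∘ shear) ⟨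
      ∑ A> (w ∘ swap ∘ shear)         ≡⟨ ∑-shear (w ∘ swap) ⟩
      ∑ X< (w ∘ swap)                 ≡⟨ swap-X w ⟨
      ∑ X> w                          ∎

    -- `χ` is the sign weight of a product of two divisor sums, made symmetric. `χ′` is `χ`
    -- transported along `shear` and equally along `unshear`, because a - b and a + b have the same
    -- parity, as do y - x and y + x.
    χ χ′ : Quadruple → ℤ
    χ  ((a , x) , b , y) = sgn a * sgn x * odd y + sgn b * sgn y * odd x
    χ′ ((a , x) , b , y) = sgn (a ℕ.+ b) * sgn x * odd (x ℕ.+ y) + sgn b * sgn (x ℕ.+ y) * odd x

    plus² minus² first² χ-plus² χ-minus² χ′-first² : Quadruple → ℤ
    plus²  ((a , x) , b , y) = (+ a + + b) * (+ a + + b)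
    minus² ((a , x) , b , y) = (+ a - + b) * (+ a - + b)
    first² ((a , x) , b , y) = + a * + a
    χ-plus²   z = χ z * plus² z
    χ-minus²  z = χ z * minus² z
    χ′-first² z = χ′ z * first² z

    χ-swap : ∀ z → χ (swap z) ≡ χ z
    χ-swap ((a , x) , b , y) = ℤ.+-comm (sgn b * sgn y * odd x) (sgn a * sgn x * odd y)

    -- The new entries a - b and b add up to a, so (a + b)² turns into a². In `minus²-shear`,
    -- dually, the difference a - b is the new first entry.
    plus²-shear : ∀ z → Convolution n z × sndA z ℕ.< fstA z → χ-plus² (shear z) ≡ χ′-first² z
    plus²-shear ((a , x) , b , y) (_ , b<a) = go (a ℕ.∸ b) (sym (ℕ.m∸n+n≡m (ℕ.<⇒≤ b<a)))
      where
      go : ∀ d → a ≡ d ℕ.+ b → χ-plus² ((d , x) , b , x ℕ.+ y) ≡ χ′-first² ((a , x) , b , y)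
      go d refl = cong₂ (λ s t → (s * sgn x * odd (x ℕ.+ y) + sgn b * sgn (x ℕ.+ y) * odd x) * (t * t))
        (sym (trans (sgn-+ (d ℕ.+ b) b) (sgn-cancel d b)))
        (sym (ℤ.pos-+ d b))

    minus²-shear : ∀ z → Convolution n z × sndA z ℕ.< fstA z → χ-minus² z ≡ χ′-first² (shear z)
    minus²-shear ((a , x) , b , y) (_ , b<a) = go (a ℕ.∸ b) (sym (ℕ.m∸n+n≡m (ℕ.<⇒≤ b<a)))
      where
      cancel : ∀ d b → d + b - b ≡ d
      cancel = solve-∀
      go : ∀ d → a ≡ d ℕ.+ b → χ-minus² ((a , x) , b , y) ≡ χ′-first² ((d , x) , b , x ℕ.+ y)
      go d refl = cong₂ (λ s t → (sgn (d ℕ.+ b) * sgn x * (1ℤ - s) + sgn b * s * odd x) * (t * t))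
        (sym (sgn-absorb x y))
        (trans (cong (_- + b) (ℤ.pos-+ d b)) (cancel (+ d) (+ b)))

    -- The mirrored shear (a, x), (b, y) ↦ (a, x + y), (b - a, y) fixes a and exchanges the two
    -- summands of `χ′`.
    χ′-shear′ : ∀ z → Convolution n z × fstA z ℕ.< sndA z → χ′-first² z ≡ χ′-first² (swap (shear (swap z)))
    χ′-shear′ ((a , x) , b , y) (_ , a<b) = go (b ℕ.∸ a) (sym (ℕ.m∸n+n≡m (ℕ.<⇒≤ a<b)))
      where
      expand : ∀ x y → y ℕ.+ x ℕ.+ y ≡ y ℕ.+ (y ℕ.+ x)
      expand = ℕ-Solver.solve-∀
      commute : ∀ p q r s u v t → (p * q * r + s * u * v) * t ≡ (s * u * v + p * q * r) * t
      commute = solve-∀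
      go : ∀ d → b ≡ d ℕ.+ a → χ′-first² ((a , x) , b , y) ≡ χ′-first² ((a , y ℕ.+ x) , d , y)
      go d refl = begin
        (sgn (a ℕ.+ (d ℕ.+ a)) * sgn x * odd (x ℕ.+ y) + sgn (d ℕ.+ a) * sgn (x ℕ.+ y) * odd x) * (+ a * + a)
          ≡⟨ cong₂ (λ s t → (s * sgn x * odd t + sgn (d ℕ.+ a) * sgn t * odd x) * (+ a * + a))
               (trans (sgn-+ a (d ℕ.+ a)) (trans (ℤ.*-comm (sgn a) (sgn (d ℕ.+ a))) (sgn-cancel d a))) (ℕ.+-comm x y) ⟩
        (sgn d * sgn x * odd (y ℕ.+ x) + sgn (d ℕ.+ a) * sgn (y ℕ.+ x) * odd x) * (+ a * + a)
          ≡⟨ commute (sgn d) (sgn x) (odd (y ℕ.+ x)) (sgn (d ℕ.+ a)) (sgn (y ℕ.+ x)) (odd x) _ ⟩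
        (sgn (d ℕ.+ a) * sgn (y ℕ.+ x) * odd x + sgn d * sgn x * odd (y ℕ.+ x)) * (+ a * + a)
          ≡⟨ cong₂ (λ s t → (sgn t * sgn (y ℕ.+ x) * (1ℤ - s) + sgn d * s * odd (y ℕ.+ x)) * (+ a * + a))
               (sym (trans (cong sgn (expand x y)) (sgn-absorb y x))) (ℕ.+-comm d a) ⟩
        χ′-first² ((a , y ℕ.+ x) , d , y) ∎

    ∑-minus² : ∑ H χ-minus² ≡ + 2 * ∑ X< χ′-first²
    ∑-minus² = begin
      ∑ H χ-minus²                                      ≡⟨ ∑-trisect H fstA sndA χ-minus² ⟩
      ∑ A< χ-minus² + ∑ A> χ-minus² + ∑ A≡ χ-minus²     ≡⟨ cong₂ (λ s t → s + ∑ A> χ-minus² + t) lower (∑-zero A≡ diagonal) ⟩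
      ∑ A> χ-minus² + ∑ A> χ-minus² + 0ℤ                ≡⟨ double (∑ A> χ-minus²) ⟩
      + 2 * ∑ A> χ-minus²                               ≡⟨ cong (+ 2 *_) (trans (∑-cong A> minus²-shear) (∑-shear χ′-first²)) ⟩
      + 2 * ∑ X< χ′-first²                              ∎
      where
      double : ∀ t → t + t + 0ℤ ≡ + 2 * t
      double = solve-∀
      square : ∀ c a b → c * ((a - b) * (a - b)) ≡ c * ((b - a) * (b - a))
      square = solve-∀
      vanish : ∀ c a → c * ((a - a) * (a - a)) ≡ 0ℤ
      vanish = solve-∀
      lower : ∑ A< χ-minus² ≡ ∑ A> χ-minus²
      lower = sym (trans (swap-A χ-minus²) (∑-cong A< λ { z@((a , x) , b , y) _ →
        trans (cong (_* minus² (swap z)) (χ-swap z)) (square (χ z) (+ b) (+ a)) }))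
      diagonal : ∀ z → Convolution n z × fstA z ≡ sndA z → χ-minus² z ≡ 0ℤ
      diagonal z@((a , x) , .a , y) (_ , refl) = vanish (χ z) (+ a)

    ∑-plus² : ∑ H χ-plus² ≡ + 2 * ∑ A> χ′-first² + ∑ X≡ χ-plus²
    ∑-plus² = begin
      ∑ H χ-plus²                                       ≡⟨ ∑-trisect H fstX sndX χ-plus² ⟩
      ∑ X< χ-plus² + ∑ X> χ-plus² + ∑ X≡ χ-plus²        ≡⟨ cong (λ s → ∑ X< χ-plus² + s + ∑ X≡ χ-plus²) upper ⟩
      ∑ X< χ-plus² + ∑ X< χ-plus² + ∑ X≡ χ-plus²        ≡⟨ cong (_+ ∑ X≡ χ-plus²) (double (∑ X< χ-plus²)) ⟩
      + 2 * ∑ X< χ-plus² + ∑ X≡ χ-plus²                 ≡⟨ cong (λ s → + 2 * s + ∑ X≡ χ-plus²)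
                                                             (trans (sym (∑-shear χ-plus²)) (∑-cong A> plus²-shear)) ⟩
      + 2 * ∑ A> χ′-first² + ∑ X≡ χ-plus²               ∎
      where
      double : ∀ t → t + t ≡ + 2 * t
      double = solve-∀
      square : ∀ c a b → c * ((a + b) * (a + b)) ≡ c * ((b + a) * (b + a))
      square = solve-∀
      upper : ∑ X> χ-plus² ≡ ∑ X< χ-plus²
      upper = trans (swap-X χ-plus²) (∑-cong X< λ { z@((a , x) , b , y) _ →
        trans (cong (_* plus² (swap z)) (χ-swap z)) (square (χ z) (+ b) (+ a)) })

    -- Since 4ab = (a + b)² - (a - b)², the shears leave twice the difference of two sums of χ′ a²,
    -- one over a > b and one over x < y. That difference is known up to the diagonals x = y and a =
    -- b, which are all that remains.
    liouville : ∑ H (λ z → χ z * (+ 4 * (+ fstA z * + sndA z))) ≡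
                ∑ X≡ χ-plus² + + 2 * (∑ X≡ χ′-first² - ∑ A≡ χ′-first²)
    liouville = begin
      ∑ H (λ z → χ z * (+ 4 * (+ fstA z * + sndA z)))
        ≡⟨ ∑-cong H (λ { z@((a , x) , b , y) _ → polarise (χ z) (+ a) (+ b) }) ⟩
      ∑ H (λ z → χ-plus² z + - χ-minus² z)
        ≡⟨ trans (∑-+ H χ-plus² (λ z → - χ-minus² z)) (cong (_+_ (∑ H χ-plus²)) (∑-neg H χ-minus²)) ⟩
      ∑ H χ-plus² - ∑ H χ-minus²
        ≡⟨ cong₂ _-_ ∑-plus² ∑-minus² ⟩
      + 2 * ∑ A> χ′-first² + ∑ X≡ χ-plus² - + 2 * ∑ X< χ′-first²
        ≡⟨ combine (∑ A> χ′-first²) (∑ X≡ χ-plus²) (∑ X< χ′-first²) (∑ X> χ′-first²) (∑ A≡ χ′-first²) (∑ X≡ χ′-first²) total ⟩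
      ∑ X≡ χ-plus² + + 2 * (∑ X≡ χ′-first² - ∑ A≡ χ′-first²) ∎
      where
      polarise : ∀ c a b → c * (+ 4 * (a * b)) ≡ c * ((a + b) * (a + b)) + - (c * ((a - b) * (a - b)))
      polarise = solve-∀
      -- The sum of χ′ a² over all quadruples, trisected by a against b and by x against y; the
      -- mirrored shear identifies the part a < b with the part x > y.
      total : ∑ X> χ′-first² + ∑ A> χ′-first² + ∑ A≡ χ′-first² ≡ ∑ X< χ′-first² + ∑ X> χ′-first² + ∑ X≡ χ′-first²
      total = begin
        ∑ X> χ′-first² + ∑ A> χ′-first² + ∑ A≡ χ′-first²
          ≡⟨ cong (λ s → s + ∑ A> χ′-first² + ∑ A≡ χ′-first²) (trans (∑-cong A< χ′-shear′) (∑-shear′ χ′-first²)) ⟨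
        ∑ A< χ′-first² + ∑ A> χ′-first² + ∑ A≡ χ′-first²
          ≡⟨ ∑-trisect H fstA sndA χ′-first² ⟨
        ∑ H χ′-first²
          ≡⟨ ∑-trisect H fstX sndX χ′-first² ⟩
        ∑ X< χ′-first² + ∑ X> χ′-first² + ∑ X≡ χ′-first² ∎
      combine : ∀ g d l u e f → u + g + e ≡ l + u + f → + 2 * g + d - + 2 * l ≡ d + + 2 * (f - e)
      combine g d l u e f eq = trans (cong (λ t → + 2 * t + d - + 2 * l) (trans (isolate g u e) (cong (λ t → t - u - e) eq)))
        (simplify d l u e f)
        where
        isolate : ∀ g u e → g ≡ u + g + e - u - e
        isolate = solve-∀
        simplify : ∀ d l u e f → + 2 * (l + u + f - u - e) + d - + 2 * l ≡ d + + 2 * (f - e)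
        simplify = solve-∀

-- The diagonal terms and Jacobi's four-square series

module FourSquares where

  open import Data.Integer.Base using (_+_; _*_)
  open import Data.Product.Base using (swap)
  open FiniteSums
  open PowerSeries
  open Dilation
  open OverpartitionSeries
  open LiouvilleIdentity
  open ≡-Reasoning

  between : ∀ m → Finite (λ a → a ℕ.< m × 0 ℕ.< a)
  between m = below m ∩ (0 ℕ.<?_)

  ∑-between : ∀ m (w : ℕ → ℤ) → ∑ (between (suc m)) w ≡ ∑ (below m) (w ∘ suc)
  ∑-between m w = sym (∑-bij (below m) (between (suc m)) suc (λ i<m → s≤s i<m , s≤s z≤n)
    (λ _ _ → ℕ.suc-injective) (λ { {zero} (_ , ()) ; {suc i} (s≤s i<m , _) → i , i<m , refl }) (λ _ _ → refl))

  -- Doubled because the closed form of an alternating sum has denominator 2; so are the two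
  -- evaluations after it.
  ∑-sgn : ∀ m → + 2 * ∑ (below m) (λ i → sgn (suc i)) ≡ sgn m - 1ℤ
  ∑-sgn zero    = cong (+ 2 *_) (∑-empty (below 0) λ _ ())
  ∑-sgn (suc m) = begin
    + 2 * ∑ (below (suc m)) (λ i → sgn (suc i))             ≡⟨ cong (+ 2 *_) (∑-below-sucʳ m (λ i → sgn (suc i))) ⟩
    + 2 * (∑ (below m) (λ i → sgn (suc i)) + - sgn m)       ≡⟨ ℤ.*-distribˡ-+ (+ 2) (∑ (below m) (λ i → sgn (suc i))) (- sgn m) ⟩
    + 2 * ∑ (below m) (λ i → sgn (suc i)) + + 2 * - sgn m   ≡⟨ cong (_+ + 2 * - sgn m) (∑-sgn m) ⟩
    sgn m - 1ℤ + + 2 * - sgn m                              ≡⟨ simplify (sgn m) ⟩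
    - sgn m - 1ℤ                                            ∎
    where
    simplify : ∀ s → s - 1ℤ + + 2 * - s ≡ - s - 1ℤ
    simplify = solve-∀

  ∑-sgn-square : ∀ m → + 2 * ∑ (below m) (λ i → sgn (suc i) * (+ suc i * + suc i)) ≡ sgn m * (+ m * + suc m)
  ∑-sgn-square zero    = cong (+ 2 *_) (∑-empty (below 0) λ _ ())
  ∑-sgn-square (suc m) = begin
    + 2 * ∑ (below (suc m)) w                       ≡⟨ cong (+ 2 *_) (∑-below-sucʳ m w) ⟩
    + 2 * (∑ (below m) w + w m)                     ≡⟨ ℤ.*-distribˡ-+ (+ 2) (∑ (below m) w) (w m) ⟩
    + 2 * ∑ (below m) w + + 2 * w m                 ≡⟨ cong (_+ + 2 * w m) (∑-sgn-square m) ⟩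
    sgn m * (+ m * + suc m) + + 2 * w m
      ≡⟨ cong (λ k → sgn m * (+ m * k) + + 2 * (- sgn m * (k * k))) (ℤ.pos-+ 1 m) ⟩
    sgn m * (+ m * (1ℤ + + m)) + + 2 * (- sgn m * ((1ℤ + + m) * (1ℤ + + m)))
      ≡⟨ simplify (sgn m) (+ m) ⟩
    - sgn m * ((1ℤ + + m) * (+ 2 + + m))            ≡⟨ cong₂ (λ k l → - sgn m * (k * l)) (ℤ.pos-+ 1 m) (ℤ.pos-+ 2 m) ⟨
    - sgn m * (+ suc m * + suc (suc m))             ∎
    where
    w : ℕ → ℤ
    w i = sgn (suc i) * (+ suc i * + suc i)
    simplify : ∀ s m → s * (m * (1ℤ + m)) + + 2 * (- s * ((1ℤ + m) * (1ℤ + m))) ≡ - s * ((1ℤ + m) * (+ 2 + m))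
    simplify = solve-∀

  ∑-odd : ∀ m → + 2 * ∑ (below m) (λ i → odd (suc i)) ≡ + 2 * + m + 1ℤ - sgn m
  ∑-odd zero    = cong (+ 2 *_) (∑-empty (below 0) λ _ ())
  ∑-odd (suc m) = begin
    + 2 * ∑ (below (suc m)) (λ i → odd (suc i))             ≡⟨ cong (+ 2 *_) (∑-below-sucʳ m (λ i → odd (suc i))) ⟩
    + 2 * (∑ (below m) (λ i → odd (suc i)) + odd (suc m))   ≡⟨ ℤ.*-distribˡ-+ (+ 2) (∑ (below m) (λ i → odd (suc i))) (odd (suc m)) ⟩
    + 2 * ∑ (below m) (λ i → odd (suc i)) + + 2 * odd (suc m) ≡⟨ cong (_+ + 2 * odd (suc m)) (∑-odd m) ⟩
    + 2 * + m + 1ℤ - sgn m + + 2 * (1ℤ - - sgn m)           ≡⟨ simplify (+ m) (sgn m) ⟩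
    + 2 * (1ℤ + + m) + 1ℤ - - sgn m                         ≡⟨ cong (λ k → + 2 * k + 1ℤ - - sgn m) (ℤ.pos-+ 1 m) ⟨
    + 2 * + suc m + 1ℤ - - sgn m                            ∎
    where
    simplify : ∀ m s → + 2 * m + 1ℤ - s + + 2 * (1ℤ - - s) ≡ + 2 * (1ℤ + m) + 1ℤ - - s
    simplify = solve-∀

  -- Lets the ring solver prove identities that hold only because signs square to 1.
  modulo-square : ∀ s c {l r} → l ≡ r + c * (s * s - 1ℤ) → s * s ≡ 1ℤ → l ≡ r
  modulo-square s c {l} {r} eq s² = trans eq (trans (cong (λ t → r + c * (t - 1ℤ)) s²) (simplify c r))
    where
    simplify : ∀ c r → r + c * (1ℤ - 1ℤ) ≡ r
    simplify = solve-∀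

  signedσ : Series
  signedσ n = ∑ (factorisations n) (λ (a , x) → sgn a * sgn x * + a)

  signedσ-generates : Generates (λ (a , x) → 0 ℕ.< a × 0 ℕ.< x) (λ (a , x) → a ℕ.* x) (λ (a , x) → sgn a * sgn x * + a) signedσ
  signedσ-generates = record { fibre = factorisations ; coefficient = λ _ → refl }

  module _ (n : ℕ) where
    open Liouville n

    -- For x = y the equation is (a + b) x = n: a factorisation m x = n and a splitting m = a + b.
    -- In `∑-A≡` it is the second factor that splits.
    ∑-X≡ : ∀ w → ∑ X≡ w ≡ ∑ (factorisations n) (λ (m , x) → ∑ (between m) (λ a → w ((a , x) , m ℕ.∸ a , x)))
    ∑-X≡ w = trans
      (∑-bij X≡ (dependent (λ (m , _) → between m) (factorisations n)) (λ { ((a , x) , b , _) → (a ℕ.+ b , x) , a })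
        (λ { {(a , x) , b , .x} ((((0<a , 0<x) , 0<b , _) , e) , refl) →
             ((ℕ.<-≤-trans 0<a (ℕ.m≤m+n a b) , 0<x) , trans (ℕ.*-distribʳ-+ x a b) e) , ℕ.m<m+n a 0<b , 0<a })
        (λ { {(a , x) , b , .x} {(a′ , x′) , b′ , .x′} (_ , refl) (_ , refl) eq → injective a b a′ b′ x x′ eq })
        (λ { {(m , x) , a} (((_ , 0<x) , e) , a<m , 0<a) → ((a , x) , m ℕ.∸ a , x) ,
             ((((0<a , 0<x) , ℕ.m<n⇒0<n∸m a<m , 0<x) ,
               trans (sym (ℕ.*-distribʳ-+ x a (m ℕ.∸ a))) (trans (cong (ℕ._* x) (ℕ.m+[n∸m]≡n (ℕ.<⇒≤ a<m))) e)) , refl) ,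
             cong (λ m → (m , x) , a) (ℕ.m+[n∸m]≡n (ℕ.<⇒≤ a<m)) })
        (λ { ((a , x) , b , .x) (_ , refl) → cong (λ b → w ((a , x) , b , x)) (sym (ℕ.m+n∸m≡n a b)) }))
      (∑-dependent (λ (m , _) → between m) (factorisations n) (λ ((m , x) , a) → w ((a , x) , m ℕ.∸ a , x)))
      where
      injective : ∀ a b a′ b′ x x′ → ((a ℕ.+ b , x) , a) ≡ ((a′ ℕ.+ b′ , x′) , a′) →
                  ((a , x) , b , x) ≡ ((a′ , x′) , b′ , x′)
      injective a b a′ b′ x x′ eq with cong proj₂ eq | cong (proj₂ ∘ proj₁) eq
      ... | refl | refl = cong (λ b → (a , x) , b , x) (ℕ.+-cancelˡ-≡ a b b′ (cong (proj₁ ∘ proj₁) eq))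

    ∑-A≡ : ∀ w → ∑ A≡ w ≡ ∑ (factorisations n) (λ (a , k) → ∑ (between k) (λ x → w ((a , x) , a , k ℕ.∸ x)))
    ∑-A≡ w = trans
      (∑-bij A≡ (dependent (λ (_ , k) → between k) (factorisations n)) (λ { ((a , x) , _ , y) → (a , x ℕ.+ y) , x })
        (λ { {(a , x) , .a , y} ((((0<a , 0<x) , _ , 0<y) , e) , refl) →
             ((0<a , ℕ.<-≤-trans 0<x (ℕ.m≤m+n x y)) , trans (ℕ.*-distribˡ-+ a x y) e) , ℕ.m<m+n x 0<y , 0<x })
        (λ { {(a , x) , .a , y} {(a′ , x′) , .a′ , y′} (_ , refl) (_ , refl) eq → injective a a′ x y x′ y′ eq })
        (λ { {(a , k) , x} (((0<a , _) , e) , x<k , 0<x) → ((a , x) , a , k ℕ.∸ x) ,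
             ((((0<a , 0<x) , 0<a , ℕ.m<n⇒0<n∸m x<k) ,
               trans (sym (ℕ.*-distribˡ-+ a x (k ℕ.∸ x))) (trans (cong (a ℕ.*_) (ℕ.m+[n∸m]≡n (ℕ.<⇒≤ x<k))) e)) , refl) ,
             cong (λ k → (a , k) , x) (ℕ.m+[n∸m]≡n (ℕ.<⇒≤ x<k)) })
        (λ { ((a , x) , .a , y) (_ , refl) → cong (λ y → w ((a , x) , a , y)) (sym (ℕ.m+n∸m≡n x y)) }))
      (∑-dependent (λ (_ , k) → between k) (factorisations n) (λ ((a , k) , x) → w ((a , x) , a , k ℕ.∸ x)))
      where
      injective : ∀ a a′ x y x′ y′ → ((a , x ℕ.+ y) , x) ≡ ((a′ , x′ ℕ.+ y′) , x′) →
                  ((a , x) , a , y) ≡ ((a′ , x′) , a′ , y′)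
      injective a a′ x y x′ y′ eq with cong proj₂ eq | cong (proj₁ ∘ proj₁) eq
      ... | refl | refl = cong (λ y → (a , x) , a , y) (ℕ.+-cancelˡ-≡ x y y′ (cong (proj₂ ∘ proj₁) eq))

    -- With b = m - a one has (-1)^b = (-1)^m (-1)^a, so the summand is a combination of (-1)^a and
    -- (-1)^a a², whose sums have closed forms.
    inner-X : ∀ m x → 0 ℕ.< m →
      ∑ (between m) (λ a → χ-plus² ((a , x) , m ℕ.∸ a , x) + + 2 * χ′-first² ((a , x) , m ℕ.∸ a , x)) ≡
      odd x * (sgn m * (+ m * + m) + + m)
    inner-X (suc m) x _ = ℤ.*-cancelˡ-≡ (+ 2) _ _ (begin
      + 2 * ∑ (between (suc m)) _
        ≡⟨ cong (+ 2 *_) (trans (∑-cong (between (suc m)) (λ a (a<m , _) → summand a (suc m ℕ.∸ a) (ℕ.m+[n∸m]≡n (ℕ.<⇒≤ a<m))))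
             (∑-between m _)) ⟩
      + 2 * ∑ (below m) (λ i → k * sgn (suc i) + l * (sgn (suc i) * (+ suc i * + suc i)))
        ≡⟨ cong (+ 2 *_) (trans (∑-+ (below m) _ _) (cong₂ _+_ (∑-* k (below m) _) (∑-* l (below m) _))) ⟩
      + 2 * (k * T₁ + l * T₂)
        ≡⟨ distribute k l T₁ T₂ ⟩
      k * (+ 2 * T₁) + l * (+ 2 * T₂)
        ≡⟨ cong₂ (λ t u → k * t + l * u) (∑-sgn m) (∑-sgn-square m) ⟩
      k * (s - 1ℤ) + l * (s * (+ m * + suc m))
        ≡⟨ cong (λ M → - (1ℤ + - s) * odd x * (M * M) * (s - 1ℤ) + + 2 * - s * odd x * (s * (+ m * M))) (ℤ.pos-+ 1 m) ⟩
      - (1ℤ + - s) * odd x * ((1ℤ + + m) * (1ℤ + + m)) * (s - 1ℤ) + + 2 * - s * odd x * (s * (+ m * (1ℤ + + m)))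
        ≡⟨ modulo-square s (odd x * ((1ℤ + + m) * (1ℤ + + m)) - + 2 * odd x * (+ m * (1ℤ + + m)))
             (identity s (odd x) (+ m)) (sgn² m) ⟩
      + 2 * (odd x * (- s * ((1ℤ + + m) * (1ℤ + + m)) + (1ℤ + + m)))
        ≡⟨ cong (λ M → + 2 * (odd x * (- s * (M * M) + M))) (ℤ.pos-+ 1 m) ⟨
      + 2 * (odd x * (- s * (+ suc m * + suc m) + + suc m)) ∎)
      where
      s k l T₁ T₂ : ℤ
      s  = sgn m
      k  = - (1ℤ + - s) * odd x * (+ suc m * + suc m)
      l  = + 2 * - s * odd x
      T₁ = ∑ (below m) (λ i → sgn (suc i))
      T₂ = ∑ (below m) (λ i → sgn (suc i) * (+ suc i * + suc i))

      distribute : ∀ k l t u → + 2 * (k * t + l * u) ≡ k * (+ 2 * t) + l * (+ 2 * u)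
      distribute = solve-∀

      identity : ∀ s o m →
        - (1ℤ + - s) * o * ((1ℤ + m) * (1ℤ + m)) * (s - 1ℤ) + + 2 * - s * o * (s * (m * (1ℤ + m))) ≡
        + 2 * (o * (- s * ((1ℤ + m) * (1ℤ + m)) + (1ℤ + m)))
          + (o * ((1ℤ + m) * (1ℤ + m)) - + 2 * o * (m * (1ℤ + m))) * (s * s - 1ℤ)
      identity = solve-∀

      expand : ∀ p r o M t a → (p * o + r * p * o) * (M * M) + + 2 * ((r * o) * (a * a)) ≡
               (p * o) * (1ℤ + r) * (M * M) + + 2 * (r * o) * (a * a)
      expand = solve-∀

      summand : ∀ a b → a ℕ.+ b ≡ suc m → χ-plus² ((a , x) , b , x) + + 2 * χ′-first² ((a , x) , b , x) ≡
                k * sgn a + l * (sgn a * (+ a * + a))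
      summand a b eq = begin
        (sgn a * sgn x * odd x + sgn b * sgn x * odd x) * ((+ a + + b) * (+ a + + b))
          + + 2 * ((sgn (a ℕ.+ b) * sgn x * odd (x ℕ.+ x) + sgn b * sgn (x ℕ.+ x) * odd x) * (+ a * + a))
          ≡⟨ cong₂ (λ M t → (sgn a * sgn x * odd x + sgn b * sgn x * odd x) * (M * M)
                      + + 2 * ((sgn (a ℕ.+ b) * sgn x * (1ℤ - t) + sgn b * t * odd x) * (+ a * + a)))
               (trans (sym (ℤ.pos-+ a b)) (cong +_ eq)) (sgn-double x) ⟩
        (sgn a * sgn x * odd x + sgn b * sgn x * odd x) * (M * M)
          + + 2 * ((sgn (a ℕ.+ b) * sgn x * (1ℤ - 1ℤ) + sgn b * 1ℤ * odd x) * (+ a * + a))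
          ≡⟨ cong (λ t → (sgn a * sgn x * odd x + t * sgn x * odd x) * (M * M)
                      + + 2 * ((sgn (a ℕ.+ b) * sgn x * (1ℤ - 1ℤ) + t * 1ℤ * odd x) * (+ a * + a))) sgn-b ⟩
        (sgn a * sgn x * odd x + (- s * sgn a) * sgn x * odd x) * (M * M)
          + + 2 * ((sgn (a ℕ.+ b) * sgn x * (1ℤ - 1ℤ) + (- s * sgn a) * 1ℤ * odd x) * (+ a * + a))
          ≡⟨ modulo-square (sgn x) (- ((sgn a + - s * sgn a) * (M * M)))
               (rearrange (sgn a) (sgn x) s M (sgn (a ℕ.+ b)) (+ a)) (sgn² x) ⟩
        k * sgn a + l * (sgn a * (+ a * + a)) ∎
        where
        M = + suc m
        sgn-b : sgn b ≡ - s * sgn a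
        sgn-b = trans (sym (sgn-cancel b a)) (cong (λ t → sgn t * sgn a) (trans (ℕ.+-comm b a) eq))
        rearrange : ∀ p x s M t a →
          (p * x * (1ℤ - x) + (- s * p) * x * (1ℤ - x)) * (M * M)
            + + 2 * ((t * x * (1ℤ - 1ℤ) + (- s * p) * 1ℤ * (1ℤ - x)) * (a * a)) ≡
          - (1ℤ + - s) * (1ℤ - x) * (M * M) * p + + 2 * - s * (1ℤ - x) * (p * (a * a))
            + (- ((p + - s * p) * (M * M))) * (x * x - 1ℤ)
        rearrange = solve-∀

    inner-A : ∀ a k → 0 ℕ.< k →
      + 2 * ∑ (between k) (λ x → χ′-first² ((a , x) , a , k ℕ.∸ x)) ≡
      + 2 * (sgn a * sgn k * (+ a * + a * + k)) + sgn a * (+ a * + a) * odd k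
    inner-A a (suc k) _ = begin
      + 2 * ∑ (between (suc k)) _
        ≡⟨ cong (+ 2 *_) (trans (∑-cong (between (suc k)) (λ x (x<k , _) → summand x (suc k ℕ.∸ x) (ℕ.m+[n∸m]≡n (ℕ.<⇒≤ x<k))))
             (∑-between k _)) ⟩
      + 2 * ∑ (below k) (λ i → u * sgn (suc i) + v * odd (suc i))
        ≡⟨ cong (+ 2 *_) (trans (∑-+ (below k) _ _) (cong₂ _+_ (∑-* u (below k) _) (∑-* v (below k) _))) ⟩
      + 2 * (u * T₁ + v * T₂)
        ≡⟨ distribute u v T₁ T₂ ⟩
      u * (+ 2 * T₁) + v * (+ 2 * T₂)
        ≡⟨ cong₂ (λ t w → u * t + v * w) (∑-sgn k) (∑-odd k) ⟩
      u * (s - 1ℤ) + v * (+ 2 * + k + 1ℤ - s)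
        ≡⟨ modulo-square s (+ a * + a + sgn a * (+ a * + a)) (identity s (sgn a) (+ a) (+ k)) (sgn² k) ⟩
      + 2 * (sgn a * - s * (+ a * + a * (1ℤ + + k))) + sgn a * (+ a * + a) * (1ℤ - - s)
        ≡⟨ cong (λ K → + 2 * (sgn a * - s * (+ a * + a * K)) + sgn a * (+ a * + a) * (1ℤ - - s)) (ℤ.pos-+ 1 k) ⟨
      + 2 * (sgn a * - s * (+ a * + a * + suc k)) + sgn a * (+ a * + a) * odd (suc k) ∎
      where
      s u v T₁ T₂ : ℤ
      s  = sgn k
      u  = (1ℤ - - s) * (+ a * + a)
      v  = sgn a * - s * (+ a * + a)
      T₁ = ∑ (below k) (λ i → sgn (suc i))
      T₂ = ∑ (below k) (λ i → odd (suc i))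

      distribute : ∀ k l t u → + 2 * (k * t + l * u) ≡ k * (+ 2 * t) + l * (+ 2 * u)
      distribute = solve-∀

      identity : ∀ s p a k →
        (1ℤ - - s) * (a * a) * (s - 1ℤ) + p * - s * (a * a) * (+ 2 * k + 1ℤ - s) ≡
        + 2 * (p * - s * (a * a * (1ℤ + k))) + p * (a * a) * (1ℤ - - s) + (a * a + p * (a * a)) * (s * s - 1ℤ)
      identity = solve-∀

      rearrange : ∀ p q x o a t → (1ℤ * x * o + p * q * t) * (a * a) ≡ o * (a * a) * x + p * q * (a * a) * t
      rearrange = solve-∀

      summand : ∀ x y → x ℕ.+ y ≡ suc k → χ′-first² ((a , x) , a , y) ≡ u * sgn x + v * odd x
      summand x y eq = trans
        (cong₂ (λ t z → (t * sgn x * odd z + sgn a * sgn z * odd x) * (+ a * + a)) (sgn-double a) eq)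
        (rearrange (sgn a) (- s) (sgn x) (odd (suc k)) (+ a) (odd x))

    -- For S = `signedσ` and E = 1 - 8S this is the differential equation θE = -4CE, divided by 4.
    signedσ⊛logDerivative : + 8 * (signedσ ⊛ logDerivative) n ≡ logDerivative n - + 2 * (+ n * signedσ n)
    signedσ⊛logDerivative = begin
      + 8 * (signedσ ⊛ logDerivative) n
        ≡⟨ cong (+ 8 *_) (⊛-generates signedσ-generates logDerivative-generates H) ⟩
      + 8 * ∑ H p
        ≡⟨ split (∑ H p) ⟩
      -- Half of the sum is moved to the swapped quadruples, which turns the weight into the
      -- symmetric `χ` times 4ab.
      + 4 * ∑ H p + + 4 * ∑ H p
        ≡⟨ cong₂ _+_ (sym (∑-* (+ 4) H p)) (trans (cong (+ 4 *_) (∑-inverse H H swap swap swap-Convolution swap-Convolution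
             (λ _ _ → refl) (λ _ _ → refl) (λ _ _ → refl))) (sym (∑-* (+ 4) H (p ∘ swap)))) ⟩
      ∑ H (λ z → + 4 * p z) + ∑ H (λ z → + 4 * p (swap z))
        ≡⟨ trans (sym (∑-+ H _ _)) (∑-cong H λ { ((a , x) , b , y) _ →
             collect (sgn a) (sgn x) (+ a) (+ b) (odd y) (sgn b) (sgn y) (odd x) }) ⟩
      ∑ H (λ z → χ z * (+ 4 * (+ fstA z * + sndA z)))
        ≡⟨ liouville ⟩
      ∑ X≡ χ-plus² + + 2 * (∑ X≡ χ′-first² - ∑ A≡ χ′-first²)
        ≡⟨ regroup (∑ X≡ χ-plus²) (∑ X≡ χ′-first²) (∑ A≡ χ′-first²) ⟩
      (∑ X≡ χ-plus² + + 2 * ∑ X≡ χ′-first²) - + 2 * ∑ A≡ χ′-first²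
        ≡⟨ cong₂ _-_ X-part A-part ⟩
      ∑ F (λ (m , x) → odd x * (sgn m * (+ m * + m) + + m))
        - ∑ F (λ (a , k) → + 2 * (sgn a * sgn k * (+ a * + a * + k)) + sgn a * (+ a * + a) * odd k)
        ≡⟨ trans (cong (_+_ (∑ F _)) (sym (∑-neg F _))) (sym (∑-+ F _ _)) ⟩
      ∑ F (λ (a , x) → odd x * (sgn a * (+ a * + a) + + a)
        + - (+ 2 * (sgn a * sgn x * (+ a * + a * + x)) + sgn a * (+ a * + a) * odd x))
        -- The terms (-1)^a a² `odd x` of the two diagonals cancel, and a x = n turns the remaining
        -- a² x into n a.
        ≡⟨ ∑-cong F (λ { (a , x) (_ , eq) → trans (difference (odd x) (sgn a) (+ a) (sgn x) (+ x))
             (cong (λ t → + a * odd x + - (+ 2 * t) * (sgn a * sgn x * + a)) (trans (sym (ℤ.pos-* a x)) (cong +_ eq))) }) ⟩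
      ∑ F (λ (a , x) → + a * odd x + - (+ 2 * + n) * (sgn a * sgn x * + a))
        ≡⟨ trans (∑-+ F _ _) (cong₂ _+_ (sym (logDerivative-∑ n)) (∑-* (- (+ 2 * + n)) F _)) ⟩
      logDerivative n + - (+ 2 * + n) * signedσ n
        ≡⟨ final (logDerivative n) (+ n) (signedσ n) ⟩
      logDerivative n - + 2 * (+ n * signedσ n) ∎
      where
      F = factorisations n
      p : Quadruple → ℤ
      p ((a , x) , b , y) = sgn a * sgn x * + a * (+ b * odd y)

      split : ∀ t → + 8 * t ≡ + 4 * t + + 4 * t
      split = solve-∀
      collect : ∀ sa sx a b oy sb sy ox → + 4 * (sa * sx * a * (b * oy)) + + 4 * (sb * sy * b * (a * ox)) ≡
                (sa * sx * oy + sb * sy * ox) * (+ 4 * (a * b))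
      collect = solve-∀
      regroup : ∀ d e f → d + + 2 * (e - f) ≡ d + + 2 * e - + 2 * f
      regroup = solve-∀
      difference : ∀ o s a t x → o * (s * (a * a) + a) + - (+ 2 * (s * t * (a * a * x)) + s * (a * a) * o) ≡
                   a * o + - (+ 2 * (a * x)) * (s * t * a)
      difference = solve-∀
      final : ∀ c n g → c + - (+ 2 * n) * g ≡ c - + 2 * (n * g)
      final = solve-∀

      X-part : ∑ X≡ χ-plus² + + 2 * ∑ X≡ χ′-first² ≡ ∑ F (λ (m , x) → odd x * (sgn m * (+ m * + m) + + m))
      X-part = begin
        ∑ X≡ χ-plus² + + 2 * ∑ X≡ χ′-first²
          ≡⟨ trans (cong (_+_ (∑ X≡ χ-plus²)) (sym (∑-* (+ 2) X≡ χ′-first²))) (sym (∑-+ X≡ χ-plus² _)) ⟩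
        ∑ X≡ (λ z → χ-plus² z + + 2 * χ′-first² z)
          ≡⟨ ∑-X≡ (λ z → χ-plus² z + + 2 * χ′-first² z) ⟩
        ∑ F (λ (m , x) → ∑ (between m) (λ a → χ-plus² ((a , x) , m ℕ.∸ a , x) + + 2 * χ′-first² ((a , x) , m ℕ.∸ a , x)))
          ≡⟨ ∑-cong F (λ { (m , x) ((0<m , _) , _) → inner-X m x 0<m }) ⟩
        ∑ F (λ (m , x) → odd x * (sgn m * (+ m * + m) + + m)) ∎

      A-part : + 2 * ∑ A≡ χ′-first² ≡ ∑ F (λ (a , k) → + 2 * (sgn a * sgn k * (+ a * + a * + k)) + sgn a * (+ a * + a) * odd k)
      A-part = begin
        + 2 * ∑ A≡ χ′-first²
          ≡⟨ cong (+ 2 *_) (∑-A≡ χ′-first²) ⟩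
        + 2 * ∑ F (λ (a , k) → ∑ (between k) (λ x → χ′-first² ((a , x) , a , k ℕ.∸ x)))
          ≡⟨ ∑-* (+ 2) F _ ⟨
        ∑ F (λ (a , k) → + 2 * ∑ (between k) (λ x → χ′-first² ((a , x) , a , k ℕ.∸ x)))
          ≡⟨ ∑-cong F (λ { (a , k) ((_ , 0<k) , _) → inner-A a k 0<k }) ⟩
        ∑ F (λ (a , k) → + 2 * (sgn a * sgn k * (+ a * + a * + k)) + sgn a * (+ a * + a) * odd k) ∎

  -- The Eisenstein series of weight 2 that `fourth-unique` identifies with φ⁴.
  eisenstein : Series
  eisenstein = 𝟏 ⊕ const (- + 8) ⊛ signedσ

  signedσ₀ : signedσ 0 ≡ 0ℤ
  signedσ₀ = ∑-empty (factorisations 0) λ { (suc a , suc x) (_ , ()) ; (zero , _) ((() , _) , _) ; (suc a , zero) ((_ , ()) , _) }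

  eisenstein₀ : eisenstein 0 ≡ 1ℤ
  eisenstein₀ = cong (λ t → 1ℤ + - + 8 * t) signedσ₀

  θ-eisenstein : θ eisenstein ≈ ⊖ (const (+ 4) ⊛ logDerivative) ⊛ eisenstein
  θ-eisenstein = coefficientwise λ n → sym (begin
    (⊖ (const (+ 4) ⊛ logDerivative) ⊛ eisenstein) n
      ≡⟨ at (solve 2 (λ c s → (:- (con (+ 4) :* c)) :* (con 1ℤ :+ con (- + 8) :* s) :=
               con (- + 4) :* c :+ con (+ 4) :* (con (+ 8) :* (s :* c))) ≈-refl logDerivative signedσ) n ⟩
    (const (- + 4) ⊛ logDerivative) n + (const (+ 4) ⊛ (const (+ 8) ⊛ (signedσ ⊛ logDerivative))) n
      ≡⟨ cong₂ _+_ (const-⊛ (- + 4) logDerivative n) (trans (const-⊛ (+ 4) (const (+ 8) ⊛ (signedσ ⊛ logDerivative)) n)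
           (cong (+ 4 *_) (trans (const-⊛ (+ 8) (signedσ ⊛ logDerivative) n) (signedσ⊛logDerivative n)))) ⟩
    - + 4 * logDerivative n + + 4 * (logDerivative n - + 2 * (+ n * signedσ n))
      ≡⟨ simplify (logDerivative n) (+ n) (signedσ n) ⟩
    + n * (- + 8 * signedσ n)
      ≡⟨ θ-const n ⟨
    θ eisenstein n ∎)
    where
    open Solver
    simplify : ∀ c n g → - + 4 * c + + 4 * (c - + 2 * (n * g)) ≡ n * (- + 8 * g)
    simplify = solve-∀
    θ-const : ∀ n → θ eisenstein n ≡ + n * (- + 8 * signedσ n)
    θ-const zero    = refl
    θ-const (suc n) = cong (+ suc n *_) (trans (ℤ.+-identityˡ _) (const-⊛ (- + 8) signedσ (suc n)))

-- Indefinite forms as triples, and φ as a sum over integers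

module BinaryForms where

  open import Data.Integer.Base using (_+_; _*_; _<_; _⊖_; ∣_∣)
  open import Data.List.Base using (List; map; _++_; upTo; cartesianProduct)
  open import Data.List.Membership.Propositional using (_∈_)
  open import Data.List.Membership.Propositional.Properties
    using (∈-++⁺ˡ; ∈-++⁺ʳ; ∈-map⁺; ∈-upTo⁺; ∈-cartesianProduct⁺)
  open import Relation.Binary.Definitions using (tri<; tri≈; tri>)
  open import Relation.Nullary.Decidable using (map′)
  open FiniteSums
  open PowerSeries
  open Dilation
  open OverpartitionSeries
  open LiouvilleIdentity
  open FourSquares
  open ≡-Reasoning

  sgnᶻ oddᶻ : ℤ → ℤ
  sgnᶻ i = sgn ∣ i ∣
  oddᶻ i = 1ℤ - sgnᶻ i

  sgnᶻ-neg : ∀ i → sgnᶻ (- i) ≡ sgnᶻ i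
  sgnᶻ-neg i = cong sgn (ℤ.∣-i∣≡∣i∣ i)

  sgn-⊖ : ∀ m n → sgnᶻ (m ⊖ n) ≡ sgn m * sgn n
  sgn-⊖ zero    zero    = refl
  sgn-⊖ zero    (suc n) = sym (ℤ.*-identityˡ (sgn (suc n)))
  sgn-⊖ (suc m) zero    = sym (ℤ.*-identityʳ (sgn (suc m)))
  sgn-⊖ (suc m) (suc n) = trans (cong sgnᶻ (ℤ.[1+m]⊖[1+n]≡m⊖n m n)) (trans (sgn-⊖ m n) (negate (sgn m) (sgn n)))
    where
    negate : ∀ a b → a * b ≡ - a * - b
    negate = solve-∀

  sgnᶻ-+ : ∀ i j → sgnᶻ (i + j) ≡ sgnᶻ i * sgnᶻ j
  sgnᶻ-+ (+ m)    (+ n)    = sgn-+ m n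
  sgnᶻ-+ (+ m)    -[1+ n ] = sgn-⊖ m (suc n)
  sgnᶻ-+ -[1+ m ] (+ n)    = trans (sgn-⊖ n (suc m)) (ℤ.*-comm (sgn n) (sgn (suc m)))
  sgnᶻ-+ -[1+ m ] -[1+ n ] = trans (cong (λ s → - - s) (sgn-+ m n)) (negate (sgn m) (sgn n))
    where
    negate : ∀ a b → - - (a * b) ≡ - a * - b
    negate = solve-∀

  sgnᶻ-minus : ∀ i j → sgnᶻ (i - j) ≡ sgnᶻ i * sgnᶻ j
  sgnᶻ-minus i j = trans (sgnᶻ-+ i (- j)) (cong (sgnᶻ i *_) (sgnᶻ-neg j))

  sgnᶻ² : ∀ i → sgnᶻ i * sgnᶻ i ≡ 1ℤ
  sgnᶻ² i = sgn² ∣ i ∣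

  sgnᶻ-double : ∀ i → sgnᶻ (+ 2 * i) ≡ 1ℤ
  sgnᶻ-double i = trans (cong sgnᶻ (twice i)) (trans (sgnᶻ-+ i i) (sgnᶻ² i))
    where
    twice : ∀ i → + 2 * i ≡ i + i
    twice = solve-∀

  i<j⇒0<j-i : ∀ {i j} → i < j → 0ℤ < j - i
  i<j⇒0<j-i {i} {j} i<j = subst (_< j - i) (ℤ.+-inverseʳ i) (ℤ.+-monoˡ-< (- i) i<j)

  0<j-i⇒i<j : ∀ {i j} → 0ℤ < j - i → i < j
  0<j-i⇒i<j {i} {j} 0<j-i =
    subst (_< j) (ℤ.+-identityˡ i) (subst (0ℤ + i <_) (restore i j) (ℤ.+-monoˡ-< i 0<j-i))
    where
    restore : ∀ i j → j - i + i ≡ j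
    restore = solve-∀

  ∑-trisectᶻ : {A : Set} {P : A → Set} (F : Finite P) (f : A → ℤ) (w : A → ℤ) →
    ∑ F w ≡ ∑ (F ∩ λ x → 0ℤ ℤ.<? f x) w + ∑ (F ∩ λ x → 0ℤ ℤ.<? - f x) w + ∑ (F ∩ λ x → f x ℤ.≟ 0ℤ) w
  ∑-trisectᶻ {P = P} F f w = begin
    ∑ F w
      ≡⟨ ∑-∩ F pos? (F ∩ λ x → ¬? (pos? x)) w ⟩
    ∑ (F ∩ pos?) w + ∑ (F ∩ λ x → ¬? (pos? x)) w
      ≡⟨ cong (_+_ (∑ (F ∩ pos?) w)) (∑-split (F ∩ λ x → ¬? (pos? x)) (F ∩ λ x → 0ℤ ℤ.<? - f x) (F ∩ λ x → f x ℤ.≟ 0ℤ)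
           to (λ (p , f<0) → p , λ 0<f → ℤ.<-asym f<0 (ℤ.neg-mono-< 0<f))
           (λ (p , f≡0) → p , λ 0<f → ℤ.<-irrefl (sym f≡0) 0<f)
           (λ (_ , f<0) (_ , f≡0) → ℤ.<-irrefl (cong -_ (sym f≡0)) f<0) w) ⟩
    ∑ (F ∩ pos?) w + (∑ (F ∩ λ x → 0ℤ ℤ.<? - f x) w + ∑ (F ∩ λ x → f x ℤ.≟ 0ℤ) w)
      ≡⟨ ℤ.+-assoc (∑ (F ∩ pos?) w) _ _ ⟨
    ∑ (F ∩ pos?) w + ∑ (F ∩ λ x → 0ℤ ℤ.<? - f x) w + ∑ (F ∩ λ x → f x ℤ.≟ 0ℤ) w ∎
    where
    pos? = λ x → 0ℤ ℤ.<? f x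
    to : ∀ {x} → P x × ¬ (0ℤ < f x) → (P x × 0ℤ < - f x) ⊎ (P x × f x ≡ 0ℤ)
    to {x} (p , f≯0) with ℤ.<-cmp 0ℤ (f x)
    ... | tri< 0<f _ _ = contradiction 0<f f≯0
    ... | tri≈ _ 0≡f _ = inj₂ (p , sym 0≡f)
    ... | tri> _ _ f<0 = inj₁ (p , ℤ.neg-mono-< f<0)

  integers : ℕ → List ℤ
  integers n = map +_ (upTo (suc n)) ++ map (λ k → - + k) (upTo (suc n))

  ∈-integers : ∀ {n} i → ∣ i ∣ ℕ.≤ n → i ∈ integers n
  ∈-integers {n} (+ m)    m≤n = ∈-++⁺ˡ (∈-map⁺ +_ (∈-upTo⁺ (s≤s m≤n)))
  ∈-integers {n} -[1+ m ] m<n = ∈-++⁺ʳ (map +_ (upTo (suc n))) (∈-map⁺ (λ k → - + k) (∈-upTo⁺ (s≤s m<n)))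

  m≤m*m : ∀ m → m ℕ.≤ m ℕ.* m
  m≤m*m zero    = z≤n
  m≤m*m (suc m) = ℕ.m≤m*n (suc m) (suc m)

  Triple : Set
  Triple = ℤ × ℤ × ℤ

  box : ℕ → List (Triple)
  box n = cartesianProduct (integers n) (cartesianProduct (integers n) (integers n))

  ∈-box : ∀ {n a b c} → ∣ a ∣ ℕ.≤ n → ∣ b ∣ ℕ.≤ n → ∣ c ∣ ℕ.≤ n → (a , b , c) ∈ box n
  ∈-box {n} {a} {b} {c} a≤n b≤n c≤n =
    ∈-cartesianProduct⁺ (∈-integers a a≤n) (∈-cartesianProduct⁺ (∈-integers b b≤n) (∈-integers c c≤n))

  i*i≡+∣i∣² : ∀ i → i * i ≡ + (∣ i ∣ ℕ.* ∣ i ∣)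
  i*i≡+∣i∣² (+ n)    = sym (ℤ.pos-* n n)
  i*i≡+∣i∣² -[1+ n ] = refl

  -- (a , b , c) stands for the indefinite binary quadratic form - a X² + 2 b X Y + c Y²
  -- (κ = 1) or - a X² + b X Y + c Y² (κ = 4).
  record Form (κ : ℕ) (D : ℤ) (z : Triple) : Set where
    constructor form
    a = proj₁ z
    b = proj₁ (proj₂ z)
    c = proj₂ (proj₂ z)
    field
      positive     : 0ℤ < a × 0ℤ < c
      discriminant : b * b + + κ * (a * c) ≡ D

  -- Since a and c are positive, b² and κ a c are nonnegative summands of D. This bounds all three
  -- coefficients and makes the set of forms finite.
  form-bound : ∀ k D ((a , b , c) : Triple) → Form (suc k) D (a , b , c) → ∣ a ∣ ℕ.≤ ∣ D ∣ × ∣ b ∣ ℕ.≤ ∣ D ∣ × ∣ c ∣ ℕ.≤ ∣ D ∣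
  form-bound k D (+ suc a , b , + suc c) (form _ eq) =
      ℕ.≤-trans (ℕ.≤-trans (ℕ.m≤m*n (suc a) (suc c)) (ℕ.m≤n*m (suc a ℕ.* suc c) (suc k))) ac≤
    , ℕ.≤-trans (m≤m*m ∣ b ∣) (ℕ.≤-trans (ℕ.m≤m+n (∣ b ∣ ℕ.* ∣ b ∣) _) (ℕ.≤-reflexive D≡))
    , ℕ.≤-trans (ℕ.≤-trans (ℕ.m≤n*m (suc c) (suc a)) (ℕ.m≤n*m (suc a ℕ.* suc c) (suc k))) ac≤
    where
    D≡ : ∣ b ∣ ℕ.* ∣ b ∣ ℕ.+ suc k ℕ.* (suc a ℕ.* suc c) ≡ ∣ D ∣
    D≡ = cong ∣_∣ (begin
      + (∣ b ∣ ℕ.* ∣ b ∣ ℕ.+ suc k ℕ.* (suc a ℕ.* suc c))     ≡⟨ ℤ.pos-+ (∣ b ∣ ℕ.* ∣ b ∣) _ ⟩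
      + (∣ b ∣ ℕ.* ∣ b ∣) + + (suc k ℕ.* (suc a ℕ.* suc c))   ≡⟨ cong₂ _+_ (sym (i*i≡+∣i∣² b)) (trans (ℤ.pos-* (suc k) _)
                                                                  (cong (+ suc k *_) (ℤ.pos-* (suc a) (suc c)))) ⟩
      b * b + + suc k * (+ suc a * + suc c)                   ≡⟨ eq ⟩
      D                                                       ∎)
    ac≤ : suc k ℕ.* (suc a ℕ.* suc c) ℕ.≤ ∣ D ∣
    ac≤ = ℕ.≤-trans (ℕ.m≤n+m _ (∣ b ∣ ℕ.* ∣ b ∣)) (ℕ.≤-reflexive D≡)
  form-bound k D (+ zero , _)              (form (+<+ () , _) _)
  form-bound k D (-[1+ _ ] , _)            (form (() , _) _)
  form-bound k D (+ suc _ , _ , + zero)    (form (_ , +<+ ()) _)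
  form-bound k D (+ suc _ , _ , -[1+ _ ])  (form (_ , ()) _)

  forms : ∀ k D → Finite (Form (suc k) D)
  forms k D = cover (≡-dec ℤ._≟_ (≡-dec ℤ._≟_ ℤ._≟_))
    (λ (a , b , c) → map′ (λ (p , e) → form p e) (λ (form p e) → p , e)
      (((0ℤ ℤ.<? a) ×-dec (0ℤ ℤ.<? c)) ×-dec (b * b + + suc k * (a * c) ℤ.≟ D)))
    (box ∣ D ∣)
    λ {z} f → let a≤ , b≤ , c≤ = form-bound k D z f in ∈-box a≤ b≤ c≤

  flip-middle : ∀ {k D} {a b c} → Form k D (a , b , c) → Form k D (a , - b , c)
  flip-middle {k} {D} {a} {b} {c} (form p eq) = form p (trans (square b (+ k * (a * c))) eq)
    where
    square : ∀ b t → - b * - b + t ≡ b * b + t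
    square = solve-∀

  -- The involution b ↦ -b reverses the weight; the forms with b = 0 have weight 0.
  ∑-odd-middle : ∀ k D (w : Triple → ℤ) → (∀ a b c → w (a , - b , c) ≡ - w (a , b , c)) → ∑ (forms k D) w ≡ 0ℤ
  ∑-odd-middle k D w w-odd = ∑-cancel (forms k D) (λ (a , b , c) → a , - b , c) flip-middle
    (λ (a , b , c) _ → cong (λ b → a , b , c) (ℤ.neg-involutive b))
    (λ (a , b , c) _ → sym (trans (cong -_ (w-odd a b c)) (ℤ.neg-involutive _)))

  rootsOf : ∀ n → Finite (λ s → ⊤ × ∣ s ∣ ℕ.* ∣ s ∣ ≡ n)
  rootsOf n = cover ℤ._≟_ (λ s → yes tt ×-dec (∣ s ∣ ℕ.* ∣ s ∣ ℕ.≟ n)) (integers n)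
    λ { {s} (_ , refl) → ∈-integers s (m≤m*m ∣ s ∣) }

  φ : Series
  φ n = ∑ (rootsOf n) sgnᶻ

  φ-generates : Generates (λ _ → ⊤) (λ s → ∣ s ∣ ℕ.* ∣ s ∣) sgnᶻ φ
  φ-generates = record { fibre = rootsOf ; coefficient = λ _ → refl }

  -- A solution of s² + ax = n with a, x > 0 is the triple (a, s, x) with κ = 1, so products of φ
  -- with divisor sums become sums over forms and admit changes of basis.
  φ⊛-∑ : ∀ {v : ℕ × ℕ → ℤ} {f} → Generates (λ (a , x) → 0 ℕ.< a × 0 ℕ.< x) (λ (a , x) → a ℕ.* x) v f →
         ∀ n (w : Triple → ℤ) → (∀ s a x → sgnᶻ s * v (a , x) ≡ w (+ a , s , + x)) →
         (φ ⊛ f) n ≡ ∑ (forms 0 (+ n)) w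
  φ⊛-∑ {v} {f} gen n w v≡w = trans (⊛-generates φ-generates gen H) (sym (∑-inverse (forms 0 (+ n)) H to′ from′
    (λ { {+ suc a , s , + suc x} (form _ eq) → (tt , s≤s z≤n , s≤s z≤n) , ℤ.+-injective (trans (cast s (suc a) (suc x)) eq)
       ; {+ zero , _} (form (+<+ () , _) _) ; { -[1+ _ ] , _} (form (() , _) _)
       ; {+ suc _ , _ , + zero} (form (_ , +<+ ()) _) ; {+ suc _ , _ , -[1+ _ ]} (form (_ , ()) _) })
    (λ { {s , a , x} ((_ , 0<a , 0<x) , eq) → form (+<+ 0<a , +<+ 0<x) (trans (sym (cast s a x)) (cong +_ eq)) })
    (λ { (+ a , s , + x) _ → refl ; (-[1+ _ ] , _) (form (() , _) _) ; (+ _ , _ , -[1+ _ ]) (form (_ , ()) _) })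
    (λ _ _ → refl)
    (λ { (+ a , s , + x) _ → sym (v≡w s a x) ; (-[1+ _ ] , _) (form (() , _) _) ; (+ _ , _ , -[1+ _ ]) (form (_ , ()) _) })))
    where
    to′ : Triple → ℤ × ℕ × ℕ
    to′ (a , s , x) = s , ∣ a ∣ , ∣ x ∣
    from′ : ℤ × ℕ × ℕ → Triple
    from′ (s , a , x) = + a , s , + x

    cast : ∀ s a x → + (∣ s ∣ ℕ.* ∣ s ∣ ℕ.+ a ℕ.* x) ≡ s * s + + 1 * (+ a * + x)
    cast s a x = trans (ℤ.pos-+ (∣ s ∣ ℕ.* ∣ s ∣) (a ℕ.* x)) (cong₂ _+_ (sym (i*i≡+∣i∣² s))
      (trans (ℤ.pos-* a x) (sym (ℤ.*-identityˡ (+ a * + x)))))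

    H : Finite (λ (s , a , x) → (⊤ × 0 ℕ.< a × 0 ℕ.< x) × ∣ s ∣ ℕ.* ∣ s ∣ ℕ.+ a ℕ.* x ≡ n)
    H = image to′
      (λ { {+ suc a , s , + suc x} (form _ eq) → (tt , s≤s z≤n , s≤s z≤n) , ℤ.+-injective (trans (cast s (suc a) (suc x)) eq)
         ; {+ zero , _} (form (+<+ () , _) _) ; { -[1+ _ ] , _} (form (() , _) _)
         ; {+ suc _ , _ , + zero} (form (_ , +<+ ()) _) ; {+ suc _ , _ , -[1+ _ ]} (form (_ , ()) _) })
      (λ { {+ a , _ , + x} {+ b , _ , + y} _ _ refl → refl
         ; { -[1+ _ ] , _} (form (() , _) _) ; {+ _ , _ , -[1+ _ ]} (form (_ , ()) _)
         ; {+ _ , _ , + _} { -[1+ _ ] , _} _ (form (() , _) _) ; {+ _ , _ , + _} {+ _ , _ , -[1+ _ ]} _ (form (_ , ()) _) })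
      (λ { {s , a , x} ((_ , 0<a , 0<x) , eq) → from′ (s , a , x) ,
           form (+<+ 0<a , +<+ 0<x) (trans (sym (cast s a x)) (cong +_ eq)) , refl })
      (forms 0 (+ n))

-- The 3-dissection and the differential equation of φ

module ThetaSeries where

  open import Data.Integer.Base using (_+_; _*_; _<_; ∣_∣)
  open import Data.Nat.DivMod using (_%_; m%n<n; %-distribˡ-*; [m+kn]%n≡m%n)
  open import Data.Nat.Divisibility using (_∣_; divides)
  open import Data.Nat.Primality using (euclidsLemma)
  open FiniteSums
  open PowerSeries
  open Dilation
  open OverpartitionSeries
  open HeckeAtThree
  open LiouvilleIdentity
  open FourSquares
  open BinaryForms
  open ≡-Reasoning

  φ₀ : φ 0 ≡ 1ℤ
  φ₀ = ∑-singleton (rootsOf 0) {0ℤ} (tt , refl) (λ { (+ zero) _ → refl ; (+ suc _) (_ , ()) ; -[1+ _ ] (_ , ()) }) sgnᶻ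

  square≢2 : ∀ m j → m ℕ.* m ≢ 2 ℕ.+ j ℕ.* 3
  square≢2 m j eq = residue (m % 3) (m%n<n m 3)
    (trans (sym (%-distribˡ-* m m 3)) (trans (cong (_% 3) eq) ([m+kn]%n≡m%n 2 j 3)))
    where
    residue : ∀ r → r ℕ.< 3 → r ℕ.* r % 3 ≢ 2
    residue 0 _ ()
    residue 1 _ ()
    residue 2 _ ()
    residue (suc (suc (suc r))) (s≤s (s≤s (s≤s ())))

  3∣⇒*3 : ∀ t → 3 ∣ ∣ t ∣ → ∃ λ s → s * + 3 ≡ t
  3∣⇒*3 (+ n)    (divides m eq) = + m , trans (sym (ℤ.pos-* m 3)) (cong +_ (sym eq))
  3∣⇒*3 -[1+ n ] (divides m eq) = - + m , trans (sym (ℤ.neg-distribˡ-* (+ m) (+ 3)))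
    (cong -_ (trans (sym (ℤ.pos-* m 3)) (cong +_ (sym eq))))

  -- A square divisible by 3 is (3s)² = 9s², and tripling s keeps the sign (-1)^s.
  φ-section₀ : section 0 φ ≈ V φ
  φ-section₀ = coefficientwise λ j → trans (section-at 0 φ j) (sym (begin
    V φ j                                                          ≡⟨ dilate-∑ 2 φ (multiples 2 j) ⟩
    ∑ (multiples 2 j) φ                                            ≡⟨ ∑-dependent rootsOf (multiples 2 j) _ ⟨
    ∑ (dependent rootsOf (multiples 2 j)) (λ (_ , s) → sgnᶻ s)
      ≡⟨ ∑-bij (dependent rootsOf (multiples 2 j)) (rootsOf (j ℕ.* 3)) (λ (_ , s) → s * + 3)
           (λ { {_ , s} (refl , _ , refl) → tt , triple ∣ s ∣ (∣ s * + 3 ∣) (ℤ.abs-* s (+ 3)) })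
           (λ { {_ , s} {_ , t} (_ , _ , refl) (_ , _ , refl) eq →
                cong (λ s → ∣ s ∣ ℕ.* ∣ s ∣ , s) (ℤ.*-cancelʳ-≡ s t (+ 3) eq) })
           (λ {t} → surj {j} {t})
           (λ (_ , s) _ → sym (trans (cong sgn (ℤ.abs-* s (+ 3))) (sgn-*3 ∣ s ∣))) ⟩
    ∑ (rootsOf (j ℕ.* 3)) sgnᶻ ∎))
    where
    regroup : ∀ m → m ℕ.* 3 ℕ.* (m ℕ.* 3) ≡ m ℕ.* m ℕ.* 3 ℕ.* 3
    regroup = ℕ-Solver.solve-∀

    triple : ∀ m n → n ≡ m ℕ.* 3 → n ℕ.* n ≡ m ℕ.* m ℕ.* 3 ℕ.* 3
    triple m n refl = regroup m

    surj : ∀ {j t} → ⊤ × ∣ t ∣ ℕ.* ∣ t ∣ ≡ j ℕ.* 3 →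
           ∃ λ is → (proj₁ is ℕ.* 3 ≡ j × ⊤ × ∣ proj₂ is ∣ ℕ.* ∣ proj₂ is ∣ ≡ proj₁ is) × proj₂ is * + 3 ≡ t
    surj {j} {t} (_ , eq) with s , refl ← 3∣⇒*3 t (reduce (euclidsLemma ∣ t ∣ ∣ t ∣ prime-3 (divides j eq))) =
      (∣ s ∣ ℕ.* ∣ s ∣ , s) , (ℕ.*-cancelʳ-≡ _ _ 3 (trans (sym (triple ∣ s ∣ (∣ s * + 3 ∣) (ℤ.abs-* s (+ 3)))) eq) , tt , refl) , refl

  φ-dissection : φ ≈ dilate 2 0 (V φ) ⊕ dilate 2 1 (section 1 φ)
  φ-dissection = coefficientwise λ n → trans (at (decompose φ) n)
    (trans (cong₂ (λ x y → x + dilate 2 1 (section 1 φ) n + y) (dilate-cong′ 2 0 (at φ-section₀) n)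
      (trans (dilate-cong′ 2 2 section₂ n) (dilate-𝟎 2 2 n)))
      (ℤ.+-identityʳ _))
    where
    section₂ : ∀ j → section 2 φ j ≡ 𝟎 j
    section₂ j = trans (section-at 2 φ j) (∑-empty (rootsOf (2 ℕ.+ j ℕ.* 3)) λ s (_ , eq) → square≢2 ∣ s ∣ j eq)

  module _ (n : ℕ) where

    private
      F = forms 0 (+ n)

      -- Values of the form -aX² + 2sXY + xY²: `a′` is minus its value at (1, 1), and `x′` is its
      -- value at (-1, 1).
      a′ x′ : Triple → ℤ
      a′ (a , s , x) = a - + 2 * s - x
      x′ (a , t , b) = b - + 2 * t - a

      F⁺ = F ∩ λ z → 0ℤ ℤ.<? a′ z
      F⁻ = F ∩ λ z → 0ℤ ℤ.<? - a′ z
      F⁰ = F ∩ λ z → a′ z ℤ.≟ 0ℤ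

      -- a - s is invariant under the involution τ, whereas (-1)^s changes sign.
      w v : Triple → ℤ
      w (a , s , x) = sgnᶻ s * oddᶻ x * (a - s)
      v (a , t , b) = - (sgnᶻ t * sgnᶻ a * oddᶻ (a + b)) * t

      -- The substitution (X, Y) ↦ (X, X - Y), an involution of determinant -1 that keeps x and
      -- exchanges a with `a′`.
      τ : Triple → Triple
      τ (a , s , x) = a - + 2 * s - x , - s - x , x

      disc-τ : ∀ a s x → (- s - x) * (- s - x) + + 1 * ((a - + 2 * s - x) * x) ≡ s * s + + 1 * (a * x)
      disc-τ = solve-∀

      a′-τ : ∀ a s x → a ≡ (a - + 2 * s - x) - + 2 * (- s - x) - x
      a′-τ = solve-∀

      ∑F⁺ : ∑ F⁺ w ≡ 0ℤ
      ∑F⁺ = ∑-cancel F⁺ τ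
        (λ { {a , s , x} (form (0<a , 0<x) eq , 0<a′) →
             form (0<a′ , 0<x) (trans (disc-τ a s x) eq) , subst (0ℤ <_) (a′-τ a s x) 0<a })
        (λ { (a , s , x) _ → cong₂ (λ a s → a , s , x) (sym (a′-τ a s x)) (involutive s x) })
        (λ { (a , s , x) _ → sym (trans
             (cong (λ t → - (t * oddᶻ x * (a - + 2 * s - x - (- s - x))))
               (trans (sgnᶻ-minus (- s) x) (cong (_* sgnᶻ x) (sgnᶻ-neg s))))
             (modulo-square (sgnᶻ x) (sgnᶻ s * (a - s)) (weights (sgnᶻ s) (sgnᶻ x) a s x) (sgnᶻ² x))) })
        where
        involutive : ∀ s x → - (- s - x) - x ≡ s
        involutive = solve-∀
        weights : ∀ p q a s x → - (p * q * (1ℤ - q) * (a - + 2 * s - x - (- s - x))) ≡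
                  p * (1ℤ - q) * (a - s) + p * (a - s) * (q * q - 1ℤ)
        weights = solve-∀

      W⁺ = F ∩ λ z → 0ℤ ℤ.<? x′ z
      W⁻ = F ∩ λ z → 0ℤ ℤ.<? - x′ z
      W⁰ = F ∩ λ z → x′ z ℤ.≟ 0ℤ

      sgn-x′ : ∀ a t b → sgnᶻ (b - + 2 * t - a) ≡ sgnᶻ (a + b)
      sgn-x′ a t b = begin
        sgnᶻ (b - + 2 * t - a)                 ≡⟨ sgnᶻ-minus (b - + 2 * t) a ⟩
        sgnᶻ (b - + 2 * t) * sgnᶻ a            ≡⟨ cong (_* sgnᶻ a) (sgnᶻ-minus b (+ 2 * t)) ⟩
        sgnᶻ b * sgnᶻ (+ 2 * t) * sgnᶻ a       ≡⟨ cong (λ s → sgnᶻ b * s * sgnᶻ a) (sgnᶻ-double t) ⟩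
        sgnᶻ b * 1ℤ * sgnᶻ a                   ≡⟨ commute (sgnᶻ b) (sgnᶻ a) ⟩
        sgnᶻ a * sgnᶻ b                        ≡⟨ sgnᶻ-+ a b ⟨
        sgnᶻ (a + b)                           ∎
        where
        commute : ∀ p q → p * 1ℤ * q ≡ q * p
        commute = solve-∀

      -- On `F⁻` the form is positive at (1, 1) too. In the basis (1, 0), (1, 1) it is the triple
      -- (a, s - a, -`a′`), and its value x at (0, 1) reappears as `x′`; `v` is `w` in these
      -- coordinates.
      ∑W⁺ : ∑ W⁺ v ≡ ∑ F⁻ w
      ∑W⁺ = ∑-inverse W⁺ F⁻ (λ (a , t , b) → a , t + a , b - + 2 * t - a) (λ (a , s , x) → a , s - a , - (a - + 2 * s - x))
        (λ { {a , t , b} (form (0<a , 0<b) eq , 0<x) →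
             form (0<a , 0<x) (trans (disc a t b) eq) , subst (0ℤ <_) (b≡ a t b) 0<b })
        (λ { {a , s , x} (form (0<a , 0<x) eq , 0<b) →
             form (0<a , 0<b) (trans (disc′ a s x) eq) , subst (0ℤ <_) (x≡ a s x) 0<x })
        (λ { (a , t , b) _ → cong₂ (λ t b → a , t , b) (cancel t a) (sym (b≡ a t b)) })
        (λ { (a , s , x) _ → cong₂ (λ s x → a , s , x) (cancel′ s a) (sym (x≡ a s x)) })
        (λ { (a , t , b) _ → sym (trans
             (cong₂ (λ p q → p * (1ℤ - q) * (a - (t + a))) (sgnᶻ-+ t a) (sgn-x′ a t b))
             (weights (sgnᶻ t) (sgnᶻ a) (oddᶻ (a + b)) a t)) })
        where
        disc : ∀ a t b → (t + a) * (t + a) + + 1 * (a * (b - + 2 * t - a)) ≡ t * t + + 1 * (a * b)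
        disc = solve-∀
        disc′ : ∀ a s x → (s - a) * (s - a) + + 1 * (a * - (a - + 2 * s - x)) ≡ s * s + + 1 * (a * x)
        disc′ = solve-∀
        b≡ : ∀ a t b → b ≡ - (a - + 2 * (t + a) - (b - + 2 * t - a))
        b≡ = solve-∀
        x≡ : ∀ a s x → x ≡ - (a - + 2 * s - x) - + 2 * (s - a) - a
        x≡ = solve-∀
        cancel : ∀ t a → t + a - a ≡ t
        cancel = solve-∀
        cancel′ : ∀ s a → s - a + a ≡ s
        cancel′ = solve-∀
        weights : ∀ p q o a t → p * q * o * (a - (t + a)) ≡ - (p * q * o) * t
        weights = solve-∀

      -- The previous bijection composed with (a, t, b) ↦ (b, -t, a). This map negates `x′` and
      -- preserves `v`, since a and b have opposite parity wherever `oddᶻ (a + b)` is nonzero.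
      ∑W⁻ : ∑ W⁻ v ≡ ∑ F⁻ w
      ∑W⁻ = ∑-inverse W⁻ F⁻ (λ (a , t , b) → b , b - t , - (b - + 2 * t - a)) (λ (a , s , x) → - (a - + 2 * s - x) , a - s , a)
        (λ { {a , t , b} (form (0<a , 0<b) eq , 0<x) →
             form (0<b , 0<x) (trans (disc a t b) eq) , subst (0ℤ <_) (a≡ a t b) 0<a })
        (λ { {a , s , x} (form (0<a , 0<x) eq , 0<b) →
             form (0<b , 0<a) (trans (disc′ a s x) eq) , subst (0ℤ <_) (x≡ a s x) 0<x })
        (λ { (a , t , b) _ → cong₂ (λ a t → a , t , b) (sym (a≡ a t b)) (cancel b t) })
        (λ { (a , s , x) _ → cong₂ (λ s x → a , s , x) (cancel a s) (sym (x≡ a s x)) })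
        (λ { (a , t , b) _ → sym (trans
             (cong₂ (λ p q → p * (1ℤ - q) * (b - (b - t))) (sgnᶻ-minus b t)
               (trans (sgnᶻ-neg (b - + 2 * t - a)) (trans (sgn-x′ a t b) (sgnᶻ-+ a b))))
             (trans (modulo-square (sgnᶻ a) (- (sgnᶻ t * sgnᶻ b * t)) (trans (modulo-square (sgnᶻ b) (- (sgnᶻ t * sgnᶻ a * t))
               (weights (sgnᶻ t) (sgnᶻ a) (sgnᶻ b) b t) (sgnᶻ² b)) refl) (sgnᶻ² a))
               (cong (λ s → - (sgnᶻ t * sgnᶻ a * (1ℤ - s)) * t) (sym (sgnᶻ-+ a b))))) })
        where
        disc : ∀ a t b → (b - t) * (b - t) + + 1 * (b * - (b - + 2 * t - a)) ≡ t * t + + 1 * (a * b)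
        disc = solve-∀
        disc′ : ∀ a s x → (a - s) * (a - s) + + 1 * (- (a - + 2 * s - x) * a) ≡ s * s + + 1 * (a * x)
        disc′ = solve-∀
        a≡ : ∀ a t b → a ≡ - (b - + 2 * (b - t) - - (b - + 2 * t - a))
        a≡ = solve-∀
        x≡ : ∀ a s x → x ≡ - (a - + 2 * (a - s) - - (a - + 2 * s - x))
        x≡ = solve-∀
        cancel : ∀ b t → b - (b - t) ≡ t
        cancel = solve-∀
        weights : ∀ p q r b t → r * p * (1ℤ - q * r) * (b - (b - t)) ≡
                  - (p * q * (1ℤ - q * r)) * t + - (p * r * t) * (q * q - 1ℤ) + - (p * q * t) * (r * r - 1ℤ)
        weights = solve-∀

      -- The weight `v` is odd in t, so its sum over all triples is 0. The parts with `x′` > 0 and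
      -- `x′` < 0 both equal the sum over `F⁻`, and `x′` = 0 forces a + b to be even, where `v` is
      -- 0. So twice the sum vanishes.
      ∑F⁻ : ∑ F⁻ w ≡ 0ℤ
      ∑F⁻ = i≡-i⇒i≡0 (begin
        ∑ F⁻ w                            ≡⟨ isolate (∑ F⁻ w) ⟩
        ∑ F⁻ w + ∑ F⁻ w + 0ℤ - ∑ F⁻ w     ≡⟨ cong (_- ∑ F⁻ w) (begin
          ∑ F⁻ w + ∑ F⁻ w + 0ℤ
            ≡⟨ cong₂ _+_ (cong₂ _+_ ∑W⁺ ∑W⁻) (∑-zero W⁰ λ { (a , t , b) (_ , x≡0) → vanish a t b x≡0 }) ⟨
          ∑ W⁺ v + ∑ W⁻ v + ∑ W⁰ v        ≡⟨ ∑-trisectᶻ F x′ v ⟨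
          ∑ F v                           ≡⟨ ∑-odd-middle 0 (+ n) v (λ a t b → trans
            (cong (λ s → - (s * sgnᶻ a * oddᶻ (a + b)) * - t) (sgnᶻ-neg t))
            (sym (ℤ.neg-distribʳ-* (- (sgnᶻ t * sgnᶻ a * oddᶻ (a + b))) t))) ⟩
          0ℤ ∎) ⟩
        0ℤ - ∑ F⁻ w                       ≡⟨ ℤ.+-identityˡ _ ⟩
        - ∑ F⁻ w                          ∎)
        where
        isolate : ∀ t → t ≡ t + t + 0ℤ - t
        isolate = solve-∀
        kill : ∀ p q t → - (p * q * (1ℤ - 1ℤ)) * t ≡ 0ℤ
        kill = solve-∀
        vanish : ∀ a t b → b - + 2 * t - a ≡ 0ℤ → v (a , t , b) ≡ 0ℤ
        vanish a t b x≡0 = trans (cong (λ s → - (sgnᶻ t * sgnᶻ a * (1ℤ - s)) * t)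
          (trans (sym (sgn-x′ a t b)) (cong sgnᶻ x≡0))) (kill (sgnᶻ t) (sgnᶻ a) t)

      Root : ℕ → Set
      Root r = 0 ℕ.< r × r ℕ.* r ≡ n

      positiveRoots : Finite Root
      positiveRoots = relabel (λ ((_ , eq) , 0<r) → 0<r , eq) (λ (0<r , eq) → (bound 0<r eq , eq) , 0<r)
        ((below (suc n) ∩ λ r → r ℕ.* r ℕ.≟ n) ∩ (0 ℕ.<?_))
        where
        bound : ∀ {r} → 0 ℕ.< r → r ℕ.* r ≡ n → r ℕ.< suc n
        bound {r} 0<r refl = s≤s (ℕ.m≤m*n r r {{ℕ.>-nonZero 0<r}})

      -- For a = 2s + x the equation reads (s + x)² = n, so this boundary is seen only at squares.
      -- For each root r = s + x > 0 there are r odd values 0 < x < 2r, and each contributes -2r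
      -- (-1)^r.
      ∑F⁰ : ∑ F⁰ w ≡ ∑ positiveRoots (λ r → - (+ 2 * + n * sgn r))
      ∑F⁰ = begin
        ∑ F⁰ w
          ≡⟨ ∑-bij D F⁰ (λ (r , x) → + 2 * + r - + x , + r - + x , + x)
               (λ { {r , x} ((0<r , refl) , x<2r , 0<x) →
                    form (subst (0ℤ <_) (cong (_- + x) (ℤ.pos-* 2 r)) (i<j⇒0<j-i (+<+ x<2r)) , +<+ 0<x)
                         (trans (disc (+ r) (+ x)) (sym (ℤ.pos-* r r))) , degenerate (+ r) (+ x) })
               (λ { {r , x} {r₁ , x₁} _ _ eq → cong₂ _,_ (ℤ.+-injective (begin
                      + r                     ≡⟨ rebuild (+ r) (+ x) ⟩
                      + r - + x + + x         ≡⟨ cong₂ _+_ (cong (proj₁ ∘ proj₂) eq) (cong (proj₂ ∘ proj₂) eq) ⟩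
                      + r₁ - + x₁ + + x₁      ≡⟨ rebuild (+ r₁) (+ x₁) ⟨
                      + r₁                    ∎))
                    (ℤ.+-injective (cong (proj₂ ∘ proj₂) eq)) })
               (λ {z} → surj {z})
               (λ _ _ → refl) ⟨
        ∑ D (λ (r , x) → w (+ 2 * + r - + x , + r - + x , + x))
          ≡⟨ ∑-cong D (λ { (r , x) _ → trans
               (cong (λ s → s * odd x * (+ 2 * + r - + x - (+ r - + x))) (sgnᶻ-minus (+ r) (+ x)))
               (modulo-square (sgn x) (- (sgn r * + r)) (weights (sgn r) (sgn x) (+ r) (+ x)) (sgn² x)) }) ⟩
        ∑ D (λ (r , x) → - (sgn r * + r) * odd x)
          ≡⟨ ∑-dependent (λ r → between (2 ℕ.* r)) positiveRoots _ ⟩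
        ∑ positiveRoots (λ r → ∑ (between (2 ℕ.* r)) (λ x → - (sgn r * + r) * odd x))
          ≡⟨ ∑-cong positiveRoots (λ { r (0<r , refl) → trans (∑-* (- (sgn r * + r)) (between (2 ℕ.* r)) odd)
               (trans (cong (- (sgn r * + r) *_) (odd-count r 0<r))
                 (trans (arrange (sgn r) (+ r)) (cong (λ m → - (+ 2 * m * sgn r)) (sym (ℤ.pos-* r r))))) }) ⟩
        ∑ positiveRoots (λ r → - (+ 2 * + n * sgn r)) ∎
        where
        D : Finite (λ (r , x) → Root r × x ℕ.< 2 ℕ.* r × 0 ℕ.< x)
        D = dependent (λ r → between (2 ℕ.* r)) positiveRoots

        disc : ∀ r x → (r - x) * (r - x) + + 1 * ((+ 2 * r - x) * x) ≡ r * r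
        disc = solve-∀
        degenerate : ∀ r x → + 2 * r - x - + 2 * (r - x) - x ≡ 0ℤ
        degenerate = solve-∀
        rebuild : ∀ r x → r ≡ r - x + x
        rebuild = solve-∀
        weights : ∀ p q r x → p * q * (1ℤ - q) * (+ 2 * r - x - (r - x)) ≡ - (p * r) * (1ℤ - q) + - (p * r) * (q * q - 1ℤ)
        weights = solve-∀
        arrange : ∀ p r → - (p * r) * (+ 2 * r) ≡ - (+ 2 * (r * r) * p)
        arrange = solve-∀

        odd-count : ∀ r → 0 ℕ.< r → ∑ (between (2 ℕ.* r)) odd ≡ + 2 * + r
        odd-count (suc r) _ = ℤ.*-cancelˡ-≡ (+ 2) _ _ (begin
          + 2 * ∑ (between (suc k)) odd                     ≡⟨ cong (+ 2 *_) (∑-between k odd) ⟩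
          + 2 * ∑ (below k) (λ i → odd (suc i))             ≡⟨ ∑-odd k ⟩
          + 2 * + k + 1ℤ - sgn k                            ≡⟨ cong (λ t → + 2 * + k + 1ℤ + t) sgn-step ⟩
          + 2 * + k + 1ℤ + 1ℤ                               ≡⟨ finish (+ k) ⟩
          + 2 * (1ℤ + + k)                                  ≡⟨ cong (+ 2 *_) (trans (sym (ℤ.pos-+ 1 k)) (ℤ.pos-* 2 (suc r))) ⟩
          + 2 * (+ 2 * + suc r)                             ∎)
          where
          k : ℕ
          k = r ℕ.+ (suc r ℕ.+ 0)
          sgn-step : - sgn k ≡ 1ℤ
          sgn-step = trans (cong (λ t → - sgn (r ℕ.+ t)) (ℕ.+-identityʳ (suc r))) (sgn-double (suc r))
          finish : ∀ k → + 2 * k + 1ℤ + 1ℤ ≡ + 2 * (1ℤ + k)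
          finish = solve-∀

        surj : ∀ {z} → Form 1 (+ n) z × a′ z ≡ 0ℤ →
               ∃ λ rx → (Root (proj₁ rx) × proj₂ rx ℕ.< 2 ℕ.* proj₁ rx × 0 ℕ.< proj₂ rx) ×
                        (+ 2 * + proj₁ rx - + proj₂ rx , + proj₁ rx - + proj₂ rx , + proj₂ rx) ≡ z
        surj {a , s , + x} (form (0<a , +<+ 0<x) eq , a′≡0) = (r , x) ,
          ((ℤ.drop‿+<+ 0<r , ℤ.+-injective (trans (ℤ.pos-* r r) (trans (cong₂ _*_ (sym R≡) (sym R≡)) R²)))
            , ℤ.drop‿+<+ x<2r , 0<x) ,
          cong₂ (λ a s → a , s , + x)
            (trans (cong (λ t → + 2 * t - + x) (sym R≡)) (trans (recover s (+ x)) (sym a≡)))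
            (trans (cong (_- + x) (sym R≡)) (recover′ s (+ x)))
          where
          R = s + + x
          r = ∣ R ∣
          solveFor : ∀ a s x → a ≡ (a - + 2 * s - x) + (+ 2 * s + x)
          solveFor = solve-∀
          a≡ : a ≡ + 2 * s + + x
          a≡ = trans (solveFor a s (+ x)) (trans (cong (_+ (+ 2 * s + + x)) a′≡0) (ℤ.+-identityˡ _))
          double : ∀ s x → (+ 2 * s + x) + x ≡ + 2 * (s + x)
          double = solve-∀
          0<2R : 0ℤ < + 2 * R
          0<2R = subst (0ℤ <_) (trans (cong (_+ + x) a≡) (double s (+ x))) (ℤ.+-mono-< 0<a (+<+ 0<x))
          0<R : 0ℤ < R
          0<R = ℤ.*-cancelˡ-<-nonNeg {0ℤ} {R} (+ 2) 0<2R
          R≡ : R ≡ + r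
          R≡ = sym (ℤ.0≤i⇒+∣i∣≡i (ℤ.<⇒≤ 0<R))
          0<r : 0ℤ < + r
          0<r = subst (0ℤ <_) R≡ 0<R
          complete-square : ∀ s x → (s + x) * (s + x) ≡ s * s + + 1 * ((+ 2 * s + x) * x)
          complete-square = solve-∀
          R² : R * R ≡ + n
          R² = trans (complete-square s (+ x)) (trans (cong (λ t → s * s + + 1 * (t * + x)) (sym a≡)) eq)
          recover : ∀ s x → + 2 * (s + x) - x ≡ + 2 * s + x
          recover = solve-∀
          recover′ : ∀ s x → s + x - x ≡ s
          recover′ = solve-∀
          x<2r : + x < + (2 ℕ.* r)
          x<2r = 0<j-i⇒i<j (subst (0ℤ <_)
            (trans a≡ (trans (sym (recover s (+ x))) (cong (_- + x) (trans (cong (+ 2 *_) R≡) (sym (ℤ.pos-* 2 r)))))) 0<a)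
        surj {a , s , -[1+ _ ]} (form (_ , ()) _ , _)

      n*φ : + n * φ n ≡ ∑ positiveRoots (λ r → + 2 * + n * sgn r)
      n*φ = begin
        + n * φ n
          ≡⟨ cong (+ n *_) (∑-trisectᶻ (rootsOf n) (λ s → s) sgnᶻ) ⟩
        + n * (∑ S⁺ sgnᶻ + ∑ S⁻ sgnᶻ + ∑ S⁰ sgnᶻ)
          ≡⟨ cong (+ n *_) (cong₂ (λ p q → p + q + ∑ S⁰ sgnᶻ) (sym plus) (sym minus)) ⟩
        + n * (T + T + ∑ S⁰ sgnᶻ)
          ≡⟨ distribute (+ n) T (∑ S⁰ sgnᶻ) ⟩
        + 2 * + n * T + + n * ∑ S⁰ sgnᶻ
          -- The root 0 occurs only for n = 0, where the factor n kills it.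
          ≡⟨ cong₂ _+_ (sym (∑-* (+ 2 * + n) positiveRoots sgn)) (trans (sym (∑-* (+ n) S⁰ sgnᶻ))
               (∑-zero S⁰ λ { _ ((_ , refl) , refl) → refl })) ⟩
        ∑ positiveRoots (λ r → + 2 * + n * sgn r) + 0ℤ
          ≡⟨ ℤ.+-identityʳ _ ⟩
        ∑ positiveRoots (λ r → + 2 * + n * sgn r) ∎
        where
        S⁺ = rootsOf n ∩ λ s → 0ℤ ℤ.<? s
        S⁻ = rootsOf n ∩ λ s → 0ℤ ℤ.<? - s
        S⁰ = rootsOf n ∩ λ s → s ℤ.≟ 0ℤ
        T  = ∑ positiveRoots sgn
        distribute : ∀ n t u → n * (t + t + u) ≡ + 2 * n * t + n * u
        distribute = solve-∀
        plus : T ≡ ∑ S⁺ sgnᶻ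
        plus = ∑-bij positiveRoots S⁺ +_ (λ (0<r , eq) → (tt , eq) , +<+ 0<r) (λ _ _ → ℤ.+-injective)
          (λ { {+ r} ((_ , eq) , +<+ 0<r) → r , (0<r , eq) , refl }) (λ _ _ → refl)
        minus : T ≡ ∑ S⁻ sgnᶻ
        minus = ∑-bij positiveRoots S⁻ (λ r → - + r)
          (λ { {suc r} (_ , eq) → (tt , eq) , +<+ (s≤s z≤n) ; {zero} (() , _) })
          (λ _ _ eq → ℤ.+-injective (ℤ.neg-injective eq))
          (λ { { -[1+ r ]} ((_ , eq) , _) → suc r , (s≤s z≤n , eq) , refl
             ; {+ suc _} (_ , ()) ; {+ zero} (_ , +<+ ()) })
          (λ r _ → sym (sgnᶻ-neg (+ r)))

    φ⊛logDerivative : (φ ⊛ logDerivative) n ≡ - (+ n * φ n)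
    φ⊛logDerivative = begin
      (φ ⊛ logDerivative) n
        ≡⟨ φ⊛-∑ logDerivative-generates n u (λ s a x → rearrange (sgnᶻ s) (+ a) (odd x)) ⟩
      ∑ F u
        ≡⟨ ℤ.+-identityʳ _ ⟨
      ∑ F u + 0ℤ
        -- The weight with -s in place of a is odd in s and sums to 0; adding it turns the factor a
        -- into a - s.
        ≡⟨ cong (_+_ (∑ F u)) (∑-odd-middle 0 (+ n) u′ (λ a s x → trans
             (cong (λ t → - (t * oddᶻ x * - s)) (sgnᶻ-neg s)) (negate (sgnᶻ s) (oddᶻ x) s))) ⟨
      ∑ F u + ∑ F u′
        ≡⟨ trans (sym (∑-+ F u u′)) (∑-cong F λ { (a , s , x) _ → combine (sgnᶻ s) (oddᶻ x) a s }) ⟩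
      ∑ F w
        ≡⟨ ∑-trisectᶻ F a′ w ⟩
      ∑ F⁺ w + ∑ F⁻ w + ∑ F⁰ w
        ≡⟨ cong₂ (λ s t → s + t + ∑ F⁰ w) ∑F⁺ ∑F⁻ ⟩
      0ℤ + 0ℤ + ∑ F⁰ w
        ≡⟨ ℤ.+-identityˡ _ ⟩
      ∑ F⁰ w
        ≡⟨ trans ∑F⁰ (∑-neg positiveRoots _) ⟩
      - ∑ positiveRoots (λ r → + 2 * + n * sgn r)
        ≡⟨ cong -_ n*φ ⟨
      - (+ n * φ n) ∎
      where
      u u′ : Triple → ℤ
      u  (a , s , x) = sgnᶻ s * oddᶻ x * a
      u′ (a , s , x) = - (sgnᶻ s * oddᶻ x * s)
      rearrange : ∀ p a o → p * (a * o) ≡ p * o * a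
      rearrange = solve-∀
      negate : ∀ p o s → - (p * o * - s) ≡ - - (p * o * s)
      negate = solve-∀
      combine : ∀ p o a s → p * o * a + - (p * o * s) ≡ p * o * (a - s)
      combine = solve-∀

  θ-φ : θ φ ≈ ⊖ (φ ⊛ logDerivative)
  θ-φ = coefficientwise λ n → trans (sym (ℤ.neg-involutive _)) (cong -_ (sym (φ⊛logDerivative n)))

-- Zagier's sum of positive values over forms negative at (1, 0)

module CrossingForms where

  open import Data.Integer.Base using (_+_; _*_; _<_)
  open import Relation.Binary.Definitions using (tri<; tri≈; tri>)
  open FiniteSums
  open BinaryForms
  open ≡-Reasoning

  *-pos : ∀ {i j} → 0ℤ < i → 0ℤ < j → 0ℤ < i * j
  *-pos {+ suc i} {+ suc j} _ _ = +<+ (s≤s z≤n)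
  *-pos {+ zero}            (+<+ ())
  *-pos {+ suc _} {+ zero}  _ (+<+ ())

  *-pos⁻ : ∀ {i j} → 0ℤ < j → 0ℤ < i * j → 0ℤ < i
  *-pos⁻ {+ suc i}   {+ suc j} _ _ = +<+ (s≤s z≤n)
  *-pos⁻ {+ zero}    {+ suc j} _ (+<+ ())
  *-pos⁻ { -[1+ _ ]} {+ suc j} _ ()
  *-pos⁻ {_}         {+ zero}  (+<+ ())

  Q : ℤ → ℤ → Triple → ℤ
  Q u v (a , b , c) = - (a * (u * u)) + b * (u * v) + c * (v * v)

  module ConstantSum (D : ℤ) (nonsquare : ∀ b → b * b ≢ D) where

    S : Finite (Form 4 D)
    S = forms 3 D

    total : ℤ
    total = ∑ S (λ (a , b , c) → c)

    record Crossing (u v : ℤ) (z : Triple) : Set where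
      constructor crossing
      a = proj₁ z
      b = proj₁ (proj₂ z)
      c = proj₂ (proj₂ z)
      field
        positive     : 0ℤ < a × 0ℤ < Q u v z
        discriminant : b * b + + 4 * (a * c) ≡ D

    -- Finiteness is part of the claim: c may be negative, so the discriminant gives no direct
    -- bound. The enumeration is carried along the Euclidean algorithm together with the sum.
    HasSum : ℤ → ℤ → Set
    HasSum u v = ∃ λ (G : Finite (Crossing u v)) → ∑ G (Q u v) ≡ v * v * total

    ∑-first : ∑ S (λ (a , b , c) → a) ≡ total
    ∑-first = ∑-inverse S S (λ (a , b , c) → c , b , a) (λ (a , b , c) → c , b , a)
      reverse reverse (λ _ _ → refl) (λ _ _ → refl) (λ _ _ → refl)
      where
      exchange : ∀ a b c → b * b + + 4 * (c * a) ≡ b * b + + 4 * (a * c)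
      exchange = solve-∀
      reverse : ∀ {z} → Form 4 D z → Form 4 D (proj₂ (proj₂ z) , proj₁ (proj₂ z) , proj₁ z)
      reverse {a , b , c} (form (0<a , 0<c) eq) = form (0<c , 0<a) (trans (exchange a b c) eq)

    -- Q(u, v) is linear in (a, b, c); reversing the triple gives Σ a = Σ c, and b ↦ -b gives Σ b =
    -- 0.
    ∑-Q : ∀ u v → ∑ S (Q u v) ≡ (v * v - u * u) * total
    ∑-Q u v = begin
      ∑ S (Q u v)
        ≡⟨ ∑-cong S (λ { (a , b , c) _ → arrange a b c u v }) ⟩
      ∑ S (λ (a , b , c) → - (u * u) * a + u * v * b + v * v * c)
        ≡⟨ trans (∑-+ S _ _) (cong₂ _+_ (trans (∑-+ S _ _) (cong₂ _+_ (∑-* (- (u * u)) S _) (∑-* (u * v) S _)))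
             (∑-* (v * v) S _)) ⟩
      - (u * u) * ∑ S (λ (a , b , c) → a) + u * v * ∑ S (λ (a , b , c) → b) + v * v * total
        ≡⟨ cong₂ (λ x y → - (u * u) * x + u * v * y + v * v * total) ∑-first
             (∑-odd-middle 3 D (λ (a , b , c) → b) (λ _ _ _ → refl)) ⟩
      - (u * u) * total + u * v * 0ℤ + v * v * total
        ≡⟨ collect u v total ⟩
      (v * v - u * u) * total ∎
      where
      arrange : ∀ a b c u v → - (a * (u * u)) + b * (u * v) + c * (v * v) ≡ - (u * u) * a + u * v * b + v * v * c
      arrange = solve-∀
      collect : ∀ u v t → - (u * u) * t + u * v * 0ℤ + v * v * t ≡ (v * v - u * u) * t
      collect = solve-∀

    base : ∀ {v} → 0ℤ < v → HasSum 0ℤ v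
    base {v} 0<v = G , (begin
      ∑ G (Q 0ℤ v)                             ≡⟨ ∑-inverse G S (λ z → z) (λ z → z) from to (λ _ _ → refl) (λ _ _ → refl)
                                                     (λ z _ → value z) ⟩
      ∑ S (λ (a , b , c) → v * v * c)          ≡⟨ ∑-* (v * v) S (λ (a , b , c) → c) ⟩
      v * v * total                            ∎)
      where
      evaluate : ∀ a b c v → - (a * (0ℤ * 0ℤ)) + b * (0ℤ * v) + c * (v * v) ≡ v * v * c
      evaluate = solve-∀
      value : ∀ z → Q 0ℤ v z ≡ v * v * proj₂ (proj₂ z)
      value (a , b , c) = evaluate a b c v
      to : ∀ {z} → Form 4 D z → Crossing 0ℤ v z
      to {z} (form (0<a , 0<c) eq) = crossing (0<a , subst (0ℤ <_) (sym (value z)) (*-pos (*-pos 0<v 0<v) 0<c)) eq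
      from : ∀ {z} → Crossing 0ℤ v z → Form 4 D z
      from {z} (crossing (0<a , 0<Q) eq) = form (0<a , *-pos⁻ (*-pos 0<v 0<v)
        (subst (0ℤ <_) (trans (value z) (ℤ.*-comm (v * v) _)) 0<Q)) eq
      G : Finite (Crossing 0ℤ v)
      G = relabel to from S

    -- The shear fixing (1, 0) and sending (u, v) to (u + v, v) preserves the discriminant and the
    -- value at (1, 0).
    translate : ∀ {u v} → HasSum u v → HasSum (u + v) v
    translate {u} {v} (G , eq) = image f to inj surj G , trans
      (sym (∑-bij G (image f to inj surj G) f to inj surj (λ { (a , b , c) _ → sym (value a b c u v) }))) eq
      where
      f f⁻¹ : Triple → Triple
      f   (a , b , c) = a , b + + 2 * a , c - b - a
      f⁻¹ (a , b , c) = a , b - + 2 * a , c + b - a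
      disc : ∀ a b c → (b + + 2 * a) * (b + + 2 * a) + + 4 * (a * (c - b - a)) ≡ b * b + + 4 * (a * c)
      disc = solve-∀
      value : ∀ a b c u v → - (a * ((u + v) * (u + v))) + (b + + 2 * a) * ((u + v) * v) + (c - b - a) * (v * v) ≡
              - (a * (u * u)) + b * (u * v) + c * (v * v)
      value = solve-∀
      cancel₁ : ∀ a b → b + + 2 * a - + 2 * a ≡ b
      cancel₁ = solve-∀
      cancel₂ : ∀ a b c → c - b - a + (b + + 2 * a) - a ≡ c
      cancel₂ = solve-∀
      cancel₃ : ∀ a b → b - + 2 * a + + 2 * a ≡ b
      cancel₃ = solve-∀
      cancel₄ : ∀ a b c → c + b - a - (b - + 2 * a) - a ≡ c
      cancel₄ = solve-∀
      f⁻¹f : ∀ z → f⁻¹ (f z) ≡ z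
      f⁻¹f (a , b , c) = cong₂ (λ b c → a , b , c) (cancel₁ a b) (cancel₂ a b c)
      ff⁻¹ : ∀ z → f (f⁻¹ z) ≡ z
      ff⁻¹ (a , b , c) = cong₂ (λ b c → a , b , c) (cancel₃ a b) (cancel₄ a b c)
      to : ∀ {z} → Crossing u v z → Crossing (u + v) v (f z)
      to {a , b , c} (crossing (0<a , 0<Q) eq) =
        crossing (0<a , subst (0ℤ <_) (sym (value a b c u v)) 0<Q) (trans (disc a b c) eq)
      back : ∀ {z} → Crossing (u + v) v (f z) → Crossing u v z
      back {a , b , c} (crossing (0<a , 0<Q) eq) =
        crossing (0<a , subst (0ℤ <_) (value a b c u v) 0<Q) (trans (sym (disc a b c)) eq)
      inj : ∀ {y z} → Crossing u v y → Crossing u v z → f y ≡ f z → y ≡ z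
      inj {y} {z} _ _ eq = trans (sym (f⁻¹f y)) (trans (cong f⁻¹ eq) (f⁻¹f z))
      surj : ∀ {z} → Crossing (u + v) v z → ∃ λ y → Crossing u v y × f y ≡ z
      surj {z} p = f⁻¹ z , back (subst (Crossing (u + v) v) (sym (ff⁻¹ z)) p) , ff⁻¹ z

    -- A form vanishing at (1, 0) or (0, 1) has the square b² as discriminant. For nonsquare D every
    -- form therefore has a sign at both points.
    nonzero : ∀ {a b c} → b * b + + 4 * (a * c) ≡ D → a ≢ 0ℤ × c ≢ 0ℤ
    nonzero {a} {b} {c} eq =
      (λ { refl → nonsquare b (trans (sym (ℤ.+-identityʳ (b * b))) eq) }) ,
      (λ { refl → nonsquare b (trans (sym (ℤ.+-identityʳ (b * b)))
        (trans (cong (λ t → b * b + + 4 * t) (sym (ℤ.*-zeroʳ a))) eq)) })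

    0<- : ∀ {i} → i ≢ 0ℤ → ¬ (0ℤ < i) → 0ℤ < - i
    0<- {i} i≢0 i≯0 with ℤ.<-cmp 0ℤ i
    ... | tri< 0<i _ _ = contradiction 0<i i≯0
    ... | tri≈ _ 0≡i _ = contradiction (sym 0≡i) i≢0
    ... | tri> _ _ i<0 = ℤ.neg-mono-< i<0

    record Swapped (u v : ℤ) (z : Triple) : Set where
      constructor crossing
      a = proj₁ z
      b = proj₁ (proj₂ z)
      c = proj₂ (proj₂ z)
      field
        positive     : 0ℤ < - c × 0ℤ < Q u v z
        discriminant : b * b + + 4 * (a * c) ≡ D

    -- With e₁ = (1 , 0), e₂ = (0 , 1) and w = (u , v), the forms negative at e₁ and positive at w
    -- differ from those negative at e₂ and positive at w only by forms whose signs at e₁ and e₂ differ.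
    invert : ∀ {u v} → HasSum v u → HasSum u v
    invert {u} {v} (G , eq) = H , (begin
      ∑ H (Q u v)
        ≡⟨ ∑-split H A (S ∩ pos?) split (λ { (crossing (_ , 0<Q) e , 0<a) → crossing (0<a , 0<Q) e })
             (λ { (form (0<a , _) e , 0<Q) → crossing (0<a , 0<Q) e }) disjoint (Q u v) ⟩
      ∑ A (Q u v) + ∑ (S ∩ pos?) (Q u v)
        ≡⟨ rearrange (∑ A (Q u v)) (∑ (S ∩ pos?) (Q u v)) (∑ (S ∩ neg?) (Q u v)) ⟩
      -- `A` and `B` split the forms negative at e₂ and positive at w by their sign at e₁, and
      -- negation carries `B` to the forms of `S` negative at w. So the first bracket is the sum
      -- over `T`, given by `eq`, and the second is the sum over all of `S`.
      (∑ A (Q u v) + - ∑ (S ∩ neg?) (Q u v)) + (∑ (S ∩ pos?) (Q u v) + ∑ (S ∩ neg?) (Q u v) + 0ℤ)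
        ≡⟨ cong₂ _+_ lower upper ⟩
      u * u * total + (v * v - u * u) * total
        ≡⟨ collect u v total ⟩
      v * v * total ∎)
      where
      pos? = λ z → 0ℤ ℤ.<? Q u v z
      neg? = λ z → 0ℤ ℤ.<? - Q u v z

      σ : Triple → Triple
      σ (a , b , c) = - c , b , - a

      value-σ : ∀ a b c u v → - (- c * (u * u)) + b * (u * v) + - a * (v * v) ≡
                - (a * (v * v)) + b * (v * u) + c * (u * u)
      value-σ = solve-∀
      disc-σ : ∀ a b c → b * b + + 4 * (- c * - a) ≡ b * b + + 4 * (a * c)
      disc-σ = solve-∀
      σσ : ∀ z → σ (σ z) ≡ z
      σσ (a , b , c) = cong₂ (λ a c → a , b , c) (ℤ.neg-involutive a) (ℤ.neg-involutive c)

      to-σ : ∀ {z} → Crossing v u z → Swapped u v (σ z)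
      to-σ {a , b , c} (crossing (0<a , 0<Q) e) = crossing
        (subst (0ℤ <_) (sym (ℤ.neg-involutive a)) 0<a , subst (0ℤ <_) (sym (value-σ a b c u v)) 0<Q)
        (trans (disc-σ a b c) e)
      from-σ : ∀ {z} → Swapped u v z → Crossing v u (σ z)
      from-σ {a , b , c} (crossing (0<-c , 0<Q) e) = crossing
        (0<-c , subst (0ℤ <_) (sym (value-σ a b c v u)) 0<Q) (trans (disc-σ a b c) e)

      inj-σ : ∀ {y z} → Crossing v u y → Crossing v u z → σ y ≡ σ z → y ≡ z
      inj-σ {y} {z} _ _ e = trans (sym (σσ y)) (trans (cong σ e) (σσ z))
      surj-σ : ∀ {z} → Swapped u v z → ∃ λ y → Crossing v u y × σ y ≡ z
      surj-σ {z} p = σ z , from-σ p , σσ z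

      T : Finite (Swapped u v)
      T = image σ to-σ inj-σ surj-σ G

      A = T ∩ λ z → 0ℤ ℤ.<? proj₁ z
      B = T ∩ λ z → 0ℤ ℤ.<? - proj₁ z

      disjoint : ∀ {z} → Swapped u v z × 0ℤ < proj₁ z → ¬ (Form 4 D z × 0ℤ < Q u v z)
      disjoint {a , b , c} (crossing (0<-c , _) _ , _) (form (_ , 0<c) _ , _) =
        ℤ.<-asym 0<c (subst (_< 0ℤ) (ℤ.neg-involutive c) (ℤ.neg-mono-< 0<-c))

      split : ∀ {z} → Crossing u v z → (Swapped u v z × 0ℤ < proj₁ z) ⊎ (Form 4 D z × 0ℤ < Q u v z)
      split {a , b , c} (crossing (0<a , 0<Q) e) with 0ℤ ℤ.<? c
      ... | yes 0<c = inj₂ (form (0<a , 0<c) e , 0<Q)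
      ... | no  c≯0 = inj₁ (crossing (0<- (proj₂ (nonzero {a} {b} {c} e)) c≯0 , 0<Q) e , 0<a)

      H : Finite (Crossing u v)
      H = relabel (λ { (inj₁ (crossing (_ , 0<Q) e , 0<a)) → crossing (0<a , 0<Q) e
                     ; (inj₂ (form (0<a , _) e , 0<Q))     → crossing (0<a , 0<Q) e })
        split (union A (S ∩ pos?) disjoint)

      value-neg : ∀ a b c u v → - (- a * (u * u)) + - b * (u * v) + - c * (v * v) ≡
                  - (- (a * (u * u)) + b * (u * v) + c * (v * v))
      value-neg = solve-∀
      disc-neg : ∀ a b c → - b * - b + + 4 * (- a * - c) ≡ b * b + + 4 * (a * c)
      disc-neg = solve-∀
      ν : Triple → Triple
      ν (a , b , c) = - a , - b , - c
      νν : ∀ z → ν (ν z) ≡ z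
      νν (a , b , c) = cong₂ (λ a (b , c) → a , b , c) (ℤ.neg-involutive a)
        (cong₂ _,_ (ℤ.neg-involutive b) (ℤ.neg-involutive c))

      ∑B : ∑ B (Q u v) ≡ - ∑ (S ∩ neg?) (Q u v)
      ∑B = trans
        (∑-inverse B (S ∩ neg?) ν ν
          (λ { {a , b , c} (crossing (0<-c , 0<Q) e , 0<-a) →
               form (0<-a , 0<-c) (trans (disc-neg a b c) e) ,
               subst (0ℤ <_) (trans (sym (ℤ.neg-involutive (Q u v (a , b , c)))) (cong -_ (sym (value-neg a b c u v)))) 0<Q })
          (λ { {a , b , c} (form (0<a , 0<c) e , 0<-Q) →
               crossing (subst (0ℤ <_) (sym (ℤ.neg-involutive c)) 0<c , subst (0ℤ <_) (sym (value-neg a b c u v)) 0<-Q)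
                 (trans (disc-neg a b c) e) ,
               subst (0ℤ <_) (sym (ℤ.neg-involutive a)) 0<a })
          (λ z _ → νν z) (λ z _ → νν z)
          (λ { (a , b , c) _ → trans (sym (ℤ.neg-involutive (Q u v (a , b , c)))) (cong -_ (sym (value-neg a b c u v))) }))
        (∑-neg (S ∩ neg?) (Q u v))

      lower : ∑ A (Q u v) + - ∑ (S ∩ neg?) (Q u v) ≡ u * u * total
      lower = begin
        ∑ A (Q u v) + - ∑ (S ∩ neg?) (Q u v)   ≡⟨ cong (_+_ (∑ A (Q u v))) ∑B ⟨
        ∑ A (Q u v) + ∑ B (Q u v)              ≡⟨ ∑-split T A B split-sign proj₁ proj₁
                                                    (λ { {a , _} (_ , 0<a) (_ , 0<-a) →
                                                         ℤ.<-asym 0<a (subst (_< 0ℤ) (ℤ.neg-involutive a) (ℤ.neg-mono-< 0<-a)) })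
                                                    (Q u v) ⟨
        ∑ T (Q u v)                            ≡⟨ ∑-bij G T σ to-σ inj-σ surj-σ
                                                    (λ { (a , b , c) _ → sym (value-σ a b c u v) }) ⟨
        ∑ G (Q v u)                            ≡⟨ eq ⟩
        u * u * total                          ∎
        where
        split-sign : ∀ {z} → Swapped u v z → (Swapped u v z × 0ℤ < proj₁ z) ⊎ (Swapped u v z × 0ℤ < - proj₁ z)
        split-sign {a , b , c} p@(crossing _ e) with 0ℤ ℤ.<? a
        ... | yes 0<a = inj₁ (p , 0<a)
        ... | no  a≯0 = inj₂ (p , 0<- (proj₁ (nonzero {a} {b} {c} e)) a≯0)

      upper : ∑ (S ∩ pos?) (Q u v) + ∑ (S ∩ neg?) (Q u v) + 0ℤ ≡ (v * v - u * u) * total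
      upper = begin
        ∑ (S ∩ pos?) (Q u v) + ∑ (S ∩ neg?) (Q u v) + 0ℤ
          ≡⟨ cong (_+_ (∑ (S ∩ pos?) (Q u v) + ∑ (S ∩ neg?) (Q u v)))
               (∑-zero (S ∩ λ z → Q u v z ℤ.≟ 0ℤ) (λ _ → proj₂)) ⟨
        ∑ (S ∩ pos?) (Q u v) + ∑ (S ∩ neg?) (Q u v) + ∑ (S ∩ λ z → Q u v z ℤ.≟ 0ℤ) (Q u v)
          ≡⟨ ∑-trisectᶻ S (Q u v) (Q u v) ⟨
        ∑ S (Q u v)
          ≡⟨ ∑-Q u v ⟩
        (v * v - u * u) * total ∎

      rearrange : ∀ a p n → a + p ≡ (a + - n) + (p + n + 0ℤ)
      rearrange = solve-∀
      collect : ∀ u v t → u * u * t + (v * v - u * u) * t ≡ v * v * t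
      collect = solve-∀

    -- The subtractive Euclidean algorithm: `translate` accounts for u - v when v ≤ u, and otherwise
    -- `invert` exchanges the two entries. The sum u + v decreases until u = 0, where Q(0, v) = v²
    -- c.
    constant : ∀ u v → 0 ℕ.< v → HasSum (+ u) (+ v)
    constant u v 0<v = euclid (u ℕ.+ v) u v ℕ.≤-refl 0<v
      where
      step : ∀ {u v} → v ℕ.≤ u → HasSum (+ (u ℕ.∸ v)) (+ v) → HasSum (+ u) (+ v)
      step {u} {v} v≤u h = subst (λ t → HasSum t (+ v))
        (trans (sym (ℤ.pos-+ (u ℕ.∸ v) v)) (cong +_ (ℕ.m∸n+n≡m v≤u))) (translate h)

      drop : ∀ {u v k} → 0 ℕ.< v → v ℕ.≤ u → u ℕ.+ v ℕ.≤ suc k → (u ℕ.∸ v) ℕ.+ v ℕ.≤ k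
      drop {u} {v} 0<v v≤u b = ℕ.≤-pred (ℕ.<-≤-trans
        (ℕ.≤-<-trans (ℕ.≤-reflexive (ℕ.m∸n+n≡m v≤u)) (ℕ.m<m+n u 0<v)) b)

      euclid : ∀ k u v → u ℕ.+ v ℕ.≤ k → 0 ℕ.< v → HasSum (+ u) (+ v)
      euclid k       zero    v _ 0<v = base (+<+ 0<v)
      euclid zero    (suc u) v ()
      euclid (suc k) (suc u) v b 0<v with v ℕ.≤? suc u
      ... | yes v≤u = step v≤u (euclid k (suc u ℕ.∸ v) v (drop 0<v v≤u b) 0<v)
      ... | no  v≰u = invert (step u≤v (euclid k (v ℕ.∸ suc u) (suc u)
          (drop (s≤s z≤n) u≤v (subst (ℕ._≤ suc k) (ℕ.+-comm (suc u) v) b)) (s≤s z≤n)))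
        where u≤v = ℕ.<⇒≤ (ℕ.≰⇒> v≰u)

-- Arithmetic modulo an odd prime

module ModPrime where

  open import Data.Integer.Base using (_+_; _*_; _<_) renaming (∣_∣ to abs)
  open import Data.Integer.Divisibility.Signed
    using (_∣_; divides; ∣ᵤ⇒∣; ∣⇒∣ᵤ; ∣m∣n⇒∣m-n; ∣n⇒∣m*n; ∣m⇒∣-m; ∣-refl)
  open import Data.Integer.DivMod using (_%ℕ_; _/ℕ_; n%ℕd<d; a≡a%ℕn+[a/ℕn]*n)
  open import Data.Nat.Coprimality using (Coprime; coprime-Bézout)
  open import Data.Nat.DivMod using (m*n/n≡m)
  open import Data.Nat.GCD using (module Bézout)
  open import Data.Nat.Primality using (Prime; euclidsLemma; prime⇒irreducible; prime⇒nonZero)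
  open ≡-Reasoning

  module PrimeArithmetic (p : ℕ) (prime : Prime p) (3≤p : 3 ℕ.≤ p) where

    P : ℤ
    P = + p

    instance
      p-nonZero : ℕ.NonZero p
      p-nonZero = prime⇒nonZero prime

    euclid : ∀ i j → P ∣ i * j → P ∣ i ⊎ P ∣ j
    euclid i j d = Sum.map ∣ᵤ⇒∣ ∣ᵤ⇒∣ (euclidsLemma (abs i) (abs j) prime (subst (p ℕ.∣_) (ℤ.abs-* i j) (∣⇒∣ᵤ d)))

    ∣-square : ∀ {i} → P ∣ i * i → P ∣ i
    ∣-square {i} d = reduce (euclid i i d)

    P∤small : ∀ {n} → 0 ℕ.< n → n ℕ.< p → ¬ P ∣ + n
    P∤small {suc n} _ n<p d = ℕ.<⇒≱ n<p (ℕ.∣⇒≤ (∣⇒∣ᵤ d))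

    P∤2 : ¬ P ∣ + 2
    P∤2 = P∤small (s≤s z≤n) 3≤p

    P∤4 : ¬ P ∣ + 4
    P∤4 d = P∤2 (∣-square d)

    P∤* : ∀ {i j} → ¬ P ∣ i → ¬ P ∣ j → ¬ P ∣ i * j
    P∤* {i} {j} ¬i ¬j d with euclid i j d
    ... | inj₁ P∣i = ¬i P∣i
    ... | inj₂ P∣j = ¬j P∣j

    inverse : ∀ m → ¬ P ∣ m → ∃ λ t → P ∣ m * t - 1ℤ
    inverse (+ n) P∤n with coprime-Bézout coprime
      where
      coprime : Coprime n p
      coprime {d} (d∣n , d∣p) with prime⇒irreducible prime d∣p
      ... | inj₁ d≡1  = d≡1
      ... | inj₂ refl = contradiction (∣ᵤ⇒∣ d∣n) P∤n
    ... | Bézout.+- x y eq = + x , divides (+ y) (begin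
      + n * + x - 1ℤ              ≡⟨ cong (_- 1ℤ) (trans (ℤ.*-comm (+ n) (+ x)) (sym (ℤ.pos-* x n))) ⟩
      + (x ℕ.* n) - 1ℤ            ≡⟨ cong (λ t → + t - 1ℤ) (sym eq) ⟩
      + (1 ℕ.+ y ℕ.* p) - 1ℤ      ≡⟨ cong (_- 1ℤ) (trans (ℤ.pos-+ 1 (y ℕ.* p)) (cong (_+_ 1ℤ) (ℤ.pos-* y p))) ⟩
      1ℤ + + y * P - 1ℤ           ≡⟨ simplify (+ y * P) ⟩
      + y * P                     ∎)
      where
      simplify : ∀ t → 1ℤ + t - 1ℤ ≡ t
      simplify = solve-∀
    ... | Bézout.-+ x y eq = - + x , divides (- + y) (begin
      + n * - + x - 1ℤ            ≡⟨ negate (+ n) (+ x) ⟩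
      - (1ℤ + + x * + n)          ≡⟨ cong -_ (trans (cong (_+_ 1ℤ) (sym (ℤ.pos-* x n))) (sym (ℤ.pos-+ 1 (x ℕ.* n)))) ⟩
      - + (1 ℕ.+ x ℕ.* n)         ≡⟨ cong (λ t → - + t) eq ⟩
      - + (y ℕ.* p)               ≡⟨ cong -_ (ℤ.pos-* y p) ⟩
      - (+ y * P)                 ≡⟨ ℤ.neg-distribˡ-* (+ y) P ⟩
      - + y * P                   ∎)
      where
      negate : ∀ n x → n * - x - 1ℤ ≡ - (1ℤ + x * n)
      negate = solve-∀
    inverse -[1+ n ] P∤m = let t , d = inverse (+ suc n) (λ d → P∤m (∣m⇒∣-m d)) in
      - t , subst (P ∣_) (negate (+ suc n) t) d
      where
      negate : ∀ n t → n * t - 1ℤ ≡ - n * - t - 1ℤ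
      negate = solve-∀

    -- j is the residue of -b / (2a), where 2a is invertible because p is odd and p ∤ a. With
    -- `root-unique` this singles out one j in 0, ..., p - 1 for each form with p ∤ a.
    root : ∀ a b → ¬ P ∣ a → ∃ λ j → j ℕ.< p × P ∣ b + + 2 * a * + j
    root a b P∤a = j , n%ℕd<d (- b * t) p , subst (P ∣_) eq
      (∣m∣n⇒∣m-n (∣m⇒∣-m (∣n⇒∣m*n b (proj₂ (inverse (+ 2 * a) (P∤* P∤2 P∤a)))))
        (∣n⇒∣m*n (+ 2 * a * ((- b * t) /ℕ p)) ∣-refl))
      where
      t = proj₁ (inverse (+ 2 * a) (P∤* P∤2 P∤a))
      j = (- b * t) %ℕ p
      k = (- b * t) /ℕ p
      expand : ∀ a b t k P → - (b * (a * t - 1ℤ)) - a * k * P ≡ b + a * (- b * t - k * P)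
      expand = solve-∀
      recover : ∀ j k → j + k - k ≡ j
      recover = solve-∀
      eq : - (b * (+ 2 * a * t - 1ℤ)) - + 2 * a * k * P ≡ b + + 2 * a * + j
      eq = trans (expand (+ 2 * a) b t k P) (cong (λ i → b + + 2 * a * i)
        (trans (cong (_- k * P) (a≡a%ℕn+[a/ℕn]*n (- b * t) p)) (recover (+ j) (k * P))))

    residue-unique-≤ : ∀ {i j} → j ℕ.≤ i → i ℕ.< p → P ∣ + i - + j → i ≡ j
    residue-unique-≤ {i} {j} j≤i i<p d with i ℕ.∸ j in eq
    ... | zero  = ℕ.≤-antisym (ℕ.m∸n≡0⇒m≤n eq) j≤i
    ... | suc m = contradiction (subst (P ∣_) (trans (ℤ.m-n≡m⊖n i j) (trans (ℤ.⊖-≥ j≤i) (cong +_ eq))) d)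
      (P∤small (s≤s z≤n) (ℕ.≤-<-trans (subst (ℕ._≤ i) eq (ℕ.m∸n≤m i j)) i<p))

    residue-unique : ∀ {i j} → i ℕ.< p → j ℕ.< p → P ∣ + i - + j → i ≡ j
    residue-unique {i} {j} i<p j<p d with ℕ.≤-total j i
    ... | inj₁ j≤i = residue-unique-≤ j≤i i<p d
    ... | inj₂ i≤j = sym (residue-unique-≤ i≤j j<p (subst (P ∣_) (negate (+ i) (+ j)) (∣m⇒∣-m d)))
      where
      negate : ∀ i j → - (i - j) ≡ j - i
      negate = solve-∀
    root-unique : ∀ {a b i j} → ¬ P ∣ a → i ℕ.< p → j ℕ.< p → P ∣ b + + 2 * a * + i → P ∣ b + + 2 * a * + j → i ≡ j
    root-unique {a} {b} {i} {j} P∤a i<p j<p d e =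
      [ (λ P∣2a → contradiction P∣2a (P∤* P∤2 P∤a)) , residue-unique i<p j<p ]′
      (euclid (+ 2 * a) (+ i - + j) (subst (P ∣_) (difference b (+ 2 * a) (+ i) (+ j)) (∣m∣n⇒∣m-n d e)))
      where
      difference : ∀ b a i j → (b + a * i) - (b + a * j) ≡ a * (i - j)
      difference = solve-∀

    cancel-P² : ∀ {x y} → P * P * x ≡ P * P * y → x ≡ y
    cancel-P² {x} {y} eq = ℤ.*-cancelˡ-≡ P x y (ℤ.*-cancelˡ-≡ P (P * x) (P * y)
      (trans (sym (ℤ.*-assoc P P x)) (trans eq (ℤ.*-assoc P P y))))

    P∣m*x⇒P∣x : ∀ {m x} → ¬ P ∣ m → P ∣ m * x → P ∣ x
    P∣m*x⇒P∣x {m} {x} P∤m d = [ (λ P∣m → contradiction P∣m P∤m) , (λ P∣x → P∣x) ]′ (euclid m x d)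

    -- Euclid's lemma removes the two factors p one after the other.
    square-factor : ∀ {m x y} → ¬ P ∣ m → m * x ≡ P * P * y → ∃ λ z → x ≡ P * P * z
    square-factor {m} {x} {y} P∤m eq = second (P∣m*x⇒P∣x {m} {x} P∤m (divides (P * y) (trans eq (move₁ P y))))
      where
      move₁ : ∀ P y → P * P * y ≡ P * y * P
      move₁ = solve-∀
      move₂ : ∀ m x P → P * (m * x) ≡ m * (x * P)
      move₂ = solve-∀
      move₃ : ∀ P y → P * P * y ≡ P * (y * P)
      move₃ = solve-∀
      move₄ : ∀ z P → z * P * P ≡ P * P * z
      move₄ = solve-∀
      third : ∀ {x₁} → P ∣ x₁ → ∃ λ z → x₁ * P ≡ P * P * z
      third (divides z refl) = z , move₄ z P
      second : P ∣ x → ∃ λ z → x ≡ P * P * z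
      second (divides x₁ refl) = third (P∣m*x⇒P∣x {m} {x₁} P∤m (divides y
        (ℤ.*-cancelˡ-≡ P (m * x₁) (y * P) (trans (move₂ m x₁ P) (trans eq (move₃ P y))))))

    -- Inverts multiplication by p on the positive integers only.
    div : ℤ → ℤ
    div i = + ((abs i) ℕ./ p)

    div-* : ∀ {i} → 0ℤ < i → div (i * P) ≡ i
    div-* {+ n} _ = cong +_ (trans (cong (ℕ._/ p) (ℤ.abs-* (+ n) P)) (m*n/n≡m n p))

-- The Hecke relation at p² for discriminants divisible by p

module HeckeRelation where

  open import Data.Integer.Base using (_+_; _*_; _<_)
  open import Data.Integer.Divisibility.Signed
    using (_∣_; _∣?_; divides; ∣m∣n⇒∣m-n; ∣m⇒∣m*n; ∣n⇒∣m*n; ∣-refl)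
  open import Data.Nat.Primality using (Prime)
  open FiniteSums
  open BinaryForms using (Form; form; forms; Triple)
  open CrossingForms
  open ModPrime
  open ≡-Reasoning

  ∑-below-const : ∀ n k → ∑ (below n) (λ _ → k) ≡ + n * k
  ∑-below-const zero    k = ∑-empty (below 0) λ _ ()
  ∑-below-const (suc n) k = begin
    ∑ (below (suc n)) (λ _ → k)        ≡⟨ ∑-below-suc n (λ _ → k) ⟩
    k + ∑ (below n) (λ _ → k)          ≡⟨ cong (_+_ k) (∑-below-const n k) ⟩
    k + + n * k                        ≡⟨ collect k (+ n) ⟩
    (1ℤ + + n) * k                     ≡⟨ cong (_* k) (ℤ.pos-+ 1 n) ⟨
    + suc n * k                        ∎
    where
    collect : ∀ k n → k + n * k ≡ (1ℤ + n) * k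
    collect = solve-∀

  +-cancelˡ-≡ : ∀ x {y z} → x + y ≡ x + z → y ≡ z
  +-cancelˡ-≡ x {y} {z} eq = trans (restore x y) (trans (cong (_- x) eq) (sym (restore x z)))
    where
    restore : ∀ x y → y ≡ x + y - x
    restore = solve-∀

  +-cancelʳ-≡ : ∀ x {y z} → y + x ≡ z + x → y ≡ z
  +-cancelʳ-≡ x {y} {z} eq = +-cancelˡ-≡ x (trans (ℤ.+-comm x y) (trans eq (ℤ.+-comm z x)))

  third : Triple → ℤ
  third (a , b , c) = c

  -- For m = p² these are the forms of discriminant D / p², stated without division: if p² ∤ D there
  -- are none, in accordance with the convention F(D / p²) = 0.
  record DividedForm (m D : ℤ) (z : Triple) : Set where
    constructor form
    a = proj₁ z
    b = proj₁ (proj₂ z)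
    c = proj₂ (proj₂ z)
    field
      positive     : 0ℤ < a × 0ℤ < c
      discriminant : m * (b * b + + 4 * (a * c)) ≡ D

  module Hecke
    (p : ℕ) (prime : Prime p) (3≤p : 3 ℕ.≤ p) (D : ℤ) (nonsquare : ∀ b → b * b ≢ D)
    (p∣D : + p ∣ D) (S″ : Finite (DividedForm (+ p * + p) D))
    where

    open PrimeArithmetic p prime 3≤p
    open ConstantSum D nonsquare

    S′ : Finite (Form 4 (P * P * D))
    S′ = forms 3 (P * P * D)

    0<p : 0 ℕ.< p
    0<p = ℕ.<-≤-trans (s≤s z≤n) 3≤p

    0<P : 0ℤ < P
    0<P = +<+ 0<p

    P∣P*P* : ∀ x → P ∣ P * P * x
    P∣P*P* x = ∣m⇒∣m*n {P} {P * P} x (∣m⇒∣m*n {P} {P} P ∣-refl)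

    middle-divisible : ∀ {a b c E} → P ∣ E → b * b + + 4 * (a * c) ≡ E → P ∣ a → P ∣ b
    middle-divisible {a} {b} {c} {E} P∣E eq P∣a = ∣-square (subst (P ∣_) (trans (cong (_- + 4 * (a * c)) (sym eq)) (isolate (b * b) (+ 4 * (a * c))))
      (∣m∣n⇒∣m-n P∣E (∣n⇒∣m*n (+ 4) (∣m⇒∣m*n c P∣a))))
      where
      isolate : ∀ x y → x + y - y ≡ x
      isolate = solve-∀

    P∣first? : Decidable (λ (z : Triple) → P ∣ proj₁ z)
    P∣first? (a , b , c) = P ∣? a

    P∣third? : Decidable (λ (z : Triple) → P ∣ third z)
    P∣third? (a , b , c) = P ∣? c

    -- Summing Zagier's identity over 0 ≤ j < p gives p³ F(D). The form Q(X + jY, pY) has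
    -- discriminant p² D and last coefficient Q(j, p); the power of p that divides all its
    -- coefficients depends on whether p and p² divide a.
    Y : Finite (λ (j , z) → j ℕ.< p × Crossing (+ j) P z)
    Y = dependent (λ j → proj₁ (constant j p 0<p)) (below p)

    value : ℕ × Triple → ℤ
    value (j , z) = Q (+ j) P z

    ∑Y : ∑ Y value ≡ P * (P * P * total)
    ∑Y = begin
      ∑ Y value
        ≡⟨ ∑-dependent (λ j → proj₁ (constant j p 0<p)) (below p) value ⟩
      ∑ (below p) (λ j → ∑ (proj₁ (constant j p 0<p)) (Q (+ j) P))
        ≡⟨ ∑-cong (below p) (λ j _ → proj₂ (constant j p 0<p)) ⟩
      ∑ (below p) (λ _ → P * P * total)
        ≡⟨ ∑-below-const p (P * P * total) ⟩
      P * (P * P * total) ∎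

    Y∣  = Y ∩ λ (j , a , b , c) → P ∣? a
    Y∤  = Y ∩ λ (j , a , b , c) → ¬? (P ∣? a)
    Y∣∣ = Y∣ ∩ λ (j , a , b , c) → P * P ∣? a
    Y∣∤ = Y∣ ∩ λ (j , a , b , c) → ¬? (P * P ∣? a)

    S∣  = S ∩ P∣first?
    S∤  = S ∩ λ z → ¬? (P∣first? z)
    S∣ᶜ = S ∩ P∣third?
    S∤ᶜ = S ∩ λ z → ¬? (P∣third? z)

    S′∤  = S′ ∩ λ z → ¬? (P∣first? z)
    S′∣  = S′ ∩ P∣first?
    S′∣∣ = S′∣ ∩ P∣third?
    S′∣∤ = S′∣ ∩ λ z → ¬? (P∣third? z)

    -- Passing to Q(X + jY, pY) keeps a, and a form (α, β, γ) of discriminant p² D with p ∤ α arises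
    -- from exactly one j, the one with p | β + 2αj.
    ∑Y∤ : ∑ Y∤ value ≡ ∑ S′∤ third
    ∑Y∤ = ∑-bij Y∤ S′∤ f to (λ {y} {z} → inj {y} {z}) surj (λ _ _ → refl)
      where
      f : ℕ × Triple → Triple
      f (j , a , b , c) = a , b * P - + 2 * a * + j , Q (+ j) P (a , b , c)

      disc : ∀ a b c j P → (b * P - + 2 * a * j) * (b * P - + 2 * a * j)
               + + 4 * (a * (- (a * (j * j)) + b * (j * P) + c * (P * P))) ≡ P * P * (b * b + + 4 * (a * c))
      disc = solve-∀

      to : ∀ {jz} → ((proj₁ jz ℕ.< p × Crossing (+ proj₁ jz) P (proj₂ jz)) × ¬ P ∣ proj₁ (proj₂ jz)) →
           Form 4 (P * P * D) (f jz) × ¬ P ∣ proj₁ (f jz)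
      to {j , a , b , c} ((_ , crossing pos eq) , P∤a) =
        form pos (trans (disc a b c (+ j) P) (cong (P * P *_) eq)) , P∤a

      restore : ∀ a b j P → b * P ≡ b * P - + 2 * a * j + + 2 * a * j
      restore = solve-∀

      same : ∀ {j a b c j′ a′ b′ c′} → ¬ P ∣ a → j ℕ.< p → j′ ℕ.< p → a ≡ a′ →
             b * P - + 2 * a * + j ≡ b′ * P - + 2 * a′ * + j′ →
             Q (+ j) P (a , b , c) ≡ Q (+ j′) P (a′ , b′ , c′) → (j , a , b , c) ≡ (j′ , a′ , b′ , c′)
      same {j} {a} {b} {c} {j′} {_} {b′} {c′} P∤a j<p j′<p refl eqb eqc
        = sameRoot (root-unique {a} {b * P - + 2 * a * + j} {j} {j′} P∤a j<p j′<p
            (divides b (sym (restore a b (+ j) P)))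
            (divides b′ (trans (cong (_+ + 2 * a * + j′) eqb) (sym (restore a b′ (+ j′) P))))) eqb eqc
        where
        sameLast : Q (+ j) P (a , b , c) ≡ Q (+ j) P (a , b , c′) → c ≡ c′
        sameLast eqc = cancel-P² (begin
          P * P * c      ≡⟨ ℤ.*-comm (P * P) c ⟩
          c * (P * P)    ≡⟨ +-cancelˡ-≡ (- (a * (+ j * + j)) + b * (+ j * P)) {c * (P * P)} {c′ * (P * P)} eqc ⟩
          c′ * (P * P)   ≡⟨ ℤ.*-comm c′ (P * P) ⟩
          P * P * c′     ∎)
        sameMiddle : b ≡ b′ → Q (+ j) P (a , b , c) ≡ Q (+ j) P (a , b′ , c′) → (j , a , b , c) ≡ (j , a , b′ , c′)
        sameMiddle refl eqc = cong (λ c → j , a , b , c) (sameLast eqc)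
        sameRoot : j ≡ j′ → b * P - + 2 * a * + j ≡ b′ * P - + 2 * a * + j′ →
                   Q (+ j) P (a , b , c) ≡ Q (+ j′) P (a , b′ , c′) → (j , a , b , c) ≡ (j′ , a , b′ , c′)
        sameRoot refl eqb = sameMiddle (ℤ.*-cancelʳ-≡ b b′ P (+-cancelʳ-≡ (- (+ 2 * a * + j)) {b * P} {b′ * P} eqb))

      inj : ∀ {y z} → ((proj₁ y ℕ.< p × Crossing (+ proj₁ y) P (proj₂ y)) × ¬ P ∣ proj₁ (proj₂ y)) →
            ((proj₁ z ℕ.< p × Crossing (+ proj₁ z) P (proj₂ z)) × ¬ P ∣ proj₁ (proj₂ z)) → f y ≡ f z → y ≡ z
      inj ((j<p , _) , P∤a) ((j′<p , _) , _) eq =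
        same P∤a j<p j′<p (cong proj₁ eq) (cong (λ z → proj₁ (proj₂ z)) eq) (cong third eq)

      complete-square : ∀ α γ b j P → + 4 * α * (γ + α * (j * j) - b * (j * P)) ≡
        (b * P - + 2 * α * j) * (b * P - + 2 * α * j) + + 4 * (α * γ) - P * P * (b * b)
      complete-square = solve-∀

      factor : ∀ P D b → P * P * D - P * P * (b * b) ≡ P * P * (D - b * b)
      factor = solve-∀

      isolate : ∀ x y → x ≡ x + y - y
      isolate = solve-∀

      evaluate : ∀ α γ b j P c → γ + α * (j * j) - b * (j * P) ≡ P * P * c →
                 γ ≡ - (α * (j * j)) + b * (j * P) + c * (P * P)
      evaluate α γ b j P c eq = trans (rearrange α γ b j P) (trans (cong (λ t → - (α * (j * j)) + b * (j * P) + t) eq)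
        (cong (λ t → - (α * (j * j)) + b * (j * P) + t) (ℤ.*-comm (P * P) c)))
        where
        rearrange : ∀ α γ b j P → γ ≡ - (α * (j * j)) + b * (j * P) + (γ + α * (j * j) - b * (j * P))
        rearrange = solve-∀

      surj : ∀ {z} → Form 4 (P * P * D) z × ¬ P ∣ proj₁ z →
             ∃ λ jz → ((proj₁ jz ℕ.< p × Crossing (+ proj₁ jz) P (proj₂ jz)) × ¬ P ∣ proj₁ (proj₂ jz)) × f jz ≡ z
      surj {α , β , γ} (form (0<α , 0<γ) eq , P∤α) = (j , α , b , c) , ((j<p , crossing (0<α , subst (0ℤ <_) γ≡ 0<γ) disc-D) , P∤α) ,
        cong₂ (λ β γ → α , β , γ) (sym β≡) (sym γ≡)
        where
        j   = proj₁ (root α β P∤α)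
        j<p = proj₁ (proj₂ (root α β P∤α))
        b   = _∣_.quotient (proj₂ (proj₂ (root α β P∤α)))
        β≡ : β ≡ b * P - + 2 * α * + j
        β≡ = trans (isolate β (+ 2 * α * + j)) (cong (_- + 2 * α * + j) (_∣_.equality (proj₂ (proj₂ (root α β P∤α)))))
        -- Completing the square gives 4α X = p² (D - b²), and 4α is prime to p, so X = p² c; this c
        -- is the last coefficient sought.
        X = γ + α * (+ j * + j) - b * (+ j * P)
        4αX : + 4 * α * X ≡ P * P * (D - b * b)
        4αX = trans (complete-square α γ b (+ j) P) (trans (cong (_- P * P * (b * b))
          (trans (cong (λ t → t * t + + 4 * (α * γ)) (sym β≡)) eq)) (factor P D b))
        c  = proj₁ (square-factor {+ 4 * α} {X} {D - b * b} (P∤* P∤4 P∤α) 4αX)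
        X≡ : X ≡ P * P * c
        X≡ = proj₂ (square-factor {+ 4 * α} {X} {D - b * b} (P∤* P∤4 P∤α) 4αX)
        γ≡ : γ ≡ Q (+ j) P (α , b , c)
        γ≡ = evaluate α γ b (+ j) P c X≡
        disc-D : b * b + + 4 * (α * c) ≡ D
        disc-D = cancel-P² (begin
          P * P * (b * b + + 4 * (α * c))                   ≡⟨ disc α b c (+ j) P ⟨
          (b * P - + 2 * α * + j) * (b * P - + 2 * α * + j)
            + + 4 * (α * (- (α * (+ j * + j)) + b * (+ j * P) + c * (P * P)))
                                                            ≡⟨ cong₂ (λ β γ → β * β + + 4 * (α * γ)) β≡ γ≡ ⟨
          β * β + + 4 * (α * γ)                             ≡⟨ eq ⟩
          P * P * D                                         ∎)

    -- With a = p a₁, every coefficient of Q(X + jY, pY) is divisible by p, and the quotient form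
    -- has discriminant D and first coefficient a₁. As p | D and p | a force p | b, the new middle
    -- coefficient b₁ = b - 2 a₁ j determines j through p | b₁ + 2 a₁ j.
    ∑Y∣∤ : ∑ Y∣∤ value ≡ P * ∑ S∤ third
    ∑Y∣∤ = trans (∑-bij Y∣∤ S∤ f (λ {y} → to {y}) (λ {y} {z} → inj {y} {z}) surj weigh) (∑-* P S∤ third)
      where
      g : ℤ → ℕ × Triple → Triple
      g a₁ (j , a , b , c) = a₁ , b - + 2 * a₁ * + j , - (a₁ * (+ j * + j)) + b * + j + c * P

      f : ℕ × Triple → Triple
      f jz = g (div (proj₁ (proj₂ jz))) jz

      first : ℕ × Triple → ℤ
      first jz = proj₁ (proj₂ jz)

      Source : ℕ × Triple → Set
      Source jz = ((proj₁ jz ℕ.< p × Crossing (+ proj₁ jz) P (proj₂ jz)) × P ∣ first jz) × ¬ P * P ∣ first jz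

      f≡g : ∀ {jz a₁} → Source jz → first jz ≡ a₁ * P → f jz ≡ g a₁ jz
      f≡g {jz} {a₁} (((_ , crossing (0<a , _) _) , _) , _) eq = cong (λ a → g a jz)
        (trans (cong div eq) (div-* (*-pos⁻ 0<P (subst (0ℤ <_) eq 0<a))))

      scaled : ∀ a₁ j b c P → - (a₁ * P * (j * j)) + b * (j * P) + c * (P * P) ≡ P * (- (a₁ * (j * j)) + b * j + c * P)
      scaled = solve-∀

      value≡ : ∀ jz a₁ → first jz ≡ a₁ * P → value jz ≡ P * third (g a₁ jz)
      value≡ (j , _ , b , c) a₁ refl = scaled a₁ (+ j) b c P

      weigh : ∀ jz → Source jz → value jz ≡ P * third (f jz)
      weigh jz s@((_ , divides a₁ eq) , _) = trans (value≡ jz a₁ eq) (cong (λ z → P * third z) (sym (f≡g {jz} {a₁} s eq)))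

      disc : ∀ a₁ j b c P → (b - + 2 * a₁ * j) * (b - + 2 * a₁ * j) + + 4 * (a₁ * (- (a₁ * (j * j)) + b * j + c * P)) ≡
             b * b + + 4 * (a₁ * P * c)
      disc = solve-∀

      to-g : ∀ jz a₁ → first jz ≡ a₁ * P → Source jz → Form 4 D (g a₁ jz) × ¬ P ∣ a₁
      to-g jz@(j , _ , b , c) a₁ refl (((_ , crossing (0<a , 0<Q) eq) , _) , P²∤a) =
        form (*-pos⁻ 0<P 0<a , *-pos⁻ {third (g a₁ jz)} 0<P (subst (0ℤ <_) (trans (value≡ jz a₁ refl) (ℤ.*-comm P (third (g a₁ jz)))) 0<Q))
             (trans (disc a₁ (+ j) b c P) eq) ,
        λ { (divides k refl) → P²∤a (divides k (ℤ.*-assoc k P P)) }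

      to : ∀ {jz} → Source jz → Form 4 D (f jz) × ¬ P ∣ proj₁ (f jz)
      to {jz} s@((_ , divides a₁ eq) , _) = subst (λ z → Form 4 D z × ¬ P ∣ proj₁ z) (sym (f≡g {jz} {a₁} s eq)) (to-g jz a₁ eq s)

      P∣middle : ∀ {jz} → Source jz → P ∣ proj₁ (proj₂ (proj₂ jz))
      P∣middle {_ , a , b , c} (((_ , crossing _ eq) , P∣a) , _) = middle-divisible {a} {b} {c} p∣D eq P∣a

      restore : ∀ b t → b ≡ b - t + t
      restore = solve-∀

      same : ∀ {j a b c j′ a′ b′ c′ a₁ a₁′} → ¬ P ∣ a₁ → j ℕ.< p → j′ ℕ.< p → P ∣ b → P ∣ b′ →
             a ≡ a₁ * P → a′ ≡ a₁′ * P → g a₁ (j , a , b , c) ≡ g a₁′ (j′ , a′ , b′ , c′) →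
             (j , a , b , c) ≡ (j′ , a′ , b′ , c′)
      same {j} {a} {b} {c} {j′} {a′} {b′} {c′} {a₁} {a₁′} P∤a₁ j<p j′<p P∣b P∣b′ refl refl eq =
        go (cong proj₁ eq) (cong (λ z → proj₁ (proj₂ z)) eq) (cong third eq)
        where
        go : a₁ ≡ a₁′ → b - + 2 * a₁ * + j ≡ b′ - + 2 * a₁′ * + j′ →
             - (a₁ * (+ j * + j)) + b * + j + c * P ≡ - (a₁′ * (+ j′ * + j′)) + b′ * + j′ + c′ * P →
             (j , a , b , c) ≡ (j′ , a′ , b′ , c′)
        go refl eqb eqc = sameRoot (root-unique {a₁} {b - + 2 * a₁ * + j} {j} {j′} P∤a₁ j<p j′<p
            (subst (P ∣_) (restore b (+ 2 * a₁ * + j)) P∣b)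
            (subst (P ∣_) (trans (restore b′ (+ 2 * a₁ * + j′)) (cong (_+ + 2 * a₁ * + j′) (sym eqb))) P∣b′)) eqb eqc
          where
          sameMiddle : b ≡ b′ → - (a₁ * (+ j * + j)) + b * + j + c * P ≡ - (a₁ * (+ j * + j)) + b′ * + j + c′ * P →
                       (j , a₁ * P , b , c) ≡ (j , a₁ * P , b′ , c′)
          sameMiddle refl eqc = cong (λ c → j , a₁ * P , b , c) (ℤ.*-cancelʳ-≡ c c′ P
            (+-cancelˡ-≡ (- (a₁ * (+ j * + j)) + b * + j) {c * P} {c′ * P} eqc))
          sameRoot : j ≡ j′ → b - + 2 * a₁ * + j ≡ b′ - + 2 * a₁ * + j′ →
                     - (a₁ * (+ j * + j)) + b * + j + c * P ≡ - (a₁ * (+ j′ * + j′)) + b′ * + j′ + c′ * P →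
                     (j , a₁ * P , b , c) ≡ (j′ , a₁ * P , b′ , c′)
          sameRoot refl eqb = sameMiddle (+-cancelʳ-≡ (- (+ 2 * a₁ * + j)) {b} {b′} eqb)

      inj : ∀ {y z} → Source y → Source z → f y ≡ f z → y ≡ z
      inj {y} {z} s@(((j<p , _) , divides a₁ eq) , _) s′@(((j′<p , _) , divides a₁′ eq′) , _) fy≡fz =
        same {a₁ = a₁} {a₁′} (proj₂ (to-g y a₁ eq s)) j<p j′<p (P∣middle {y} s) (P∣middle {z} s′) eq eq′
          (trans (sym (f≡g {y} {a₁} s eq)) (trans fy≡fz (f≡g {z} {a₁′} s′ eq′)))

      complete-square : ∀ a b c j → + 4 * a * (c - b * j - a * (j * j)) ≡
                        (b * b + + 4 * (a * c)) - (b + + 2 * a * j) * (b + + 2 * a * j)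
      complete-square = solve-∀

      surj : ∀ {z} → Form 4 D z × ¬ P ∣ proj₁ z → ∃ λ jz → Source jz × f jz ≡ z
      surj {a₁ , b₁ , c₁} (form (0<a₁ , 0<c₁) eq , P∤a₁) = jz , source ,
        trans (f≡g {jz} {a₁} source refl) (cong₂ (λ b c → a₁ , b , c) (sym (restore′ b₁ (+ 2 * a₁ * + j))) (sym c₁≡))
        where
        r   = root a₁ b₁ P∤a₁
        j   = proj₁ r
        b   = b₁ + + 2 * a₁ * + j
        X   = c₁ - b₁ * + j - a₁ * (+ j * + j)
        P∣X : P ∣ X
        P∣X = P∣m*x⇒P∣x {+ 4 * a₁} {X} (P∤* P∤4 P∤a₁)
          (subst (P ∣_) (trans (cong (_- b * b) (sym eq)) (sym (complete-square a₁ b₁ c₁ (+ j))))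
            (∣m∣n⇒∣m-n p∣D (∣m⇒∣m*n b (proj₂ (proj₂ r)))))
        c   = _∣_.quotient P∣X
        jz : ℕ × Triple
        jz  = j , a₁ * P , b , c
        restore′ : ∀ b t → b ≡ b + t - t
        restore′ = solve-∀
        evaluate : ∀ a b c j → c ≡ - (a * (j * j)) + (b + + 2 * a * j) * j + (c - b * j - a * (j * j))
        evaluate = solve-∀
        c₁≡ : c₁ ≡ third (g a₁ jz)
        c₁≡ = trans (evaluate a₁ b₁ c₁ (+ j)) (cong (λ t → - (a₁ * (+ j * + j)) + b * + j + t) (_∣_.equality P∣X))
        source : Source jz
        source = ((proj₁ (proj₂ r) , crossing (*-pos 0<a₁ 0<P , subst (0ℤ <_) (sym (value≡ jz a₁ refl)) (*-pos 0<P (subst (0ℤ <_) c₁≡ 0<c₁)))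
            (trans (sym (disc a₁ (+ j) b c P)) (trans (cong₂ (λ b c → b * b + + 4 * (a₁ * c)) (sym (restore′ b₁ (+ 2 * a₁ * + j))) (sym c₁≡)) eq)))
          , divides a₁ refl) ,
          λ { (divides k e) → P∤a₁ (divides k (ℤ.*-cancelʳ-≡ a₁ (k * P) P (trans e (sym (ℤ.*-assoc k P P))))) }

    -- Now p² | a and p | b, so Q(X + jY, pY) is p² times a form of discriminant D / p². The inverse
    -- substitution is integral for every j, so each such form occurs p times.
    ∑Y∣∣ : ∑ Y∣∣ value ≡ P * (P * P * ∑ S″ third)
    ∑Y∣∣ = begin
      ∑ Y∣∣ value
        ≡⟨ ∑-bij Z Y∣∣ f to (λ {y} {z} → inj {y} {z}) surj (λ { (j , a , b , c) _ → sym (evaluate a b c (+ j) P) }) ⟨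
      ∑ Z (λ (j , z) → P * P * third z)
        ≡⟨ ∑-dependent (λ _ → S″) (below p) _ ⟩
      ∑ (below p) (λ _ → ∑ S″ (λ z → P * P * third z))
        ≡⟨ ∑-below-const p _ ⟩
      P * ∑ S″ (λ z → P * P * third z)
        ≡⟨ cong (P *_) (∑-* (P * P) S″ third) ⟩
      P * (P * P * ∑ S″ third) ∎
      where
      Z : Finite (λ (j , z) → j ℕ.< p × DividedForm (P * P) D z)
      Z = dependent (λ _ → S″) (below p)

      f : ℕ × Triple → ℕ × Triple
      f (j , a , b , c) = j , P * P * a , P * b + + 2 * P * a * + j , c - b * + j - a * (+ j * + j)

      Target : ℕ × Triple → Set
      Target jz = ((proj₁ jz ℕ.< p × Crossing (+ proj₁ jz) P (proj₂ jz)) × P ∣ proj₁ (proj₂ jz)) × P * P ∣ proj₁ (proj₂ jz)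

      evaluate : ∀ a b c j P → - (P * P * a * (j * j)) + (P * b + + 2 * P * a * j) * (j * P)
                   + (c - b * j - a * (j * j)) * (P * P) ≡ P * P * c
      evaluate = solve-∀

      disc : ∀ a b c j P → (P * b + + 2 * P * a * j) * (P * b + + 2 * P * a * j) + + 4 * (P * P * a * (c - b * j - a * (j * j))) ≡
             P * P * (b * b + + 4 * (a * c))
      disc = solve-∀

      0<P² : 0ℤ < P * P
      0<P² = *-pos 0<P 0<P

      to : ∀ {jz} → (proj₁ jz ℕ.< p × DividedForm (P * P) D (proj₂ jz)) → Target (f jz)
      to {j , a , b , c} (j<p , form (0<a , 0<c) eq) =
        ((j<p , crossing (*-pos 0<P² 0<a , subst (0ℤ <_) (sym (evaluate a b c (+ j) P)) (*-pos 0<P² 0<c))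
                  (trans (disc a b c (+ j) P) eq))
        , P∣P*P* a) , divides a (ℤ.*-comm (P * P) a)

      same : ∀ {j a b c j′ a′ b′ c′} → j ≡ j′ → P * P * a ≡ P * P * a′ → P * b + + 2 * P * a * + j ≡ P * b′ + + 2 * P * a′ * + j′ →
             c - b * + j - a * (+ j * + j) ≡ c′ - b′ * + j′ - a′ * (+ j′ * + j′) → (j , a , b , c) ≡ (j′ , a′ , b′ , c′)
      same {j} {a} {b} {c} {_} {a′} {b′} {c′} refl eqa = sameFirst (cancel-P² {a} {a′} eqa)
        where
        sameMiddle : b ≡ b′ → c - b * + j - a * (+ j * + j) ≡ c′ - b′ * + j - a * (+ j * + j) → (j , a , b , c) ≡ (j , a , b′ , c′)
        sameMiddle refl eqc = cong (λ c → j , a , b , c) (+-cancelʳ-≡ (- (b * + j)) {c} {c′}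
          (+-cancelʳ-≡ (- (a * (+ j * + j))) {c - b * + j} {c′ - b * + j} eqc))
        sameFirst : a ≡ a′ → P * b + + 2 * P * a * + j ≡ P * b′ + + 2 * P * a′ * + j →
                    c - b * + j - a * (+ j * + j) ≡ c′ - b′ * + j - a′ * (+ j * + j) → (j , a , b , c) ≡ (j , a′ , b′ , c′)
        sameFirst refl eqb = sameMiddle (ℤ.*-cancelˡ-≡ P b b′ (+-cancelʳ-≡ (+ 2 * P * a * + j) {P * b} {P * b′} eqb))

      inj : ∀ {y z} → (proj₁ y ℕ.< p × DividedForm (P * P) D (proj₂ y)) → (proj₁ z ℕ.< p × DividedForm (P * P) D (proj₂ z)) →
            f y ≡ f z → y ≡ z
      inj _ _ eq = same (cong proj₁ eq) (cong (λ z → proj₁ (proj₂ z)) eq) (cong (λ z → proj₁ (proj₂ (proj₂ z))) eq)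
        (cong (λ z → third (proj₂ z)) eq)

      surj : ∀ {jz} → Target jz → ∃ λ y → (proj₁ y ℕ.< p × DividedForm (P * P) D (proj₂ y)) × f y ≡ jz
      surj {j , a , b , c} (((j<p , crossing (0<a , 0<Q) eq) , P∣a) , divides a₃ a≡) = (j , a₃ , b₃ , c₃) ,
        (j<p , form (*-pos⁻ 0<P² (subst (0ℤ <_) a≡ 0<a) ,
            *-pos⁻ 0<P² (subst (0ℤ <_) (trans (cong (λ z → Q (+ j) P (proj₂ z)) (sym f≡)) (trans (evaluate a₃ b₃ c₃ (+ j) P) (ℤ.*-comm (P * P) c₃))) 0<Q))
          (trans (sym (disc a₃ b₃ c₃ (+ j) P)) (trans (cong discriminant f≡) eq))) ,
        f≡
        where
        P∣b : P ∣ b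
        P∣b = middle-divisible {a} {b} {c} p∣D eq P∣a
        b₁ = _∣_.quotient P∣b
        b₃ = b₁ - + 2 * a₃ * + j
        c₃ = c + b₃ * + j + a₃ * (+ j * + j)
        discriminant : ℕ × Triple → ℤ
        discriminant (_ , a , b , c) = b * b + + 4 * (a * c)
        middle : ∀ b a j P → P * (b - + 2 * a * j) + + 2 * P * a * j ≡ b * P
        middle = solve-∀
        last : ∀ c x y → c + x + y - x - y ≡ c
        last = solve-∀
        f≡ : f (j , a₃ , b₃ , c₃) ≡ (j , a , b , c)
        f≡ = cong₂ (λ a (b , c) → j , a , b , c) (trans (ℤ.*-comm (P * P) a₃) (sym a≡))
          (cong₂ _,_ (trans (middle b₁ a₃ (+ j) P) (sym (_∣_.equality P∣b))) (last c (b₃ * + j) (a₃ * (+ j * + j))))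

    -- p | α forces p | β, hence p² | 4αγ and, as p ∤ γ, p² | α. These are the forms Q(pX, Y) with Q
    -- of discriminant D, which leaves the last coefficient unchanged.
    ∑S′∣∤ : ∑ S′∣∤ third ≡ ∑ S∤ᶜ third
    ∑S′∣∤ = sym (∑-bij S∤ᶜ S′∣∤ f to (λ {y} {z} → inj {y} {z}) surj (λ _ _ → refl))
      where
      f : Triple → Triple
      f (a , b , c) = P * P * a , P * b , c
      disc : ∀ a b c P → P * b * (P * b) + + 4 * (P * P * a * c) ≡ P * P * (b * b + + 4 * (a * c))
      disc = solve-∀
      to : ∀ {z} → Form 4 D z × ¬ P ∣ third z → (Form 4 (P * P * D) (f z) × P ∣ proj₁ (f z)) × ¬ P ∣ third z
      to {a , b , c} (form (0<a , 0<c) eq , P∤c) =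
        (form (*-pos (*-pos 0<P 0<P) 0<a , 0<c) (trans (disc a b c P) (cong (P * P *_) eq)) , P∣P*P* a) , P∤c
      same : ∀ {a b c a′ b′ c′} → P * P * a ≡ P * P * a′ → P * b ≡ P * b′ → c ≡ c′ → (a , b , c) ≡ (a′ , b′ , c′)
      same {a} {b} {c} {a′} {b′} eqa eqb refl = cong₂ (λ a b → a , b , c) (cancel-P² {a} {a′} eqa) (ℤ.*-cancelˡ-≡ P b b′ eqb)
      inj : ∀ {y z} → Form 4 D y × ¬ P ∣ third y → Form 4 D z × ¬ P ∣ third z → f y ≡ f z → y ≡ z
      inj _ _ eq = same (cong proj₁ eq) (cong (λ z → proj₁ (proj₂ z)) eq) (cong third eq)
      surj : ∀ {z} → (Form 4 (P * P * D) z × P ∣ proj₁ z) × ¬ P ∣ third z →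
             ∃ λ y → (Form 4 D y × ¬ P ∣ third y) × f y ≡ z
      surj {α , β , γ} ((form (0<α , 0<γ) eq , P∣α@(divides α₁ refl)) , P∤γ) = (a , b , γ) ,
        (form (*-pos⁻ 0<P (*-pos⁻ 0<P (subst (λ t → 0ℤ < t * P) (_∣_.equality P∣α₁) 0<α)) , 0<γ)
          (cancel-P² (trans (sym (disc a b γ P)) (trans (cong₂ (λ α β → β * β + + 4 * (α * γ)) (sym α≡) (sym β≡)) eq))) , P∤γ) ,
        cong₂ (λ α β → α , β , γ) (sym α≡) (sym β≡)
        where
        P∣β : P ∣ β
        P∣β = middle-divisible {α} {β} {γ} (P∣P*P* D) eq P∣α
        b = _∣_.quotient P∣β
        β≡ : β ≡ P * b
        β≡ = trans (_∣_.equality P∣β) (ℤ.*-comm b P)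
        isolate : ∀ α₁ γ b P → + 4 * γ * α₁ * P ≡ (P * b * (P * b) + + 4 * (α₁ * P * γ)) - P * P * (b * b)
        isolate = solve-∀
        factor : ∀ D b P → P * P * D - P * P * (b * b) ≡ P * (D - b * b) * P
        factor = solve-∀
        P∣α₁ : P ∣ α₁
        P∣α₁ = P∣m*x⇒P∣x {+ 4 * γ} {α₁} (P∤* P∤4 P∤γ) (divides (D - b * b)
          (trans (ℤ.*-cancelʳ-≡ (+ 4 * γ * α₁) (P * (D - b * b)) P (trans (isolate α₁ γ b P)
            (trans (cong (_- P * P * (b * b)) (trans (cong (λ β → β * β + + 4 * (α₁ * P * γ)) (sym β≡)) eq)) (factor D b P))))
            (ℤ.*-comm P (D - b * b))))
        a = _∣_.quotient P∣α₁
        square : ∀ a P → a * P * P ≡ P * P * a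
        square = solve-∀
        α≡ : α₁ * P ≡ P * P * a
        α≡ = trans (cong (_* P) (_∣_.equality P∣α₁)) (square a P)

    -- p | α forces p | β, so p divides all coefficients: these are the multiples pQ of the forms Q
    -- of discriminant D.
    ∑S′∣∣ : ∑ S′∣∣ third ≡ P * total
    ∑S′∣∣ = trans (sym (∑-bij S S′∣∣ f to (λ {y} {z} → inj {y} {z}) surj (λ _ _ → refl))) (∑-* P S third)
      where
      f : Triple → Triple
      f (a , b , c) = P * a , P * b , P * c
      disc : ∀ a b c P → P * b * (P * b) + + 4 * (P * a * (P * c)) ≡ P * P * (b * b + + 4 * (a * c))
      disc = solve-∀
      P∣P* : ∀ x → P ∣ P * x
      P∣P* x = ∣m⇒∣m*n {P} {P} x ∣-refl
      to : ∀ {z} → Form 4 D z → (Form 4 (P * P * D) (f z) × P ∣ proj₁ (f z)) × P ∣ third (f z)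
      to {a , b , c} (form (0<a , 0<c) eq) =
        (form (*-pos 0<P 0<a , *-pos 0<P 0<c) (trans (disc a b c P) (cong (P * P *_) eq)) , P∣P* a) , P∣P* c
      same : ∀ {a b c a′ b′ c′} → P * a ≡ P * a′ → P * b ≡ P * b′ → P * c ≡ P * c′ → (a , b , c) ≡ (a′ , b′ , c′)
      same {a} {b} {c} {a′} {b′} {c′} eqa eqb eqc = cong₂ _,_ (ℤ.*-cancelˡ-≡ P a a′ eqa)
        (cong₂ _,_ (ℤ.*-cancelˡ-≡ P b b′ eqb) (ℤ.*-cancelˡ-≡ P c c′ eqc))
      inj : ∀ {y z} → Form 4 D y → Form 4 D z → f y ≡ f z → y ≡ z
      inj _ _ eq = same (cong proj₁ eq) (cong (λ z → proj₁ (proj₂ z)) eq) (cong third eq)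
      surj : ∀ {z} → (Form 4 (P * P * D) z × P ∣ proj₁ z) × P ∣ third z → ∃ λ y → Form 4 D y × f y ≡ z
      surj {α , β , γ} ((form (0<α , 0<γ) eq , P∣α@(divides a refl)) , divides c refl) = (a , b , c) ,
        form (*-pos⁻ 0<P 0<α , *-pos⁻ 0<P 0<γ)
          (cancel-P² (trans (sym (disc a b c P)) (trans (cong (λ (α , β , γ) → β * β + + 4 * (α * γ)) f≡) eq))) , f≡
        where
        P∣β : P ∣ β
        P∣β = middle-divisible {α} {β} {γ} (P∣P*P* D) eq P∣α
        b = _∣_.quotient P∣β
        f≡ : f (a , b , c) ≡ (α , β , γ)
        f≡ = cong₂ _,_ (ℤ.*-comm P a)
          (cong₂ _,_ (trans (ℤ.*-comm P b) (sym (_∣_.equality P∣β))) (ℤ.*-comm P c))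

    -- (p a , b , c) and (a , b , p c) have the same discriminant.
    ∑S∣ᶜ : ∑ S∣ᶜ third ≡ P * ∑ S∣ third
    ∑S∣ᶜ = trans (sym (∑-bij S∣ S∣ᶜ f to inj surj (λ _ _ → refl))) (∑-* P S∣ third)
      where
      f : Triple → Triple
      f (a , b , c) = div a , b , P * c
      disc : ∀ a b c P → b * b + + 4 * (a * (P * c)) ≡ b * b + + 4 * (a * P * c)
      disc = solve-∀
      to : ∀ {z} → Form 4 D z × P ∣ proj₁ z → Form 4 D (f z) × P ∣ third (f z)
      to {_ , b , c} (form (0<a , 0<c) eq , divides a refl) =
        form (subst (0ℤ <_) (sym (div-* 0<a′)) 0<a′ , *-pos 0<P 0<c)
          (trans (cong (λ a → b * b + + 4 * (a * (P * c))) (div-* 0<a′)) (trans (disc a b c P) eq)) ,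
        ∣m⇒∣m*n {P} {P} c ∣-refl
        where
        0<a′ : 0ℤ < a
        0<a′ = *-pos⁻ 0<P 0<a
      same : ∀ {a b c a′ b′ c′} → a ≡ a′ → b ≡ b′ → P * c ≡ P * c′ → (a * P , b , c) ≡ (a′ * P , b′ , c′)
      same {a} {b} {c} {_} {_} {c′} refl refl eqc = cong (λ c → a * P , b , c) (ℤ.*-cancelˡ-≡ P c c′ eqc)
      inj : ∀ {y z} → Form 4 D y × P ∣ proj₁ y → Form 4 D z × P ∣ proj₁ z → f y ≡ f z → y ≡ z
      inj {_ , b , c} {_ , b′ , c′} (form (0<a , _) _ , divides a refl) (form (0<a′ , _) _ , divides a′ refl) eq =
        same {a} {b} {c} {a′} {b′} {c′} (trans (sym (div-* (*-pos⁻ 0<P 0<a))) (trans (cong proj₁ eq) (div-* (*-pos⁻ 0<P 0<a′))))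
          (cong (λ z → proj₁ (proj₂ z)) eq) (cong third eq)
      surj : ∀ {z} → Form 4 D z × P ∣ third z → ∃ λ y → (Form 4 D y × P ∣ proj₁ y) × f y ≡ z
      surj {a , b , _} (form (0<a , 0<c) eq , divides c refl) = (a * P , b , c) ,
        (form (*-pos 0<a 0<P , *-pos⁻ 0<P 0<c)
          (trans (sym (disc a b c P)) (trans (cong (λ c → b * b + + 4 * (a * c)) (ℤ.*-comm P c)) eq)) , divides a refl) ,
        cong₂ (λ a c → a , b , c) (div-* 0<a) (ℤ.*-comm P c)

    -- Write F(D) = a + a′ = c + c′, where a, a′ sum over the forms whose first coefficient is or is
    -- not divisible by p, and c, c′ likewise for the last coefficient. Besides p³ F(D), the pieces
    -- leave p F(D) + c′ - p a′ = p a + c′, which is c + c′ = F(D) by `∑S∣ᶜ`.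
    hecke : ∑ S′ third + P * (P * P * ∑ S″ third) ≡ (P * P * P + 1ℤ) * total
    hecke = combine P total (∑ S∣ third) (∑ S∤ third) (∑ S∣ᶜ third) (∑ S∤ᶜ third) (∑ S″ third) (∑ S′∤ third) (∑ S′ third)
      (∑-∩ S P∣third? S∤ᶜ third)
      (∑-∩ S P∣first? S∤ third)
      ∑S∣ᶜ
      (trans (sym ∑Y) (trans (∑-∩ Y (λ (j , a , b , c) → P ∣? a) Y∤ value)
        (cong₂ _+_ (trans (∑-∩ Y∣ (λ (j , a , b , c) → P * P ∣? a) Y∣∤ value) (cong₂ _+_ ∑Y∣∣ ∑Y∣∤)) ∑Y∤)))
      (trans (∑-∩ S′ P∣first? S′∤ third) (cong (_+ ∑ S′∤ third)
        (trans (∑-∩ S′∣ P∣third? S′∣∤ third) (cong₂ _+_ ∑S′∣∣ ∑S′∣∤))))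
      where
      combine : ∀ P T a a′ c c′ r n t → T ≡ c + c′ → T ≡ a + a′ → c ≡ P * a →
                P * (P * P * T) ≡ P * (P * P * r) + P * a′ + n → t ≡ P * T + c′ + n →
                t + P * (P * P * r) ≡ (P * P * P + 1ℤ) * T
      combine P T a a′ c c′ r n t e₁ e₂ e₃ e₄ e₅ = begin
        t + P * (P * P * r)
          ≡⟨ cong (_+ P * (P * P * r)) e₅ ⟩
        P * T + c′ + n + P * (P * P * r)
          ≡⟨ regroup (P * T) c′ n (P * (P * P * r)) (P * a′) ⟩
        (P * (P * P * r) + P * a′ + n) + (P * T + c′ - P * a′)
          ≡⟨ cong₂ (λ x T′ → x + (P * T′ + c′ - P * a′)) (sym e₄) e₂ ⟩
        P * (P * P * T) + (P * (a + a′) + c′ - P * a′)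
          ≡⟨ cong (_+_ (P * (P * P * T))) (trans (simplify P a a′ c′) (trans (cong (_+ c′) (sym e₃)) (sym e₁))) ⟩
        P * (P * P * T) + T
          ≡⟨ factor P T ⟩
        (P * P * P + 1ℤ) * T ∎
        where
        regroup : ∀ x c n r y → x + c + n + r ≡ (r + y + n) + (x + c - y)
        regroup = solve-∀
        simplify : ∀ P a a′ c → P * (a + a′) + c - P * a′ ≡ P * a + c
        simplify = solve-∀
        factor : ∀ P T → P * (P * P * T) + T ≡ (P * P * P + 1ℤ) * T
        factor = solve-∀

-- From F to p̄(3n), and F along the discriminants p^(2k+1) M

module Congruence where

  open import Data.Integer.Base using (_+_; _*_; _<_) renaming (∣_∣ to abs)
  open import Data.Integer.Divisibility.Signed
    using (_∣_; divides; ∣⇒∣ᵤ; ∣ᵤ⇒∣; ∣m∣n⇒∣m+n; ∣m∣n⇒∣m-n; ∣m⇒∣m*n; ∣n⇒∣m*n; ∣-refl)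
  open import Data.Nat.DivMod using (_%_; _/_; m≡m%n+[m/n]*n)
  open import Data.Nat.Primality using (Prime)
  open FiniteSums
  open PowerSeries
  open Dilation
  open CubicDissection
  open OverpartitionSeries
  open HeckeAtThree
  open LiouvilleIdentity
  open FourSquares
  open BinaryForms
  open ThetaSeries
  open CrossingForms
  open ModPrime
  open HeckeRelation
  open ≡-Reasoning

  formSum : ℤ → ℤ
  formSum D = ∑ (forms 3 D) third

  sgn-cases : ∀ n → sgn n ≡ 1ℤ ⊎ sgn n ≡ -1ℤ
  sgn-cases zero    = inj₁ refl
  sgn-cases (suc n) = [ (λ e → inj₂ (cong -_ e)) , (λ e → inj₁ (cong -_ e)) ]′ (sgn-cases n)

  sgn-even : ∀ n → sgn n ≡ 1ℤ → ∃ λ m → n ≡ 2 ℕ.* m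
  sgn-even zero          _ = 0 , refl
  sgn-even (suc zero)    ()
  sgn-even (suc (suc n)) e = let m , n≡ = sgn-even n (trans (sym (ℤ.neg-involutive (sgn n))) e) in
    suc m , trans (cong (λ n → suc (suc n)) n≡) (sym (ℕ.*-suc 2 m))

  sgn-*-even : ∀ m n → sgn n ≡ 1ℤ → sgn (m ℕ.* n) ≡ 1ℤ
  sgn-*-even zero    n e = refl
  sgn-*-even (suc m) n e = trans (sgn-+ n (m ℕ.* n)) (cong₂ _*_ e (sgn-*-even m n e))

  sgn-*-odd : ∀ m n → sgn n ≡ -1ℤ → sgn (m ℕ.* n) ≡ sgn m
  sgn-*-odd zero    n e = refl
  sgn-*-odd (suc m) n e = trans (sgn-+ n (m ℕ.* n)) (trans (cong₂ _*_ e (sgn-*-odd m n e)) (ℤ.-1*i≡-i (sgn m)))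

  sgnᶻ-even : ∀ i → sgnᶻ i ≡ 1ℤ → ∃ λ j → i ≡ + 2 * j
  sgnᶻ-even (+ n)    e = let m , n≡ = sgn-even n e in + m , trans (cong +_ n≡) (ℤ.pos-* 2 m)
  sgnᶻ-even -[1+ n ] e = let m , n≡ = sgn-even (suc n) e in
    - + m , trans (cong (λ n → - + n) n≡) (trans (cong -_ (ℤ.pos-* 2 m)) (ℤ.neg-distribʳ-* (+ 2) (+ m)))

  sgnᶻ-*-even : ∀ i j → sgnᶻ j ≡ 1ℤ → sgnᶻ (i * j) ≡ 1ℤ
  sgnᶻ-*-even i j e = trans (cong sgn (ℤ.abs-* i j)) (sgn-*-even (abs i) (abs j) e)

  sgnᶻ-*-odd : ∀ i j → sgnᶻ j ≡ -1ℤ → sgnᶻ (i * j) ≡ sgnᶻ i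
  sgnᶻ-*-odd i j e = trans (cong sgn (ℤ.abs-* i j)) (sgn-*-odd (abs i) (abs j) e)

  sgnᶻ-square : ∀ i → sgnᶻ (i * i) ≡ sgnᶻ i
  sgnᶻ-square i = [ (λ e → trans (sgnᶻ-*-even i i e) (sym e)) , sgnᶻ-*-odd i i ]′ (sgn-cases (abs i))

  module _ (n : ℕ) where

    private
      T = forms 0 (+ n)

      -- (-1)^a (-1)^x equals (-1)^(ax) when a and x are both even and is its negative otherwise,
      -- while (-1)^n = (-1)^s (-1)^(ax). So the sign weight is (-1)^n on this class and -(-1)^n off
      -- it.
      BothEven : Triple → Set
      BothEven (a , s , x) = sgnᶻ a ≡ 1ℤ × sgnᶻ x ≡ 1ℤ

      bothEven? : Decidable BothEven
      bothEven? (a , s , x) = (sgnᶻ a ℤ.≟ 1ℤ) ×-dec (sgnᶻ x ℤ.≟ 1ℤ)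

      E = T ∩ bothEven?
      O = T ∩ λ z → ¬? (bothEven? z)

      first w : Triple → ℤ
      first (a , s , x) = a
      w (a , s , x) = sgnᶻ s * (sgnᶻ a * sgnᶻ x * a)

      sgn-n : ∀ {a s x} → s * s + + 1 * (a * x) ≡ + n → sgn n ≡ sgnᶻ s * sgnᶻ (a * x)
      sgn-n {a} {s} {x} eq = trans (cong sgnᶻ (sym eq)) (trans (sgnᶻ-+ (s * s) (+ 1 * (a * x)))
        (cong₂ (λ u v → u * sgnᶻ v) (sgnᶻ-square s) (ℤ.*-identityˡ (a * x))))

      w-even : ∀ z → Form 1 (+ n) z × BothEven z → w z ≡ sgn n * first z
      w-even (a , s , x) (form _ eq , a-even , x-even) = trans
        (cong₂ (λ A X → sgnᶻ s * (A * X * a)) a-even x-even)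
        (trans (collect (sgnᶻ s) a) (cong (_* a) (sym (trans (sgn-n {a} {s} {x} eq) (cong (sgnᶻ s *_) (sgnᶻ-*-even a x x-even))))))
        where
        collect : ∀ s a → s * (1ℤ * 1ℤ * a) ≡ s * 1ℤ * a
        collect = solve-∀

      w-odd : ∀ z → Form 1 (+ n) z × ¬ BothEven z → w z ≡ - sgn n * first z
      w-odd (a , s , x) (form _ eq , ¬even) = [ (λ A → [ (λ X → contradiction (A , X) ¬even) , even-odd A ]′ (sgn-cases (abs x)))
                                              , (λ A → [ odd-even A , odd-odd A ]′ (sgn-cases (abs x))) ]′ (sgn-cases (abs a))
        where
        finish : ∀ {A X} t → sgnᶻ a ≡ A → sgnᶻ x ≡ X → sgnᶻ (a * x) ≡ t →
                 sgnᶻ s * (A * X * a) ≡ - (sgnᶻ s * t) * a → w (a , s , x) ≡ - sgn n * a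
        finish t eA eX et e = trans (cong₂ (λ A X → sgnᶻ s * (A * X * a)) eA eX)
          (trans e (cong (λ t → - t * a) (sym (trans (sgn-n {a} {s} {x} eq) (cong (sgnᶻ s *_) et)))))
        +-sign : ∀ s a → s * (1ℤ * -1ℤ * a) ≡ - (s * 1ℤ) * a
        +-sign = solve-∀
        -+sign : ∀ s a → s * (-1ℤ * 1ℤ * a) ≡ - (s * 1ℤ) * a
        -+sign = solve-∀
        -²sign : ∀ s a → s * (-1ℤ * -1ℤ * a) ≡ - (s * -1ℤ) * a
        -²sign = solve-∀
        even-odd : sgnᶻ a ≡ 1ℤ → sgnᶻ x ≡ -1ℤ → w (a , s , x) ≡ - sgn n * a
        even-odd A X = finish 1ℤ A X (trans (sgnᶻ-*-odd a x X) A) (+-sign (sgnᶻ s) a)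
        odd-even : sgnᶻ a ≡ -1ℤ → sgnᶻ x ≡ 1ℤ → w (a , s , x) ≡ - sgn n * a
        odd-even A X = finish 1ℤ A X (sgnᶻ-*-even a x X) (-+sign (sgnᶻ s) a)
        odd-odd : sgnᶻ a ≡ -1ℤ → sgnᶻ x ≡ -1ℤ → w (a , s , x) ≡ - sgn n * a
        odd-odd A X = finish -1ℤ A X (trans (sgnᶻ-*-odd a x X) A) (-²sign (sgnᶻ s) a)

      -- Doubling s turns s² + ax = n into b² + 4ac = 4n, and every b in a solution of the latter is
      -- even.
      ∑T : ∑ T first ≡ formSum (+ (4 ℕ.* n))
      ∑T = ∑-bij T (forms 3 (+ (4 ℕ.* n))) f to inj surj (λ _ _ → refl)
        where
        f : Triple → Triple
        f (a , s , x) = x , + 2 * s , a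
        disc : ∀ a s x → + 2 * s * (+ 2 * s) + + 4 * (x * a) ≡ + 4 * (s * s + + 1 * (a * x))
        disc = solve-∀
        to : ∀ {z} → Form 1 (+ n) z → Form 4 (+ (4 ℕ.* n)) (f z)
        to {a , s , x} (form (0<a , 0<x) eq) =
          form (0<x , 0<a) (trans (disc a s x) (trans (cong (+ 4 *_) eq) (sym (ℤ.pos-* 4 n))))
        inj : ∀ {y z} → Form 1 (+ n) y → Form 1 (+ n) z → f y ≡ f z → y ≡ z
        inj {_ , s , _} {_ , t , _} _ _ eq = cong₂ (λ a (s , x) → a , s , x) (cong third eq)
          (cong₂ _,_ (ℤ.*-cancelˡ-≡ (+ 2) s t (cong (λ z → proj₁ (proj₂ z)) eq)) (cong proj₁ eq))
        isolate : ∀ b t → b * b ≡ (b * b + + 4 * t) - + 4 * t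
        isolate = solve-∀
        double : ∀ n t → + 4 * n - + 4 * t ≡ + 2 * (+ 2 * (n - t))
        double = solve-∀
        surj : ∀ {z} → Form 4 (+ (4 ℕ.* n)) z → ∃ λ y → Form 1 (+ n) y × f y ≡ z
        surj {c , b , a} (form (0<c , 0<a) eq) = (a , s , c) , form (0<a , 0<c) (ℤ.*-cancelˡ-≡ (+ 4) _ (+ n) (begin
            + 4 * (s * s + + 1 * (a * c))                  ≡⟨ disc a s c ⟨
            + 2 * s * (+ 2 * s) + + 4 * (c * a)            ≡⟨ cong (λ b → b * b + + 4 * (c * a)) b≡ ⟨
            b * b + + 4 * (c * a)                          ≡⟨ eq ⟩
            + (4 ℕ.* n)                                    ≡⟨ ℤ.pos-* 4 n ⟩
            + 4 * + n                                      ∎)) , cong (λ b → c , b , a) (sym b≡)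
          where
          b-even : sgnᶻ b ≡ 1ℤ
          b-even = trans (sym (sgnᶻ-square b)) (trans (cong sgnᶻ (trans (isolate b (c * a))
            (trans (cong (_- + 4 * (c * a)) (trans eq (ℤ.pos-* 4 n))) (double (+ n) (c * a)))))
            (sgnᶻ-double (+ 2 * (+ n - c * a))))
          s = proj₁ (sgnᶻ-even b b-even)
          b≡ = proj₂ (sgnᶻ-even b b-even)

      -- Halving the two even entries turns s² + ax = n into b² + 4ac = n; the weight is halved as
      -- well, whence the factor 2.
      ∑E : ∑ E first ≡ + 2 * formSum (+ n)
      ∑E = trans (sym (∑-bij (forms 3 (+ n)) E f to inj surj (λ _ _ → refl))) (∑-* (+ 2) (forms 3 (+ n)) third)
        where
        f : Triple → Triple
        f (a , b , c) = + 2 * c , b , + 2 * a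
        disc : ∀ a b c → b * b + + 1 * (+ 2 * c * (+ 2 * a)) ≡ b * b + + 4 * (a * c)
        disc = solve-∀
        to : ∀ {z} → Form 4 (+ n) z → Form 1 (+ n) (f z) × BothEven (f z)
        to {a , b , c} (form (0<a , 0<c) eq) =
          form (*-pos {+ 2} (+<+ (s≤s z≤n)) 0<c , *-pos {+ 2} (+<+ (s≤s z≤n)) 0<a) (trans (disc a b c) eq) ,
          sgnᶻ-double c , sgnᶻ-double a
        inj : ∀ {y z} → Form 4 (+ n) y → Form 4 (+ n) z → f y ≡ f z → y ≡ z
        inj {a , _ , c} {a′ , _ , c′} _ _ eq = cong₂ (λ a (b , c) → a , b , c) (ℤ.*-cancelˡ-≡ (+ 2) a a′ (cong third eq))
          (cong₂ _,_ (cong (λ z → proj₁ (proj₂ z)) eq) (ℤ.*-cancelˡ-≡ (+ 2) c c′ (cong proj₁ eq)))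
        surj : ∀ {z} → Form 1 (+ n) z × BothEven z → ∃ λ y → Form 4 (+ n) y × f y ≡ z
        surj {c , b , a} (form (0<c , 0<a) eq , c-even , a-even) =
          (proj₁ (half a a-even) , b , proj₁ (half c c-even)) ,
          form (halve (proj₂ (half a a-even)) 0<a , halve (proj₂ (half c c-even)) 0<c)
            (trans (sym (disc (proj₁ (half a a-even)) b (proj₁ (half c c-even))))
              (trans (cong₂ (λ c a → b * b + + 1 * (c * a)) (sym (proj₂ (half c c-even))) (sym (proj₂ (half a a-even)))) eq)) ,
          cong₂ (λ c a → c , b , a) (sym (proj₂ (half c c-even))) (sym (proj₂ (half a a-even)))
          where
          half = sgnᶻ-even
          halve : ∀ {i j} → i ≡ + 2 * j → 0ℤ < i → 0ℤ < j
          halve {_} {j} refl 0<2j = *-pos⁻ {j} {+ 2} (+<+ (s≤s z≤n)) (subst (0ℤ <_) (ℤ.*-comm (+ 2) j) 0<2j)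

    φ⊛signedσ : (φ ⊛ signedσ) n ≡ sgn n * (+ 4 * formSum (+ n) - formSum (+ (4 ℕ.* n)))
    φ⊛signedσ = begin
      (φ ⊛ signedσ) n
        ≡⟨ φ⊛-∑ signedσ-generates n w (λ _ _ _ → refl) ⟩
      ∑ T w
        ≡⟨ ∑-∩ T bothEven? O w ⟩
      ∑ E w + ∑ O w
        ≡⟨ cong₂ _+_ (trans (∑-cong E w-even) (∑-* (sgn n) E first)) (trans (∑-cong O w-odd) (∑-* (- sgn n) O first)) ⟩
      sgn n * ∑ E first + - sgn n * ∑ O first
        ≡⟨ regroup (sgn n) (∑ E first) (∑ O first) ⟩
      sgn n * (+ 2 * ∑ E first - (∑ E first + ∑ O first))
        ≡⟨ cong₂ (λ e t → sgn n * (+ 2 * e - t)) ∑E (trans (sym (∑-∩ T bothEven? O first)) ∑T) ⟩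
      sgn n * (+ 2 * (+ 2 * formSum (+ n)) - formSum (+ (4 ℕ.* n)))
        ≡⟨ cong (λ t → sgn n * (t - formSum (+ (4 ℕ.* n)))) (sym (ℤ.*-assoc (+ 2) (+ 2) (formSum (+ n)))) ⟩
      sgn n * (+ 4 * formSum (+ n) - formSum (+ (4 ℕ.* n))) ∎
      where
      regroup : ∀ s e o → s * e + - s * o ≡ s * (+ 2 * e - (e + o))
      regroup = solve-∀

  open ThreeDissection φ p̄-series logDerivative (section 1 φ) φ₀ refl refl θ-φ θ-p̄ φ-dissection logDerivative-hecke₃

  -- The constant term of `eisenstein` contributes φ(n), which is 0 for nonsquare n; only φ times
  -- the signed divisor sum remains, and 9h is the error of `p₀≡φ⁵`.
  p̄[3n] : ∀ n → (∀ b → b * b ≢ + n) →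
          ∃ λ h → + p̄ (n ℕ.* 3) ≡ - + 8 * (sgn n * (+ 4 * formSum (+ n) - formSum (+ (4 ℕ.* n)))) + + 9 * h
  p̄[3n] n nonsquare = h n , (begin
    + p̄ (n ℕ.* 3)
      ≡⟨ section-at 0 p̄-series n ⟨
    section 0 p̄-series n
      ≡⟨ at (proj₂ p₀≡φ⁵) n ⟩
    (φ ⊛ fourth) n + (const (+ 9) ⊛ h) n
      ≡⟨ cong₂ _+_ (at (⊛-congʳ {φ} (fourth-unique eisenstein eisenstein₀ θ-eisenstein)) n) (const-⊛ (+ 9) h n) ⟩
    (φ ⊛ eisenstein) n + + 9 * h n
      ≡⟨ cong (_+ + 9 * h n) (at (solve 2 (λ f g → f :* (con 1ℤ :+ con (- + 8) :* g) := f :+ con (- + 8) :* (f :* g)) ≈-refl φ signedσ) n) ⟩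
    φ n + (const (- + 8) ⊛ (φ ⊛ signedσ)) n + + 9 * h n
      ≡⟨ cong₂ (λ x y → x + y + + 9 * h n) φn≡0 (trans (const-⊛ (- + 8) (φ ⊛ signedσ) n) (cong (- + 8 *_) (φ⊛signedσ n))) ⟩
    0ℤ + - + 8 * (sgn n * (+ 4 * formSum (+ n) - formSum (+ (4 ℕ.* n)))) + + 9 * h n
      ≡⟨ cong (_+ + 9 * h n) (ℤ.+-identityˡ (- + 8 * (sgn n * (+ 4 * formSum (+ n) - formSum (+ (4 ℕ.* n)))))) ⟩
    - + 8 * (sgn n * (+ 4 * formSum (+ n) - formSum (+ (4 ℕ.* n)))) + + 9 * h n ∎)
    where
    open Solver
    h : Series
    h = proj₁ p₀≡φ⁵
    φn≡0 : φ n ≡ 0ℤ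
    φn≡0 = ∑-empty (rootsOf n) λ s (_ , eq) → nonsquare s (trans (i*i≡+∣i∣² s) (cong +_ eq))

  module _ (p : ℕ) (prime : Prime p) (3≤p : 3 ℕ.≤ p) where

    open PrimeArithmetic p prime 3≤p

    module Tower (M : ℤ) (P∤M : ¬ P ∣ M) where

      -- D k = p^(2k+1) M: the odd exponent of p keeps all of these discriminants nonsquare.
      D : ℕ → ℤ
      D zero    = P * M
      D (suc k) = P * P * D k

      P∣D : ∀ k → P ∣ D k
      P∣D zero    = ∣m⇒∣m*n {P} {P} M ∣-refl
      P∣D (suc k) = ∣n⇒∣m*n (P * P) (P∣D k)

      -- Descent: p | b strips a factor p² from both sides, until p² would divide pM.
      D-nonsquare : ∀ k b → b * b ≢ D k
      D-nonsquare k b eq = descend k (∣-square {b} (subst (P ∣_) (sym eq) (P∣D k))) eq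
        where
        square : ∀ b P → b * P * (b * P) ≡ P * (b * b * P)
        square = solve-∀
        square′ : ∀ b P → b * P * (b * P) ≡ P * P * (b * b)
        square′ = solve-∀
        descend : ∀ k {b} → P ∣ b → b * b ≢ D k
        descend zero    (divides b refl) eq =
          P∤M (divides (b * b) (sym (ℤ.*-cancelˡ-≡ P (b * b * P) M (trans (sym (square b P)) eq))))
        descend (suc k) (divides b refl) eq = D-nonsquare k b (cancel-P² (trans (sym (square′ b P)) eq))

      G : ℕ → ℤ
      G k = formSum (D k)

      -- p² does not divide pM, so the recursion starts with F(D / p²) = 0.
      none : Finite (DividedForm (P * P) (D 0))
      none = empty λ { (a , b , c) (form _ eq) → P∤M (divides (b * b + + 4 * (a * c))
        (sym (ℤ.*-cancelˡ-≡ P ((b * b + + 4 * (a * c)) * P) M (trans (move P (b * b + + 4 * (a * c))) eq)))) }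
        where
        move : ∀ P x → P * (x * P) ≡ P * P * x
        move = solve-∀

      G₁ : G 1 ≡ (P * P * P + 1ℤ) * G 0
      G₁ = trans (sym (trans (cong (λ t → G 1 + P * (P * P * t)) (∑-elements none third)) (vanish (G 1) P)))
        (Hecke.hecke p prime 3≤p (D 0) (D-nonsquare 0) (P∣D 0) none)
        where
        vanish : ∀ g P → g + P * (P * P * 0ℤ) ≡ g
        vanish = solve-∀

      G₊₂ : ∀ k → G (suc (suc k)) + P * (P * P * G k) ≡ (P * P * P + 1ℤ) * G (suc k)
      G₊₂ k = trans (cong (λ t → G (suc (suc k)) + P * (P * P * t)) (∑-indep-relabel))
        (Hecke.hecke p prime 3≤p (D (suc k)) (D-nonsquare (suc k)) (P∣D (suc k)) divided)
        where
        divided : Finite (DividedForm (P * P) (D (suc k)))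
        divided = relabel (λ { (form pos eq) → form pos (cong (P * P *_) eq) }) (λ { (form pos eq) → form pos (cancel-P² eq) })
          (forms 3 (D k))
        ∑-indep-relabel : G k ≡ ∑ divided third
        ∑-indep-relabel = ∑-inverse (forms 3 (D k)) divided (λ z → z) (λ z → z)
          (λ { (form pos eq) → form pos (cong (P * P *_) eq) }) (λ { (form pos eq) → form pos (cancel-P² eq) })
          (λ _ _ → refl) (λ _ _ → refl) (λ _ _ → refl)

      -- For p³ ≡ 1 (mod 9) the recursion is G(k + 2) ≡ 2 G(k + 1) - G(k), that of an arithmetic
      -- progression, with G 1 ≡ 2 G 0. Two consecutive values are carried because the recursion has
      -- order two.
      residue₁ : ∀ {c} → P * P * P ≡ 1ℤ + + 9 * c → ∀ k →
                 (∃ λ x → G k ≡ + suc k * G 0 + + 9 * x) × (∃ λ x → G (suc k) ≡ + suc (suc k) * G 0 + + 9 * x)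
      residue₁ {c} P³ zero = (0ℤ , start (G 0)) , c * G 0 ,
        trans G₁ (trans (cong (λ t → (t + 1ℤ) * G 0) P³) (next c (G 0)))
        where
        start : ∀ g → g ≡ 1ℤ * g + + 9 * 0ℤ
        start = solve-∀
        next : ∀ c g → (1ℤ + + 9 * c + 1ℤ) * g ≡ + 2 * g + + 9 * (c * g)
        next = solve-∀
      residue₁ {c} P³ (suc k) = (x , eqx) , _ , (begin
        G (suc (suc k))
          ≡⟨ isolate (G (suc (suc k))) P (G k) ⟩
        (G (suc (suc k)) + P * (P * P * G k)) - P * P * P * G k
          ≡⟨ cong₂ (λ s t → s - t * G k) (G₊₂ k) P³ ⟩
        (P * P * P + 1ℤ) * G (suc k) - (1ℤ + + 9 * c) * G k
          ≡⟨ cong (λ t → (t + 1ℤ) * G (suc k) - (1ℤ + + 9 * c) * G k) P³ ⟩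
        (1ℤ + + 9 * c + 1ℤ) * G (suc k) - (1ℤ + + 9 * c) * G k
          ≡⟨ cong₂ (λ s t → (1ℤ + + 9 * c + 1ℤ) * s - (1ℤ + + 9 * c) * t)
               (trans eqx (cong (λ K → K * G 0 + + 9 * x) (ℤ.pos-+ 2 k))) (trans eqy (cong (λ K → K * G 0 + + 9 * y) (ℤ.pos-+ 1 k))) ⟩
        (1ℤ + + 9 * c + 1ℤ) * ((+ 2 + + k) * G 0 + + 9 * x) - (1ℤ + + 9 * c) * ((1ℤ + + k) * G 0 + + 9 * y)
          ≡⟨ collect c (+ k) (G 0) x y ⟩
        (+ 3 + + k) * G 0 + + 9 * (+ 2 * x - y + c * (G 0 + + 9 * x - + 9 * y))
          ≡⟨ cong (λ K → K * G 0 + + 9 * (+ 2 * x - y + c * (G 0 + + 9 * x - + 9 * y))) (ℤ.pos-+ 3 k) ⟨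
        + suc (suc (suc k)) * G 0 + + 9 * (+ 2 * x - y + c * (G 0 + + 9 * x - + 9 * y)) ∎)
        where
        ih  = residue₁ {c} P³ k
        y   = proj₁ (proj₁ ih)
        x   = proj₁ (proj₂ ih)
        eqy = proj₂ (proj₁ ih)
        eqx = proj₂ (proj₂ ih)
        isolate : ∀ s P t → s ≡ (s + P * (P * P * t)) - P * P * P * t
        isolate = solve-∀
        collect : ∀ c k g x y → (1ℤ + + 9 * c + 1ℤ) * ((+ 2 + k) * g + + 9 * x) - (1ℤ + + 9 * c) * ((1ℤ + k) * g + + 9 * y) ≡
                  (+ 3 + k) * g + + 9 * (+ 2 * x - y + c * (g + + 9 * x - + 9 * y))
        collect = solve-∀

      -- For p³ ≡ -1 (mod 9) the eigenvalue p³ + 1 vanishes, so G 1 ≡ 0 and G(k + 2) ≡ G(k).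
      residue₂ : ∀ {c} → P * P * P ≡ -1ℤ + + 9 * c → ∀ k → + 9 ∣ G (suc (k ℕ.* 2))
      residue₂ {c} P³ zero = divides (c * G 0) (trans G₁ (trans (cong (λ t → (t + 1ℤ) * G 0) P³) (start c (G 0))))
        where
        start : ∀ c g → (-1ℤ + + 9 * c + 1ℤ) * g ≡ c * g * + 9
        start = solve-∀
      residue₂ {c} P³ (suc k) = subst (+ 9 ∣_) (sym (begin
        G (suc (suc m))
          ≡⟨ isolate (G (suc (suc m))) P (G m) ⟩
        (G (suc (suc m)) + P * (P * P * G m)) - P * P * P * G m
          ≡⟨ cong (_- P * P * P * G m) (G₊₂ m) ⟩
        (P * P * P + 1ℤ) * G (suc m) - P * P * P * G m
          ≡⟨ cong (λ t → (t + 1ℤ) * G (suc m) - t * G m) P³ ⟩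
        (-1ℤ + + 9 * c + 1ℤ) * G (suc m) - (-1ℤ + + 9 * c) * G m
          ≡⟨ collect c (G (suc m)) (G m) ⟩
        + 9 * (c * G (suc m) - c * G m) + G m ∎))
        (∣m∣n⇒∣m+n (∣m⇒∣m*n {+ 9} {+ 9} (c * G (suc m) - c * G m) ∣-refl) (residue₂ {c} P³ k))
        where
        m = suc (k ℕ.* 2)
        isolate : ∀ s P t → s ≡ (s + P * (P * P * t)) - P * P * P * t
        isolate = solve-∀
        collect : ∀ c s t → (-1ℤ + + 9 * c + 1ℤ) * s - (-1ℤ + + 9 * c) * t ≡ + 9 * (c * s - c * t) + t
        collect = solve-∀

      -- The factor k + 1 of G 0 is 3 (α + 1) for k = 3α + 2; in the next lemma it is 9 (α + 1) for
      -- k = 9α + 8.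
      residue₁-∣3 : ∀ {c} → P * P * P ≡ 1ℤ + + 9 * c → ∀ α → + 3 ∣ G (3 ℕ.* α ℕ.+ 2)
      residue₁-∣3 {c} P³ α = let x , eq = proj₁ (residue₁ {c} P³ (3 ℕ.* α ℕ.+ 2)) in
        subst (+ 3 ∣_) (sym eq) (∣m∣n⇒∣m+n (∣m⇒∣m*n {+ 3} {+ suc (3 ℕ.* α ℕ.+ 2)} (G 0) (∣ᵤ⇒∣ (ℕ.divides (suc α) (multiple α)))) (∣m⇒∣m*n {+ 3} {+ 9} x (divides (+ 3) refl)))
        where
        multiple : ∀ α → suc (3 ℕ.* α ℕ.+ 2) ≡ suc α ℕ.* 3
        multiple = ℕ-Solver.solve-∀

      residue₁-∣9 : ∀ {c} → P * P * P ≡ 1ℤ + + 9 * c → ∀ α → + 9 ∣ G (9 ℕ.* α ℕ.+ 8)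
      residue₁-∣9 {c} P³ α = let x , eq = proj₁ (residue₁ {c} P³ (9 ℕ.* α ℕ.+ 8)) in
        subst (+ 9 ∣_) (sym eq) (∣m∣n⇒∣m+n (∣m⇒∣m*n {+ 9} {+ suc (9 ℕ.* α ℕ.+ 8)} (G 0) (∣ᵤ⇒∣ (ℕ.divides (suc α) (multiple α)))) (∣m⇒∣m*n {+ 9} {+ 9} x ∣-refl))
        where
        multiple : ∀ α → suc (9 ℕ.* α ℕ.+ 8) ≡ suc α ℕ.* 9
        multiple = ℕ-Solver.solve-∀

    cube≡1 : p % 3 ≡ 1 → ∃ λ c → P * P * P ≡ 1ℤ + + 9 * c
    cube≡1 p≡1 = m + + 3 * (m * m) + + 3 * (m * m * m) , trans (cong (λ x → x * x * x) P≡) (expand m)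
      where
      m : ℤ
      m = + (p / 3)
      P≡ : P ≡ 1ℤ + + (p / 3) * + 3
      P≡ = trans (cong +_ (trans (m≡m%n+[m/n]*n p 3) (cong (ℕ._+ p / 3 ℕ.* 3) p≡1)))
        (trans (ℤ.pos-+ 1 (p / 3 ℕ.* 3)) (cong (_+_ 1ℤ) (ℤ.pos-* (p / 3) 3)))
      expand : ∀ m → (1ℤ + m * + 3) * (1ℤ + m * + 3) * (1ℤ + m * + 3) ≡ 1ℤ + + 9 * (m + + 3 * (m * m) + + 3 * (m * m * m))
      expand = solve-∀

    cube≡2 : p % 3 ≡ 2 → ∃ λ c → P * P * P ≡ -1ℤ + + 9 * c
    cube≡2 p≡2 = 1ℤ + + 4 * m + + 6 * (m * m) + + 3 * (m * m * m) , trans (cong (λ x → x * x * x) P≡) (expand m)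
      where
      m : ℤ
      m = + (p / 3)
      P≡ : P ≡ + 2 + + (p / 3) * + 3
      P≡ = trans (cong +_ (trans (m≡m%n+[m/n]*n p 3) (cong (ℕ._+ p / 3 ℕ.* 3) p≡2)))
        (trans (ℤ.pos-+ 2 (p / 3 ℕ.* 3)) (cong (_+_ (+ 2)) (ℤ.pos-* (p / 3) 3)))
      expand : ∀ m → (+ 2 + m * + 3) * (+ 2 + m * + 3) * (+ 2 + m * + 3) ≡
               -1ℤ + + 9 * (1ℤ + + 4 * m + + 6 * (m * m) + + 3 * (m * m * m))
      expand = solve-∀

    module _ (N : ℕ) (P∤N : ¬ P ∣ + N) where

      P∤4N : ¬ P ∣ + (4 ℕ.* N)
      P∤4N = subst (λ x → ¬ P ∣ x) (sym (ℤ.pos-* 4 N)) (P∤* P∤4 P∤N)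

      module N₁ = Tower (+ N) P∤N
      module N₄ = Tower (+ (4 ℕ.* N)) P∤4N

      odd-power : ℕ → ℕ
      odd-power k = p ℕ.^ suc (k ℕ.* 2) ℕ.* N

      D₁≡ : ∀ k → N₁.D k ≡ + odd-power k
      D₁≡ zero    = trans (sym (ℤ.pos-* p N)) (cong (λ q → + (q ℕ.* N)) (sym (ℕ.*-identityʳ p)))
      D₁≡ (suc k) = begin
        P * P * N₁.D k                       ≡⟨ cong₂ _*_ (sym (ℤ.pos-* p p)) (D₁≡ k) ⟩
        + (p ℕ.* p) * + odd-power k          ≡⟨ ℤ.pos-* (p ℕ.* p) (odd-power k) ⟨
        + (p ℕ.* p ℕ.* odd-power k)          ≡⟨ cong +_ (associate p (p ℕ.^ suc (k ℕ.* 2)) N) ⟩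
        + odd-power (suc k)                  ∎
        where
        associate : ∀ p q n → p ℕ.* p ℕ.* (q ℕ.* n) ≡ p ℕ.* (p ℕ.* q) ℕ.* n
        associate = ℕ-Solver.solve-∀

      D₄≡ : ∀ k → N₄.D k ≡ + (4 ℕ.* odd-power k)
      D₄≡ k = trans (scale k) (trans (cong (+ 4 *_) (D₁≡ k)) (sym (ℤ.pos-* 4 (odd-power k))))
        where
        exchange : ∀ P x → P * P * (+ 4 * x) ≡ + 4 * (P * P * x)
        exchange = solve-∀
        exchange₀ : ∀ P x → P * (+ 4 * x) ≡ + 4 * (P * x)
        exchange₀ = solve-∀
        scale : ∀ k → N₄.D k ≡ + 4 * N₁.D k
        scale zero    = trans (cong (P *_) (ℤ.pos-* 4 N)) (exchange₀ P (+ N))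
        scale (suc k) = trans (cong (P * P *_) (scale k)) (exchange P (N₁.D k))

      -- For n = p^(2k+1) N the values F(n) and F(4n) lie in the towers over N and over 4N, both
      -- prime to p since p is odd.
      p̄-divisible : ∀ d .{{_ : ℕ.NonZero d}} k → + d ∣ + 9 → + d ∣ N₁.G k → + d ∣ N₄.G k →
                    p̄ (3 ℕ.* p ℕ.^ suc (k ℕ.* 2) ℕ.* N) % d ≡ 0
      p̄-divisible d k d∣9 d∣G₁ d∣G₄ = ℕ.n∣m⇒m%n≡0 _ d (∣⇒∣ᵤ (subst (λ m → + d ∣ + p̄ m) (reassociate (p ℕ.^ suc (k ℕ.* 2)) N)
        (subst (+ d ∣_) (sym (proj₂ formula)) (∣m∣n⇒∣m+n
          (∣n⇒∣m*n (- + 8) (∣n⇒∣m*n (sgn n) (∣m∣n⇒∣m-n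
            (∣n⇒∣m*n (+ 4) (subst (λ D → + d ∣ formSum D) (D₁≡ k) d∣G₁)) (subst (λ D → + d ∣ formSum D) (D₄≡ k) d∣G₄))))
          (∣m⇒∣m*n (proj₁ formula) d∣9)))))
        where
        n = odd-power k
        formula = p̄[3n] n λ b eq → N₁.D-nonsquare k b (trans eq (sym (D₁≡ k)))
        reassociate : ∀ q n → q ℕ.* n ℕ.* 3 ≡ 3 ℕ.* q ℕ.* n
        reassociate = ℕ-Solver.solve-∀

-- The residue classes 1 and 2 of p modulo 3

open import Data.Nat.Base using (ℕ; _+_; _*_; _^_; _≤_; _<_)
open import Data.Nat.DivMod using (_%_)
open import Data.Nat.Coprimality using (Coprime)
open import Data.Nat.Primality using (Prime)
open import Data.Integer.Divisibility.Signed using (_∣_; divides; ∣⇒∣ᵤ; ∣-refl)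
open Congruence using (cube≡1; cube≡2; P∤4N; p̄-divisible; module Tower)

theorem6 : (p : ℕ) → Prime p → 3 ≤ p →
    (N : ℕ) → 0 < N → Coprime N p → (α : ℕ) →
    (p % 3 ≡ 1 →
    p̄ (3 * p ^ (6 * α + 5) * N) % 3 ≡ 0 × p̄ (3 * p ^ (18 * α + 17) * N) % 9 ≡ 0) ×
    (p % 3 ≡ 2 →
    p̄ (3 * p ^ (4 * α + 3) * N) % 9 ≡ 0)
theorem6 p p-prime 3≤p N _ coprime α =
  (λ p≡1 → let c , P³ = cube≡1 p p-prime 3≤p p≡1 in
      divisible 3 (3 * α + 2) (6 * α + 5) (exponent₆ α) (divides (+ 3) refl)
        (T₁.residue₁-∣3 {c} P³ α) (T₄.residue₁-∣3 {c} P³ α)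
    , divisible 9 (9 * α + 8) (18 * α + 17) (exponent₁₈ α) ∣-refl
        (T₁.residue₁-∣9 {c} P³ α) (T₄.residue₁-∣9 {c} P³ α)) ,
  (λ p≡2 → let c , P³ = cube≡2 p p-prime 3≤p p≡2 in
      divisible 9 (suc (α * 2)) (4 * α + 3) (exponent₄ α) ∣-refl
        (T₁.residue₂ {c} P³ α) (T₄.residue₂ {c} P³ α))
  where
  P∤N : ¬ + p ∣ + N
  -- If p divided N, coprimality applied to the common divisor p would give p = 1.
  P∤N d = contradiction (subst (3 ≤_) (coprime (∣⇒∣ᵤ d , ℕ.∣-refl)) 3≤p) λ { (s≤s ()) }
  module T₁ = Tower p p-prime 3≤p (+ N) P∤N
  module T₄ = Tower p p-prime 3≤p (+ (4 * N)) (P∤4N p p-prime 3≤p N P∤N)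
  divisible : ∀ d .{{_ : ℕ.NonZero d}} k e → suc (k * 2) ≡ e → + d ∣ + 9 → + d ∣ T₁.G k → + d ∣ T₄.G k →
              p̄ (3 * p ^ e * N) % d ≡ 0
  divisible d k e refl = p̄-divisible p p-prime 3≤p N P∤N d k
  exponent₆ : ∀ α → suc ((3 * α + 2) * 2) ≡ 6 * α + 5
  exponent₆ = ℕ-Solver.solve-∀
  exponent₁₈ : ∀ α → suc ((9 * α + 8) * 2) ≡ 18 * α + 17
  exponent₁₈ = ℕ-Solver.solve-∀
  exponent₄ : ∀ α → suc (suc (α * 2) * 2) ≡ 4 * α + 3
  exponent₄ = ℕ-Solver.solve-∀
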